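{- Let $\kappa\in\{\mathsf{pre},\mathsf{Kan}\}$, let $i\le j$ be natural numbers, let $\Psi$ be a finite set of dimension names, and let $A,B$ be terms with no free term variables and free dimension names in $\Psi$. Relative to the cubical type system $\tau^{\mathsf{pre}}_\omega$: if $A\doteq B\in\mathcal U^\kappa_i\,[\Psi]$ then $A\doteq B\in\mathcal U^\kappa_j\,[\Psi]$.
   Context: **Syntax.** A dimension $r$ is a constant $0$ or $1$ or a dimension name ($x,y,z,w,\dots$); $\varepsilon$ ranges over $\{0,1\}$ and $\bar\varepsilon$ is the opposite constant. Terms (with term variables $a,b,c,f,n,\dots$; indices $j\in\mathbb N$) are: variables, $(a{:}A)\to B$, $(a{:}A)\times B$, $\mathsf{Path}_{x.A}(M,N)$, $\mathsf{Eq}_A(M,N)$, $\mathsf{void}$, $\mathsf{nat}$, $\mathsf{bool}$, $\mathsf{wbool}$, $\mathbb S^1$, $\mathcal U^{\mathsf{pre}}_j$, $\mathcal U^{\mathsf{Kan}}_j$, $\mathsf V_r(A,B,E)$, $\mathsf{Vin}_r(M,N)$, $\mathsf{Vproj}_r(M,F)$, $\lambda a.M$, $\mathsf{app}(M,N)$, $\langle M,N\rangle$, $\mathsf{fst}(M)$, $\mathsf{snd}(M)$, $\langle x\rangle M$, $M@r$, $\star$, $\mathsf z$, $\mathsf s(M)$, $\mathsf{natrec}(M;N_1,n.a.N_2)$, $\mathsf{true}$, $\mathsf{false}$, $\mathsf{if}_{b.A}(M;N_1,N_2)$, $\mathsf{base}$, $\mathsf{loop}_r$, $\mathbb S^1\text{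 - }\mathsf{elim}_{c.A}(M;N_1,x.N_2)$, $\mathsf{coe}_{x.A}^{r\rightsquigarrow r'}(M)$, $\mathsf{hcom}_A^{r\rightsquigarrow r'}(M;T)$, $\mathsf{com}_{y.A}^{r\rightsquigarrow r'}(M;T)$, $\mathsf{fcom}^{r\rightsquigarrow r'}(M;T)$, $\mathsf{ghcom}_A^{r\rightsquigarrow r'}(M;T)$, $\mathsf{gcom}_{y.A}^{r\rightsquigarrow r'}(M;T)$, $\mathsf{box}^{r\rightsquigarrow r'}(M;\xi_i\hookrightarrow N_i)$, $\mathsf{cap}^{r\leftarrow r'}(M;T)$. Here $T$ is a finite, possibly empty list of entries $\xi_i\hookrightarrow y.N_i$, where $\xi_i$ abbreviates the equation $r_i=r_i'$ of dimensions; a displayed entry with index $i$ (or $j$) stands for the whole list, and an entry mentioning a free $\varepsilon$ for the two entries $\varepsilon=0,1$. A dot binds the preceding dimension names or variables ($x.$, $y.$, $a.$, ...), $\langle x\rangle M$ binds $x$ in $M$, and $a$ is bound in $B$ in $(a{:}A)\to B$, $(a{:}A)\times B$. $A\to B$ and $A\times B$ are the nondependent cases. $\mathsf{FD}(M)$ is the set of free dimension names; $M\langle r/x\rangle$ is dimension substitution, $M[N/a]$ term substitution. $M\ \mathsf{tm}\,[\Psi]$ means $M$ has no free term variables and $\mathsf{FD}(M)\subseteq\Psi$; $x\#\xi$ means $x$ does not occur in $\xi$. A dimension substitution $\psi:\Psi'\to\Psi$ assigns to each name in $\Psi$ either $0$, $1$ or a name in $\Psi'$; $M\psi$ is its action,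 $\psi_1\psi_2$ is first $\psi_1$ then $\psi_2$. **Operational semantics** (on terms with no free term variables; $M\ \mathsf{val}$ and $M\longmapsto M'$ are the least relations given by the following; $r\ne r'$ is syntactic). $M\Downarrow V$ means $M\longmapsto^*V$ and $V\ \mathsf{val}$. *Values:* $(a{:}A)\to B$, $(a{:}A)\times B$, $\mathsf{Path}_{x.A}(M,N)$, $\mathsf{Eq}_A(M,N)$, $\mathsf{void},\mathsf{nat},\mathsf{bool},\mathsf{wbool},\mathbb S^1,\mathcal U^{\mathsf{pre}}_j,\mathcal U^{\mathsf{Kan}}_j$, $\mathsf V_x(A,B,E)$ ($x$ a name), $\lambda a.M$, $\langle M,N\rangle$, $\langle x\rangle M$, $\star$, $\mathsf z$, $\mathsf s(M)$, $\mathsf{true},\mathsf{false},\mathsf{base}$, $\mathsf{loop}_x$, $\mathsf{Vin}_x(M,N)$ ($x$ a name), and $\mathsf{fcom}^{r\rightsquigarrow r'}(M;r_i=r_i'\hookrightarrow y.N_i)$, $\mathsf{box}^{r\rightsquigarrow r'}(M;r_i=r_i'\hookrightarrow N_i)$ when $r\ne r'$ and $r_i\neq r_i'$ for all $i$. *Congruence:* if $A\longmapsto A'$ then $\mathsf{hcom}_A^{r\rightsquigarrow r'}(M;T)\longmapsto\mathsf{hcom}_{A'}^{r\rightsquigarrow r'}(M;T)$ and $\mathsf{coe}_{x.A}^{r\rightsquigarrow r'}(M)\longmapsto\mathsf{coe}_{x.A'}^{r\rightsquigarrow r'}(M)$; if $M\longmapsto M'$ then the principal argument $M$ may be replaced by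 $M'$ in $\mathsf{app}(M,N)$, $\mathsf{fst}(M)$, $\mathsf{snd}(M)$, $M@r$, $\mathsf{natrec}(M;\ldots)$, $\mathsf{if}_{b.A}(M;\ldots)$, $\mathbb S^1\text{ - }\mathsf{elim}_{c.A}(M;\ldots)$, $\mathsf{Vproj}_x(M,F)$ ($x$ a name), and $\mathsf{cap}^{r\leftarrow r'}(M;r_i=r_i'\hookrightarrow y.B_i)$ provided $r\neq r'$ and $r_i\ne r_i'$ for all $i$. *General Kan operations:* - $\mathsf{com}_{y.A}^{r\rightsquigarrow r'}(M;\xi_i\hookrightarrow y.N_i)\longmapsto\mathsf{hcom}_{A\langle r'/y\rangle}^{r\rightsquigarrow r'}(\mathsf{coe}_{y.A}^{r\rightsquigarrow r'}(M);\xi_i\hookrightarrow y.\mathsf{coe}_{y.A}^{y\rightsquigarrow r'}(N_i))$; $\mathsf{gcom}$ steps likewise with $\mathsf{ghcom}$ for $\mathsf{hcom}$. - $\mathsf{fcom}^{r\rightsquigarrow r'}(M;T)\longmapsto M$ if $r=r'$; $\longmapsto N_j\langle r'/y\rangle$ if $r\ne r'$ and $j$ is least with $r_j=r_j'$. - $\mathsf{ghcom}_A^{r\rightsquigarrow r'}(M;\cdot)\longmapsto M$; $\mathsf{ghcom}_A^{r\rightsquigarrow r'}(M;s=s'\hookrightarrow y.N,\xi_i\hookrightarrow y.N_i)\longmapsto\mathsf{hcom}_A^{r\rightsquigarrow r'}(M;s=\varepsilon\hookrightarrow z.T_\varepsilon,\,s=s'\hookrightarrow y.N,\,\xi_i\hookrightarrow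 y.N_i)$ with $T_\varepsilon=\mathsf{hcom}_A^{r\rightsquigarrow z}(M;s'=\varepsilon\hookrightarrow y.N,\,s'=\bar\varepsilon\hookrightarrow y.\mathsf{ghcom}_A^{r\rightsquigarrow y}(M;\xi_i\hookrightarrow y.N_i),\,\xi_i\hookrightarrow y.N_i)$. *Functions:* $\mathsf{app}(\lambda a.M,N)\longmapsto M[N/a]$; $\mathsf{hcom}_{(a:A)\to B}^{r\rightsquigarrow r'}(M;\xi_i\hookrightarrow y.N_i)\longmapsto\lambda a.\mathsf{hcom}_B^{r\rightsquigarrow r'}(\mathsf{app}(M,a);\xi_i\hookrightarrow y.\mathsf{app}(N_i,a))$; $\mathsf{coe}_{x.(a:A)\to B}^{r\rightsquigarrow r'}(M)\longmapsto\lambda a.\mathsf{coe}_{x.B[\mathsf{coe}_{x.A}^{r'\rightsquigarrow x}(a)/a]}^{r\rightsquigarrow r'}(\mathsf{app}(M,\mathsf{coe}_{x.A}^{r'\rightsquigarrow r}(a)))$. *Pairs:* $\mathsf{fst}(\langle M,N\rangle)\longmapsto M$; $\mathsf{snd}(\langle M,N\rangle)\longmapsto N$; $\mathsf{hcom}_{(a:A)\times B}^{r\rightsquigarrow r'}(M;\xi_i\hookrightarrow y.N_i)\longmapsto\langle\mathsf{hcom}_A^{r\rightsquigarrow r'}(\mathsf{fst}(M);\xi_i\hookrightarrow y.\mathsf{fst}(N_i)),\ \mathsf{com}_{z.B[F/a]}^{r\rightsquigarrow r'}(\mathsf{snd}(M);\xi_i\hookrightarrow y.\mathsf{snd}(N_i))\rangle$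 with $F=\mathsf{hcom}_A^{r\rightsquigarrow z}(\mathsf{fst}(M);\xi_i\hookrightarrow y.\mathsf{fst}(N_i))$; $\mathsf{coe}_{x.(a:A)\times B}^{r\rightsquigarrow r'}(M)\longmapsto\langle\mathsf{coe}_{x.A}^{r\rightsquigarrow r'}(\mathsf{fst}(M)),\mathsf{coe}^{r\rightsquigarrow r'}_{x.B[\mathsf{coe}_{x.A}^{r\rightsquigarrow x}(\mathsf{fst}(M))/a]}(\mathsf{snd}(M))\rangle$. *Paths:* $(\langle x\rangle M)@r\longmapsto M\langle r/x\rangle$; $\mathsf{hcom}_{\mathsf{Path}_{x.A}(P_0,P_1)}^{r\rightsquigarrow r'}(M;\xi_i\hookrightarrow y.N_i)\longmapsto\langle x\rangle\mathsf{hcom}_A^{r\rightsquigarrow r'}(M@x;x=\varepsilon\hookrightarrow\_.P_\varepsilon,\,\xi_i\hookrightarrow y.N_i@x)$; $\mathsf{coe}_{y.\mathsf{Path}_{x.A}(P_0,P_1)}^{r\rightsquigarrow r'}(M)\longmapsto\langle x\rangle\mathsf{com}_{y.A}^{r\rightsquigarrow r'}(M@x;x=\varepsilon\hookrightarrow y.P_\varepsilon)$. *Equality:* $\mathsf{hcom}_{\mathsf{Eq}_A(E_0,E_1)}^{r\rightsquigarrow r'}(M;T)\longmapsto\star$. *Base types:* $\mathsf{natrec}(\mathsf z;Z,n.a.S)\longmapsto Z$; $\mathsf{natrec}(\mathsf s(M);Z,n.a.S)\longmapsto S[M/n][\mathsf{natrec}(M;Z,n.a.S)/a]$; $\mathsf{if}_{b.A}(\mathsf{true};T,F)\longmapsto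 T$; $\mathsf{if}_{b.A}(\mathsf{false};T,F)\longmapsto F$; $\mathsf{hcom}_{C}^{r\rightsquigarrow r'}(M;T)\longmapsto M$ for $C\in\{\mathsf{nat},\mathsf{bool}\}$; $\mathsf{coe}_{x.C}^{r\rightsquigarrow r'}(M)\longmapsto M$ for $C\in\{\mathsf{nat},\mathsf{bool},\mathsf{wbool},\mathbb S^1\}$; $\mathsf{hcom}_C^{r\rightsquigarrow r'}(M;T)\longmapsto\mathsf{fcom}^{r\rightsquigarrow r'}(M;T)$ for $C\in\{\mathsf{wbool},\mathbb S^1\}$; $\mathsf{loop}_\varepsilon\longmapsto\mathsf{base}$; $\mathbb S^1\text{ - }\mathsf{elim}_{c.A}(\mathsf{base};P,x.L)\longmapsto P$; $\mathbb S^1\text{ - }\mathsf{elim}_{c.A}(\mathsf{loop}_w;P,x.L)\longmapsto L\langle w/x\rangle$ ($w$ a name). If $r\ne r'$ and $r_i\neq r_i'$ for all $i$, with $H=\mathsf{fcom}^{r\rightsquigarrow z}(M;\xi_i\hookrightarrow y.N_i)$: $\mathsf{if}_{b.A}(\mathsf{fcom}^{r\rightsquigarrow r'}(M;\xi_i\hookrightarrow y.N_i);T,F)\longmapsto\mathsf{com}_{z.A[H/b]}^{r\rightsquigarrow r'}(\mathsf{if}_{b.A}(M;T,F);\xi_i\hookrightarrow y.\mathsf{if}_{b.A}(N_i;T,F))$, and $\mathbb S^1\text{ - }\mathsf{elim}_{c.A}(\mathsf{fcom}^{r\rightsquigarrow r'}(M;\xi_i\hookrightarrow y.N_i);P,x.L)\longmapsto\mathsf{com}_{z.A[H/c]}^{r\rightsquigarrow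 r'}(\mathbb S^1\text{ - }\mathsf{elim}_{c.A}(M;P,x.L);\xi_i\hookrightarrow y.\mathbb S^1\text{ - }\mathsf{elim}_{c.A}(N_i;P,x.L))$. *V types* ($x,y$ names): $\mathsf V_0(A,B,E)\longmapsto A$; $\mathsf V_1(A,B,E)\longmapsto B$; $\mathsf{Vin}_0(M,N)\longmapsto M$; $\mathsf{Vin}_1(M,N)\longmapsto N$; $\mathsf{Vproj}_0(M,F)\longmapsto\mathsf{app}(F,M)$; $\mathsf{Vproj}_1(M,F)\longmapsto M$; $\mathsf{Vproj}_x(\mathsf{Vin}_x(M,N),F)\longmapsto N$. - $\mathsf{hcom}_{\mathsf V_x(A,B,E)}^{r\rightsquigarrow r'}(M;\xi_i\hookrightarrow y.N_i)\longmapsto\mathsf{Vin}_x(O\langle r'/y\rangle,\mathsf{hcom}_B^{r\rightsquigarrow r'}(\mathsf{Vproj}_x(M,\mathsf{fst}(E));\xi_i\hookrightarrow y.\mathsf{Vproj}_x(N_i,\mathsf{fst}(E)),\,x=0\hookrightarrow y.\mathsf{app}(\mathsf{fst}(E),O),\,x=1\hookrightarrow y.\mathsf{hcom}_B^{r\rightsquigarrow y}(M;\xi_i\hookrightarrow y.N_i)))$ with $O=\mathsf{hcom}_A^{r\rightsquigarrow y}(M;\xi_i\hookrightarrow y.N_i)$. - $\mathsf{coe}_{x.\mathsf V_x(A,B,E)}^{0\rightsquigarrow r'}(M)\longmapsto\mathsf{Vin}_{r'}(M,\mathsf{coe}_{x.B}^{0\rightsquigarrow r'}(\mathsf{app}(\mathsf{fst}(E\langle0/x\rangle),M)))$.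 - $\mathsf{coe}_{x.\mathsf V_x(A,B,E)}^{1\rightsquigarrow r'}(N)\longmapsto\mathsf{Vin}_{r'}(\mathsf{fst}(O),P)$ with $O=\mathsf{fst}(\mathsf{app}(\mathsf{snd}(E\langle r'/x\rangle),\mathsf{coe}_{x.B}^{1\rightsquigarrow r'}(N)))$, $P=\mathsf{hcom}_{B\langle r'/x\rangle}^{1\rightsquigarrow0}(\mathsf{coe}_{x.B}^{1\rightsquigarrow r'}(N);r'=0\hookrightarrow y.\mathsf{snd}(O)@y,\,r'=1\hookrightarrow\_.\mathsf{coe}_{x.B}^{1\rightsquigarrow r'}(N))$. - $\mathsf{coe}_{x.\mathsf V_x(A,B,E)}^{y\rightsquigarrow r'}(M)\longmapsto\mathsf{Vin}_{r'}(\mathsf{fst}(R),\mathsf{hcom}_{B\langle r'/x\rangle}^{1\rightsquigarrow0}(P\langle r'/x\rangle;\,y=\varepsilon\hookrightarrow\_.O_\varepsilon\langle r'/w\rangle,\,y=r'\hookrightarrow\_.\mathsf{Vproj}_{r'}(M,\mathsf{fst}(E\langle r'/x\rangle)),\,r'=0\hookrightarrow z.\mathsf{snd}(R)@z))$ where $O_\varepsilon=\mathsf{Vproj}_w(\mathsf{coe}_{x.\mathsf V_x(A,B,E)}^{\varepsilon\rightsquigarrow w}(M),\mathsf{fst}(E\langle w/x\rangle))$; $P=\mathsf{com}_{x.B}^{y\rightsquigarrow x}(\mathsf{Vproj}_y(M,\mathsf{fst}(E\langle y/x\rangle));y=\varepsilon\hookrightarrow w.O_\varepsilon)$; $Q_\varepsilon[a]=\langle\mathsf{coe}_{y.A\langle0/x\rangle}^{\varepsilon\rightsquigarrow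 y}(a),\langle z\rangle\mathsf{com}_{y.B\langle0/x\rangle}^{\varepsilon\rightsquigarrow y}(P\langle0/x\rangle\langle\varepsilon/y\rangle;z=0\hookrightarrow y.\mathsf{app}(\mathsf{fst}(E\langle0/x\rangle),\mathsf{coe}_{y.A\langle0/x\rangle}^{\varepsilon\rightsquigarrow y}(a)),\,z=1\hookrightarrow y.P\langle0/x\rangle)\rangle$; $R=\mathsf{app}(\mathsf{app}(\mathsf{snd}(\mathsf{app}(\mathsf{snd}(E\langle0/x\rangle),P\langle0/x\rangle)),Q_0[M\langle0/y\rangle]),Q_1[(\mathsf{coe}_{x.\mathsf V_x(A,B,E)}^{1\rightsquigarrow0}(M))\langle1/y\rangle])@y$. - If $x\neq y$: $\mathsf{coe}_{y.\mathsf V_x(A,B,E)}^{r\rightsquigarrow r'}(M)\longmapsto\mathsf{Vin}_x(\mathsf{coe}_{y.A}^{r\rightsquigarrow r'}(M),\mathsf{com}_{y.B}^{r\rightsquigarrow r'}(\mathsf{Vproj}_x(M,\mathsf{fst}(E\langle r/y\rangle));x=0\hookrightarrow y.\mathsf{app}(\mathsf{fst}(E),\mathsf{coe}_{y.A}^{r\rightsquigarrow y}(M)),\,x=1\hookrightarrow y.\mathsf{coe}_{y.B}^{r\rightsquigarrow y}(M)))$. *Universes and composite types:* $\mathsf{hcom}_{\mathcal U^{\mathsf{Kan}}_j}^{r\rightsquigarrow r'}(M;T)\longmapsto\mathsf{fcom}^{r\rightsquigarrow r'}(M;T)$; $\mathsf{coe}_{x.\mathcal U^\kappa_j}^{r\rightsquigarrow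 r'}(M)\longmapsto M$ ($\kappa\in\{\mathsf{pre},\mathsf{Kan}\}$). - $\mathsf{box}^{r\rightsquigarrow r'}(M;\xi_i\hookrightarrow N_i)\longmapsto M$ if $r=r'$, $\longmapsto N_j$ if $r\neq r'$ and $j$ is least with $r_j=r_j'$. $\mathsf{cap}^{r\leftarrow r'}(M;\xi_i\hookrightarrow y.B_i)\longmapsto M$ if $r=r'$, $\longmapsto\mathsf{coe}_{y.B_j}^{r'\rightsquigarrow r}(M)$ if $r\ne r'$ and $j$ is least with $r_j=r_j'$. If $r\neq r'$ and all $r_i\neq r_i'$: $\mathsf{cap}^{r\leftarrow r'}(\mathsf{box}^{r\rightsquigarrow r'}(M;\xi_i\hookrightarrow N_i);\xi_i\hookrightarrow y.B_i)\longmapsto M$. - If $s\neq s'$, all $s_j\ne s_j'$: $\mathsf{hcom}_{\mathsf{fcom}^{s\rightsquigarrow s'}(A;s_j=s_j'\hookrightarrow z.B_j)}^{r\rightsquigarrow r'}(M;\xi_i\hookrightarrow y.N_i)\longmapsto\mathsf{box}^{s\rightsquigarrow s'}(Q;s_j=s_j'\hookrightarrow P_j\langle s'/z\rangle)$ where $P_j=\mathsf{hcom}_{B_j}^{r\rightsquigarrow r'}(\mathsf{coe}_{z.B_j}^{s'\rightsquigarrow z}(M);\xi_i\hookrightarrow y.\mathsf{coe}_{z.B_j}^{s'\rightsquigarrow z}(N_i))$; $F[c]=\mathsf{hcom}_A^{s'\rightsquigarrow z}(\mathsf{cap}^{s\leftarrow s'}(c;s_j=s_j'\hookrightarrow z.B_j);s_j=s_j'\hookrightarrow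 z'.\mathsf{coe}_{z.B_j}^{z'\rightsquigarrow s}(\mathsf{coe}_{z.B_j}^{s'\rightsquigarrow z'}(c)))$; $O=\mathsf{hcom}_A^{r\rightsquigarrow r'}((F[M])\langle s/z\rangle;\xi_i\hookrightarrow y.(F[N_i])\langle s/z\rangle)$; $Q=\mathsf{hcom}_A^{s\rightsquigarrow s'}(O;\xi_i\hookrightarrow z.F[N_i\langle r'/y\rangle],\,s_j=s_j'\hookrightarrow z.\mathsf{coe}_{z.B_j}^{z\rightsquigarrow s}(P_j),\,r=r'\hookrightarrow z.F[M])$. - If $s\neq s'$, all $s_i\neq s_i'$: $\mathsf{coe}_{x.\mathsf{fcom}^{s\rightsquigarrow s'}(A;s_i=s_i'\hookrightarrow z.B_i)}^{r\rightsquigarrow r'}(M)\longmapsto(\mathsf{box}^{s\rightsquigarrow s'}(\mathsf{hcom}_A^{s\rightsquigarrow s'}(P;s_i=s_i'\hookrightarrow z.\mathsf{coe}_{z.B_i}^{z\rightsquigarrow s}(Q_i),\,r=r'\hookrightarrow z.O);s_i=s_i'\hookrightarrow Q_i\langle s'/z\rangle))\langle r'/x\rangle$ where $N_i=\mathsf{coe}_{z.B_i}^{s'\rightsquigarrow z}(\mathsf{coe}_{x.B_i\langle s'/z\rangle}^{r\rightsquigarrow x}(M))$; $O=(\mathsf{hcom}_A^{s'\rightsquigarrow z}(\mathsf{cap}^{s\leftarrow s'}(M;s_i=s_i'\hookrightarrow z.B_i);s_i=s_i'\hookrightarrow z.\mathsf{coe}_{z.B_i}^{z\rightsquigarrow s}(N_i)))\langle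 r/x\rangle$; $P=\mathsf{gcom}_{x.A}^{r\rightsquigarrow r'}(O\langle s\langle r/x\rangle/z\rangle;\ s_i=s_i'\hookrightarrow x.N_i\langle s/z\rangle$ (only those $i$ with $x\#s_i,s_i'$)$,\ s=s'\hookrightarrow x.\mathsf{coe}_{x.A}^{r\rightsquigarrow x}(M)$ (only if $x\#s,s'$)$)$; $Q_k=\mathsf{gcom}_{z.B_k\langle r'/x\rangle}^{s\langle r'/x\rangle\rightsquigarrow z}(P;\ s_i=s_i'\hookrightarrow z.N_i\langle r'/x\rangle$ (only those $i$ with $x\#s_i,s_i'$)$,\ r=r'\hookrightarrow z.N_k\langle r'/x\rangle)$. **Type systems.** A candidate cubical type system is a relation $\tau(\Psi,A_0,B_0,\varphi)$ on values $A_0,B_0$ over $\Psi$ and binary relations $\varphi$ on values over $\Psi$. $R^{\Downarrow}$ denotes the lifting of a relation on values to terms by evaluation. A $\Psi$-relation $\alpha$ is a family $\alpha_\psi$ of binary relations on terms over $\Psi'$, indexed by $\psi:\Psi'\to\Psi$ ("over values" if only values are related); $\alpha$ alone means $\alpha_{\mathrm{id}}$; $(\alpha\psi)_{\psi'}=\alpha_{\psi\psi'}$. A context-indexed relation $R_\Psi$ gives a $\Psi$-relation $R(\Psi)$ by $R(\Psi)_\psi=R_{\Psi'}$. - $\mathsf{PTy}(\tau)(\Psi,A,B,\alpha)$ ($\alpha$ a $\Psi$-relation over values): for all $\psi:\Psi'\to\Psi$, $\tau^\Downarrow(\Psi',A\psi,B\psi,\alpha_\psi)$; and for all $\psi_1:\Psi_1\to\Psi$,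 $\psi_2:\Psi_2\to\Psi_1$: $A\psi_1\Downarrow A_1$, $B\psi_1\Downarrow B_1$ and, for some $\varphi$, $\tau^\Downarrow(\Psi_2,-,-,\varphi)$ relates $(A_1\psi_2,A\psi_1\psi_2)$, $(A\psi_1\psi_2,A_1\psi_2)$, $(B_1\psi_2,B\psi_1\psi_2)$, $(B\psi_1\psi_2,B_1\psi_2)$, $(A_1\psi_2,B_1\psi_2)$. - $\mathsf{Tm}(\alpha)(M,N)$: for all $\psi_1:\Psi_1\to\Psi$, $\psi_2:\Psi_2\to\Psi_1$: $M\psi_1\Downarrow M_1$, $N\psi_1\Downarrow N_1$ and $\alpha^\Downarrow_{\psi_1\psi_2}$ relates $(M_1\psi_2,M\psi_1\psi_2)$, $(M\psi_1\psi_2,M_1\psi_2)$, $(N_1\psi_2,N\psi_1\psi_2)$, $(N\psi_1\psi_2,N_1\psi_2)$, $(M_1\psi_2,N_1\psi_2)$. - $\mathsf{Coh}(\alpha)$: for all $\psi$, $\alpha_\psi(M_0,N_0)$ implies $\mathsf{Tm}(\alpha\psi)(M_0,N_0)$. $\mu$ denotes least fixed points (for inclusion). $\mathbb N=\mu R.\{(\Psi,\mathsf z,\mathsf z)\}\cup\{(\Psi,\mathsf s(M),\mathsf s(M'))\mid\mathsf{Tm}(R(\Psi))(M,M')\}$; $\mathbb B=\mu R.\{(\Psi,\mathsf{true},\mathsf{true}),(\Psi,\mathsf{false},\mathsf{false})\}\cup\mathrm{FKan}(R)$; $\mathbb C=\mu R.\{(\Psi,\mathsf{base},\mathsf{base}),((\Psi,x),\mathsf{loop}_x,\mathsf{loop}_x)\}\cup\mathrm{FKan}(R)$,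 where $\mathrm{FKan}(R)$ consists of all $(\Psi,\mathsf{fcom}^{r\rightsquigarrow r'}(M;r_i=r_i'\hookrightarrow y.N_i),\mathsf{fcom}^{r\rightsquigarrow r'}(M';r_i=r_i'\hookrightarrow y.N_i'))$ with $(\dagger)$: $r\neq r'$, $r_i\ne r_i'$ for all $i$, and some $i,j$ have $r_i=r_j,r_i'=0,r_j'=1$; $\mathsf{Tm}(R(\Psi))(M,M')$; $\mathsf{Tm}(R(\Psi'))(N_i\psi,N_j'\psi)$ for all $i,j$ and $\psi:\Psi'\to(\Psi,y)$ with $r_i\psi=r_i'\psi$, $r_j\psi=r_j'\psi$; and $\mathsf{Tm}(R(\Psi'))(N_i\langle r/y\rangle\psi,M\psi)$ for all $i$ and $\psi:\Psi'\to\Psi$ with $r_i\psi=r_i'\psi$. Abbreviate $\mathsf{isContr}(C):=C\times((c{:}C)\to(c'{:}C)\to\mathsf{Path}_{\_.C}(c,c'))$ and $\mathsf{Equiv}(A,B):=(f{:}A\to B)\times((b{:}B)\to\mathsf{isContr}((a{:}A)\times\mathsf{Path}_{\_.B}(\mathsf{app}(f,a),b)))$. Operators on candidate cubical type systems: - $\mathrm{Fun}(\tau)$ (resp. $\mathrm{Pair}(\tau)$): all $(\Psi,(a{:}A)\to B,(a{:}A')\to B',\varphi)$ (resp. with $\times$) such that there are $\alpha$, $\beta^{\psi,M,M'}$ with $\mathsf{PTy}(\tau)(\Psi,A,A',\alpha)$, $\mathsf{Coh}(\alpha)$, and for all $\psi:\Psi'\to\Psi$ and $\mathsf{Tm}(\alpha\psi)(M,M')$,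 $\mathsf{PTy}(\tau)(\Psi',B\psi[M/a],B'\psi[M'/a],\beta^{\psi,M,M'})$ and $\mathsf{Coh}(\beta^{\psi,M,M'})$; with $\varphi=\{(\lambda a.N,\lambda a.N')\mid\forall\psi,M,M'.\ \mathsf{Tm}(\alpha\psi)(M,M')\Rightarrow\mathsf{Tm}(\beta^{\psi,M,M'})(N\psi[M/a],N'\psi[M'/a])\}$ (resp. $\varphi=\{(\langle M,N\rangle,\langle M',N'\rangle)\mid\mathsf{Tm}(\alpha)(M,M')\wedge\mathsf{Tm}(\beta^{\mathrm{id},M,M'})(N,N')\}$). - $\mathrm{Path}(\tau)$: all $(\Psi,\mathsf{Path}_{x.A}(P_0,P_1),\mathsf{Path}_{x.A'}(P_0',P_1'),\varphi)$ with, for some $\alpha$, $\mathsf{PTy}(\tau)((\Psi,x),A,A',\alpha)$, $\mathsf{Coh}(\alpha)$, $\mathsf{Tm}(\alpha\langle\varepsilon/x\rangle)(P_\varepsilon,P_\varepsilon')$ for $\varepsilon=0,1$, and $\varphi=\{(\langle x\rangle M,\langle x\rangle M')\mid\mathsf{Tm}(\alpha)(M,M')\wedge\forall\varepsilon.\mathsf{Tm}(\alpha\langle\varepsilon/x\rangle)(M\langle\varepsilon/x\rangle,P_\varepsilon)\}$. - $\mathrm{Eq}(\tau)$: all $(\Psi,\mathsf{Eq}_A(M,N),\mathsf{Eq}_{A'}(M',N'),\varphi)$ with, for some $\alpha$, $\mathsf{PTy}(\tau)(\Psi,A,A',\alpha)$, $\mathsf{Coh}(\alpha)$, $\mathsf{Tm}(\alpha)(M,M')$,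 $\mathsf{Tm}(\alpha)(N,N')$, $\varphi=\{(\star,\star)\mid\mathsf{Tm}(\alpha)(M,N)\}$. - $\mathrm V(\tau)$: all $((\Psi,x),\mathsf V_x(A,B,E),\mathsf V_x(A',B',E'),\varphi)$ with, for some $\beta,\alpha^\psi,\eta^\psi$: $\mathsf{PTy}(\tau)((\Psi,x),B,B',\beta)$, $\mathsf{Coh}(\beta)$; for all $\psi:\Psi'\to(\Psi,x)$ with $x\psi=0$, $\mathsf{PTy}(\tau)(\Psi',A\psi,A'\psi,\alpha^\psi)$, $\mathsf{Coh}(\alpha^\psi)$, $\mathsf{PTy}(\tau)(\Psi',\mathsf{Equiv}(A\psi,B\psi),\mathsf{Equiv}(A\psi,B\psi),\eta^\psi)$, $\mathsf{Tm}(\eta^\psi)(E\psi,E'\psi)$; and $\varphi$ is the set of $(\mathsf{Vin}_x(M,N),\mathsf{Vin}_x(M',N'))$ with $\mathsf{Tm}(\beta)(N,N')$ and, for all $\psi$ with $x\psi=0$, $\mathsf{Tm}(\alpha^\psi)(M\psi,M'\psi)$ and $\mathsf{Tm}(\beta\psi)(\mathsf{app}(\mathsf{fst}(E\psi),M\psi),N\psi)$. - $\mathrm{Fcom}(\tau)$: all $(\Psi,\mathsf{fcom}^{r\rightsquigarrow r'}(A;r_i=r_i'\hookrightarrow y.B_i),\mathsf{fcom}^{r\rightsquigarrow r'}(A';r_i=r_i'\hookrightarrow y.B_i'),\varphi)$ with $(\dagger)$ and, for some $\alpha,\beta^{\psi,i,j}$: $\mathsf{PTy}(\tau)(\Psi,A,A',\alpha)$,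 $\mathsf{Coh}(\alpha)$; for all $i,j$ and $\psi:\Psi'\to(\Psi,y)$ with $r_i\psi=r_i'\psi$, $r_j\psi=r_j'\psi$, $\mathsf{PTy}(\tau)(\Psi',B_i\psi,B_j'\psi,\beta^{\psi,i,j})$ and $\mathsf{Coh}(\beta^{\psi,i,j})$; for all $i$ and $\psi:\Psi'\to\Psi$ with $r_i\psi=r_i'\psi$, $\mathsf{PTy}(\tau)(\Psi',B_i\langle r/y\rangle\psi,A\psi,\_)$; and $\varphi$ is the set of $(\mathsf{box}^{r\rightsquigarrow r'}(M;r_i=r_i'\hookrightarrow N_i),\mathsf{box}^{r\rightsquigarrow r'}(M';r_i=r_i'\hookrightarrow N_i'))$ with $\mathsf{Tm}(\alpha)(M,M')$; $\mathsf{Tm}(\beta^{\psi,i,j}\langle r'\psi/y\rangle)(N_i\psi,N_j'\psi)$ for all $i,j,\psi:\Psi'\to\Psi$ with $r_i\psi=r_i'\psi$, $r_j\psi=r_j'\psi$ (in $\beta^{\psi,i,j}$, $\psi$ is extended by $y\mapsto y$); and $\mathsf{Tm}(\alpha\psi)(M\psi,\mathsf{coe}_{y.B_i\psi}^{r'\psi\rightsquigarrow r\psi}(N_i\psi))$ for all $i,\psi$ with $r_i\psi=r_i'\psi$. - $\mathrm{Void}=\{(\Psi,\mathsf{void},\mathsf{void},\emptyset)\}$, $\mathrm{Nat}=\{(\Psi,\mathsf{nat},\mathsf{nat},\mathbb N_\Psi)\}$, $\mathrm{Bool}=\{(\Psi,\mathsf{bool},\mathsf{bool},\{(\mathsf{true},\mathsf{true}),(\mathsf{false},\mathsf{false})\})\}$,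 $\mathrm{WB}=\{(\Psi,\mathsf{wbool},\mathsf{wbool},\mathbb B_\Psi)\}$, $\mathrm{Circ}=\{(\Psi,\mathbb S^1,\mathbb S^1,\mathbb C_\Psi)\}$, $\mathrm{UPre}(\nu)$ and $\mathrm{UKan}(\nu)$ are the restrictions of $\nu$ to tuples $(\Psi,\mathcal U^{\mathsf{pre}}_j,\mathcal U^{\mathsf{pre}}_j,\varphi)$, resp. $(\Psi,\mathcal U^{\mathsf{Kan}}_j,\mathcal U^{\mathsf{Kan}}_j,\varphi)$. $P(\nu,\sigma,\tau)$ is the union of $\mathrm{Fun}(\tau),\mathrm{Pair}(\tau),\mathrm{Path}(\tau),\mathrm{Eq}(\tau),\mathrm V(\tau),\mathrm{Fcom}(\sigma),\mathrm{Void},\mathrm{Nat},\mathrm{Bool},\mathrm{WB},\mathrm{Circ},\mathrm{UPre}(\nu),\mathrm{UKan}(\nu)$; $K(\nu,\sigma)$ is the union of $\mathrm{Fun}(\sigma),\mathrm{Pair}(\sigma),\mathrm{Path}(\sigma),\mathrm V(\sigma),\mathrm{Fcom}(\sigma),\mathrm{Void},\mathrm{Nat},\mathrm{Bool},\mathrm{WB},\mathrm{Circ},\mathrm{UKan}(\nu)$. Put $\mu^{\mathsf{pre}}(\nu,\sigma)=\mu\tau.P(\nu,\sigma,\tau)$ and $\mu^{\mathsf{Kan}}(\nu)=\mu\sigma.K(\nu,\sigma)$. By recursion on $n$, $\nu_n=\{(\Psi,\mathcal U^\kappa_j,\mathcal U^\kappa_j,\varphi)\mid j<n,\ \kappa\in\{\mathsf{pre},\mathsf{Kan}\},\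 \varphi=\{(A_0,B_0)\mid\tau^\kappa_j(\Psi,A_0,B_0,\_)\}\}$, $\tau^{\mathsf{Kan}}_n=\mu^{\mathsf{Kan}}(\nu_n)$, $\tau^{\mathsf{pre}}_n=\mu^{\mathsf{pre}}(\nu_n,\mu^{\mathsf{Kan}}(\nu_n))$; $\nu_\omega$ is defined as $\nu_n$ without the condition $j<n$, and $\tau^{\mathsf{Kan}}_\omega=\mu^{\mathsf{Kan}}(\nu_\omega)$, $\tau^{\mathsf{pre}}_\omega=\mu^{\mathsf{pre}}(\nu_\omega,\mu^{\mathsf{Kan}}(\nu_\omega))$. ($\_$ means "for some relation".) **Judgments** relative to $\tau$ (all terms have free dimensions in $\Psi$ and no free variables). $A\doteq B\ \mathsf{type}_{\mathsf{pre}}\,[\Psi]$: $\mathsf{PTy}(\tau)(\Psi,A,B,\alpha)$ and $\mathsf{Coh}(\alpha)$ for some $\alpha$; this $\alpha$ is unique and independent of $B$, and is written $[\![A]\!]$. $M\doteq N\in A\,[\Psi]$ (presupposing $A\doteq A\ \mathsf{type}_{\mathsf{pre}}\,[\Psi]$): $\mathsf{Tm}([\![A]\!])(M,N)$. -}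

module Defs where

open import Data.Bool.Base using (Bool; true; false; not; if_then_else_)
open import Data.Empty using (⊥)
open import Data.Fin.Base using (Fin; zero; suc; _<_)
open import Data.List.Base using (List; []; _∷_; length; mapMaybe)
open import Data.List.Relation.Unary.All using (All; []; _∷_)
open import Data.Maybe.Base as Maybe using (Maybe; just; nothing)
open import Data.Nat.Base using (ℕ; zero; suc; _+_; _<′_; ≤′-reflexive; ≤′-step)
open import Data.Product.Base using (_×_; _,_; ∃; ∃₂; proj₁; proj₂)
open import Data.Vec.Base as Vec using (Vec; []; _∷_; _++_; map; lookup; tabulate; allFin; toList; fromList; zip; _[_]≔_)
open import Level using (Level; Lift; Setω) renaming (zero to lzero; suc to lsuc)
open import Relation.Binary.Construct.Closure.ReflexiveTransitive using (Star)
open import Relation.Binary.PropositionalEquality using (_≡_; _≢_; refl)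
open import Relation.Nullary.Negation using (¬_)

------------------------------------------------------------------------
-- Dimensions and dimension substitutions
--
-- Everything is well scoped de Bruijn: a finite set Ψ of dimension names is
-- given by its size, and the most recently bound name is zero.  Contexts of
-- dimension names and of term variables are kept apart.

data Dim (Ψ : ℕ) : Set where
  const : Bool → Dim Ψ
  name  : Fin Ψ → Dim Ψ

pattern 𝟎 = const false
pattern 𝟏 = const true

Eqn : ℕ → Set
Eqn Ψ = Dim Ψ × Dim Ψ

Holds : ∀ {Ψ} → Eqn Ψ → Set
Holds (r , r′) = r ≡ r′

-- Vectors rather than functions, so that composition is associative and
-- unital up to _≡_ without function extensionality.
infix 4 _⇒_
_⇒_ : ℕ → ℕ → Set
Ψ′ ⇒ Ψ = Vec (Dim Ψ′) Ψ

infixl 20 _⟪_⟫ᵈ _⟪_⟫ᵉ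
_⟪_⟫ᵈ : ∀ {Ψ Ψ′} → Dim Ψ → Ψ′ ⇒ Ψ → Dim Ψ′
const ε ⟪ ψ ⟫ᵈ = const ε
name x  ⟪ ψ ⟫ᵈ = lookup ψ x

_⟪_⟫ᵉ : ∀ {Ψ Ψ′} → Eqn Ψ → Ψ′ ⇒ Ψ → Eqn Ψ′
(r , r′) ⟪ ψ ⟫ᵉ = r ⟪ ψ ⟫ᵈ , r′ ⟪ ψ ⟫ᵈ

idₛ : ∀ {Ψ} → Ψ ⇒ Ψ
idₛ = tabulate name

wkₛ : ∀ {Ψ} → suc Ψ ⇒ Ψ
wkₛ = tabulate (λ x → name (suc x))

-- First ψ₁, then ψ₂.
infixl 9 _⨾_
_⨾_ : ∀ {Ψ Ψ₁ Ψ₂} → Ψ₁ ⇒ Ψ → Ψ₂ ⇒ Ψ₁ → Ψ₂ ⇒ Ψ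
ψ₁ ⨾ ψ₂ = map (_⟪ ψ₂ ⟫ᵈ) ψ₁

wkᵈ : ∀ {Ψ} → Dim Ψ → Dim (suc Ψ)
wkᵈ r = r ⟪ wkₛ ⟫ᵈ

wkᵉ : ∀ {Ψ} → Eqn Ψ → Eqn (suc Ψ)
wkᵉ e = e ⟪ wkₛ ⟫ᵉ

lift : ∀ {Ψ Ψ′} → Ψ′ ⇒ Ψ → suc Ψ′ ⇒ suc Ψ
lift ψ = name zero ∷ map wkᵈ ψ

lifts : ∀ d {Ψ Ψ′} → Ψ′ ⇒ Ψ → d + Ψ′ ⇒ d + Ψ
lifts zero    ψ = ψ
lifts (suc d) ψ = lift (lifts d ψ)

------------------------------------------------------------------------
-- Syntax, over a second-order signature

data Kind : Set where
  pre Kan : Kind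

-- tmˢ d t is a term under d dimension binders and t variable binders.
-- A list of k entries ξᵢ ↪ y.Nᵢ is split into its equations (eqnsˢ k) and
-- its bodies (tmsˢ 1 k); the entries of box bind no name (tmsˢ 0 k).
data Sort : Set where
  dimˢ  : Sort
  tmˢ   : (d t : ℕ) → Sort
  eqnsˢ : (k : ℕ) → Sort
  tmsˢ  : (d k : ℕ) → Sort

data Op : Set where
  Πᵒ Σᵒ Pathᵒ Eqᵒ voidᵒ natᵒ boolᵒ wboolᵒ S¹ᵒ : Op
  Uᵒ : Kind → ℕ → Op
  Vᵒ Vinᵒ Vprojᵒ : Op
  lamᵒ appᵒ pairᵒ fstᵒ sndᵒ plamᵒ papᵒ starᵒ : Op
  zᵒ sᵒ natrecᵒ trueᵒ falseᵒ ifᵒ baseᵒ loopᵒ S¹elimᵒ : Op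
  coeᵒ : Op
  hcomᵒ comᵒ fcomᵒ ghcomᵒ gcomᵒ boxᵒ capᵒ : ℕ → Op

arity : Op → List Sort
arity Πᵒ         = tmˢ 0 0 ∷ tmˢ 0 1 ∷ []
arity Σᵒ         = tmˢ 0 0 ∷ tmˢ 0 1 ∷ []
arity Pathᵒ      = tmˢ 1 0 ∷ tmˢ 0 0 ∷ tmˢ 0 0 ∷ []
arity Eqᵒ        = tmˢ 0 0 ∷ tmˢ 0 0 ∷ tmˢ 0 0 ∷ []
arity voidᵒ      = []
arity natᵒ       = []
arity boolᵒ      = []
arity wboolᵒ     = []
arity S¹ᵒ        = []
arity (Uᵒ κ j)   = []
arity Vᵒ         = dimˢ ∷ tmˢ 0 0 ∷ tmˢ 0 0 ∷ tmˢ 0 0 ∷ []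
arity Vinᵒ       = dimˢ ∷ tmˢ 0 0 ∷ tmˢ 0 0 ∷ []
arity Vprojᵒ     = dimˢ ∷ tmˢ 0 0 ∷ tmˢ 0 0 ∷ []
arity lamᵒ       = tmˢ 0 1 ∷ []
arity appᵒ       = tmˢ 0 0 ∷ tmˢ 0 0 ∷ []
arity pairᵒ      = tmˢ 0 0 ∷ tmˢ 0 0 ∷ []
arity fstᵒ       = tmˢ 0 0 ∷ []
arity sndᵒ       = tmˢ 0 0 ∷ []
arity plamᵒ      = tmˢ 1 0 ∷ []
arity papᵒ       = tmˢ 0 0 ∷ dimˢ ∷ []
arity starᵒ      = []
arity zᵒ         = []
arity sᵒ         = tmˢ 0 0 ∷ []
arity natrecᵒ    = tmˢ 0 0 ∷ tmˢ 0 0 ∷ tmˢ 0 2 ∷ []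
arity trueᵒ      = []
arity falseᵒ     = []
arity ifᵒ        = tmˢ 0 1 ∷ tmˢ 0 0 ∷ tmˢ 0 0 ∷ tmˢ 0 0 ∷ []
arity baseᵒ      = []
arity loopᵒ      = dimˢ ∷ []
arity S¹elimᵒ    = tmˢ 0 1 ∷ tmˢ 0 0 ∷ tmˢ 0 0 ∷ tmˢ 1 0 ∷ []
arity coeᵒ       = dimˢ ∷ dimˢ ∷ tmˢ 1 0 ∷ tmˢ 0 0 ∷ []
arity (hcomᵒ k)  = dimˢ ∷ dimˢ ∷ tmˢ 0 0 ∷ tmˢ 0 0 ∷ eqnsˢ k ∷ tmsˢ 1 k ∷ []
arity (comᵒ k)   = dimˢ ∷ dimˢ ∷ tmˢ 1 0 ∷ tmˢ 0 0 ∷ eqnsˢ k ∷ tmsˢ 1 k ∷ []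
arity (fcomᵒ k)  = dimˢ ∷ dimˢ ∷ tmˢ 0 0 ∷ eqnsˢ k ∷ tmsˢ 1 k ∷ []
arity (ghcomᵒ k) = dimˢ ∷ dimˢ ∷ tmˢ 0 0 ∷ tmˢ 0 0 ∷ eqnsˢ k ∷ tmsˢ 1 k ∷ []
arity (gcomᵒ k)  = dimˢ ∷ dimˢ ∷ tmˢ 1 0 ∷ tmˢ 0 0 ∷ eqnsˢ k ∷ tmsˢ 1 k ∷ []
arity (boxᵒ k)   = dimˢ ∷ dimˢ ∷ tmˢ 0 0 ∷ eqnsˢ k ∷ tmsˢ 0 k ∷ []
arity (capᵒ k)   = dimˢ ∷ dimˢ ∷ tmˢ 0 0 ∷ eqnsˢ k ∷ tmsˢ 1 k ∷ []

-- Term Ψ m: terms with free dimension names in Ψ and m free term variables.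
data Term (Ψ m : ℕ) : Set
data Arg (Ψ m : ℕ) : Sort → Set

data Term Ψ m where
  var : Fin m → Term Ψ m
  op  : (o : Op) → All (Arg Ψ m) (arity o) → Term Ψ m

data Arg Ψ m where
  dim  : Dim Ψ → Arg Ψ m dimˢ
  tm   : ∀ {d t} → Term (d + Ψ) (t + m) → Arg Ψ m (tmˢ d t)
  eqns : ∀ {k} → Vec (Eqn Ψ) k → Arg Ψ m (eqnsˢ k)
  tms  : ∀ {d k} → Vec (Term (d + Ψ) m) k → Arg Ψ m (tmsˢ d k)

infixr 30 _→ᵗ_ _×ᵗ_

pattern Πᵗ A B       = op Πᵒ (tm A ∷ tm B ∷ [])
pattern Σᵗ A B       = op Σᵒ (tm A ∷ tm B ∷ [])
pattern Pathᵗ A M N  = op Pathᵒ (tm A ∷ tm M ∷ tm N ∷ [])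
pattern Eqᵗ A M N    = op Eqᵒ (tm A ∷ tm M ∷ tm N ∷ [])
pattern voidᵗ        = op voidᵒ []
pattern natᵗ         = op natᵒ []
pattern boolᵗ        = op boolᵒ []
pattern wboolᵗ       = op wboolᵒ []
pattern S¹ᵗ          = op S¹ᵒ []
pattern U κ j        = op (Uᵒ κ j) []
pattern V r A B E    = op Vᵒ (dim r ∷ tm A ∷ tm B ∷ tm E ∷ [])
pattern Vin r M N    = op Vinᵒ (dim r ∷ tm M ∷ tm N ∷ [])
pattern Vproj r M F  = op Vprojᵒ (dim r ∷ tm M ∷ tm F ∷ [])
pattern lam M        = op lamᵒ (tm M ∷ [])
pattern app M N      = op appᵒ (tm M ∷ tm N ∷ [])
pattern pair M N     = op pairᵒ (tm M ∷ tm N ∷ [])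
pattern fst M        = op fstᵒ (tm M ∷ [])
pattern snd M        = op sndᵒ (tm M ∷ [])
pattern plam M       = op plamᵒ (tm M ∷ [])
pattern _at_ M r     = op papᵒ (tm M ∷ dim r ∷ [])
pattern star         = op starᵒ []
pattern zᵗ           = op zᵒ []
pattern sᵗ M         = op sᵒ (tm M ∷ [])
pattern natrec M Z S = op natrecᵒ (tm M ∷ tm Z ∷ tm S ∷ [])
pattern trueᵗ        = op trueᵒ []
pattern falseᵗ       = op falseᵒ []
pattern ifᵗ A M T F  = op ifᵒ (tm A ∷ tm M ∷ tm T ∷ tm F ∷ [])
pattern base         = op baseᵒ []
pattern loop r       = op loopᵒ (dim r ∷ [])
pattern S¹elim A M P L = op S¹elimᵒ (tm A ∷ tm M ∷ tm P ∷ tm L ∷ [])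
pattern coe r r′ A M       = op coeᵒ (dim r ∷ dim r′ ∷ tm A ∷ tm M ∷ [])
pattern hcom r r′ A M ξ N  = op (hcomᵒ _) (dim r ∷ dim r′ ∷ tm A ∷ tm M ∷ eqns ξ ∷ tms N ∷ [])
pattern com r r′ A M ξ N   = op (comᵒ _) (dim r ∷ dim r′ ∷ tm A ∷ tm M ∷ eqns ξ ∷ tms N ∷ [])
pattern fcom r r′ M ξ N    = op (fcomᵒ _) (dim r ∷ dim r′ ∷ tm M ∷ eqns ξ ∷ tms N ∷ [])
pattern ghcom r r′ A M ξ N = op (ghcomᵒ _) (dim r ∷ dim r′ ∷ tm A ∷ tm M ∷ eqns ξ ∷ tms N ∷ [])
pattern gcom r r′ A M ξ N  = op (gcomᵒ _) (dim r ∷ dim r′ ∷ tm A ∷ tm M ∷ eqns ξ ∷ tms N ∷ [])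
pattern box r r′ M ξ N     = op (boxᵒ _) (dim r ∷ dim r′ ∷ tm M ∷ eqns ξ ∷ tms N ∷ [])
pattern cap r r′ M ξ B     = op (capᵒ _) (dim r ∷ dim r′ ∷ tm M ∷ eqns ξ ∷ tms B ∷ [])

liftsᵛ : ∀ t {m m′} → Vec (Fin m′) m → Vec (Fin (t + m′)) (t + m)
liftsᵛ zero    ρ = ρ
liftsᵛ (suc t) ρ = zero ∷ map suc (liftsᵛ t ρ)

-- Simultaneous dimension substitution and renaming of term variables.
act     : ∀ {Ψ Ψ′ m m′} → Ψ′ ⇒ Ψ → Vec (Fin m′) m → Term Ψ m → Term Ψ′ m′
actArgs : ∀ {Ψ Ψ′ m m′ ss} → Ψ′ ⇒ Ψ → Vec (Fin m′) m → All (Arg Ψ m) ss → All (Arg Ψ′ m′) ss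
actArg  : ∀ {Ψ Ψ′ m m′ s} → Ψ′ ⇒ Ψ → Vec (Fin m′) m → Arg Ψ m s → Arg Ψ′ m′ s
actVec  : ∀ {Ψ Ψ′ m m′ k} → Ψ′ ⇒ Ψ → Vec (Fin m′) m → Vec (Term Ψ m) k → Vec (Term Ψ′ m′) k

act ψ ρ (var a)   = var (lookup ρ a)
act ψ ρ (op o as) = op o (actArgs ψ ρ as)

actArgs ψ ρ []       = []
actArgs ψ ρ (a ∷ as) = actArg ψ ρ a ∷ actArgs ψ ρ as

actArg ψ ρ (dim r)            = dim (r ⟪ ψ ⟫ᵈ)
actArg ψ ρ (tm {d} {t} M)     = tm (act (lifts d ψ) (liftsᵛ t ρ) M)
actArg ψ ρ (eqns ξ)           = eqns (map (_⟪ ψ ⟫ᵉ) ξ)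
actArg ψ ρ (tms {d} N)        = tms (actVec (lifts d ψ) ρ N)

actVec ψ ρ []      = []
actVec ψ ρ (M ∷ N) = act ψ ρ M ∷ actVec ψ ρ N

infixl 20 _⟪_⟫
_⟪_⟫ : ∀ {Ψ Ψ′ m} → Term Ψ m → Ψ′ ⇒ Ψ → Term Ψ′ m
M ⟪ ψ ⟫ = act ψ (allFin _) M

wk : ∀ {Ψ m} → Term Ψ m → Term (suc Ψ) m
wk M = M ⟪ wkₛ ⟫

-- Weakening below the most recently bound name.
wk₁ : ∀ {Ψ m} → Term (suc Ψ) m → Term (suc (suc Ψ)) m
wk₁ M = M ⟪ lift wkₛ ⟫

wkᵛ : ∀ {Ψ m} → Term Ψ m → Term Ψ (suc m)
wkᵛ M = act idₛ (tabulate suc) M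

liftθ : ∀ d t {Ψ m m′} → Vec (Term Ψ m′) m → Vec (Term (d + Ψ) (t + m′)) (t + m)
liftθ zero    zero    θ = θ
liftθ (suc d) zero    θ = map wk (liftθ d zero θ)
liftθ d       (suc t) θ = var zero ∷ map wkᵛ (liftθ d t θ)

sub     : ∀ {Ψ m m′} → Vec (Term Ψ m′) m → Term Ψ m → Term Ψ m′
subArgs : ∀ {Ψ m m′ ss} → Vec (Term Ψ m′) m → All (Arg Ψ m) ss → All (Arg Ψ m′) ss
subArg  : ∀ {Ψ m m′ s} → Vec (Term Ψ m′) m → Arg Ψ m s → Arg Ψ m′ s
subVec  : ∀ {Ψ m m′ k} → Vec (Term Ψ m′) m → Vec (Term Ψ m) k → Vec (Term Ψ m′) k

sub θ (var a)   = lookup θ a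
sub θ (op o as) = op o (subArgs θ as)

subArgs θ []       = []
subArgs θ (a ∷ as) = subArg θ a ∷ subArgs θ as

subArg θ (dim r)        = dim r
subArg θ (tm {d} {t} M) = tm (sub (liftθ d t θ) M)
subArg θ (eqns ξ)       = eqns ξ
subArg θ (tms {d} N)    = tms (subVec (liftθ d 0 θ) N)

subVec θ []      = []
subVec θ (M ∷ N) = sub θ M ∷ subVec θ N

-- M[N/a], for M with the single free term variable a.
infixl 20 _[_]
_[_] : ∀ {Ψ m} → Term Ψ 1 → Term Ψ m → Term Ψ m
M [ N ] = sub (N ∷ []) M

-- M⟨r/x⟩ for x the most recently bound name, and for the one before it.
infixl 20 _⟨_⟩ _⟨_⟩₁
_⟨_⟩ : ∀ {Ψ m} → Term (suc Ψ) m → Dim Ψ → Term Ψ m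
M ⟨ r ⟩ = M ⟪ r ∷ idₛ ⟫

_⟨_⟩₁ : ∀ {Ψ m} → Term (suc (suc Ψ)) m → Dim Ψ → Term (suc Ψ) m
M ⟨ r ⟩₁ = M ⟪ lift (r ∷ idₛ) ⟫

-- M⟨r/y⟩ for an arbitrary name y in scope.
infixl 20 _⟨_/_⟩
_⟨_/_⟩ : ∀ {Ψ m} → Term Ψ m → Dim Ψ → Fin Ψ → Term Ψ m
M ⟨ r / y ⟩ = M ⟪ idₛ [ y ]≔ r ⟫

-- y.M for a name y in scope: every occurrence of y in M becomes bound.
abs : ∀ {Ψ m} → Fin Ψ → Term Ψ m → Term (suc Ψ) m
abs y M = M ⟪ wkₛ [ y ]≔ name zero ⟫

swap : ∀ {Ψ m} → Term (suc (suc Ψ)) m → Term (suc (suc Ψ)) m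
swap M = M ⟪ name (suc zero) ∷ name zero ∷ tabulate (λ x → name (suc (suc x))) ⟫

_→ᵗ_ _×ᵗ_ : ∀ {Ψ m} → Term Ψ m → Term Ψ m → Term Ψ m
A →ᵗ B = Πᵗ A (wkᵛ B)
A ×ᵗ B = Σᵗ A (wkᵛ B)

isContr : ∀ {Ψ m} → Term Ψ m → Term Ψ m
isContr C = C ×ᵗ Πᵗ C (Πᵗ (wkᵛ C) (Pathᵗ (wk (wkᵛ (wkᵛ C))) (var (suc zero)) (var zero)))

Equiv : ∀ {Ψ m} → Term Ψ m → Term Ψ m → Term Ψ m
Equiv A B =
  Σᵗ (A →ᵗ B)
     (Πᵗ (wkᵛ B)
         (isContr (Σᵗ (wkᵛ (wkᵛ A))
                      (Pathᵗ (wk (wkᵛ (wkᵛ (wkᵛ B)))) (app (var (suc (suc zero))) (var zero)) (var (suc zero))))))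

------------------------------------------------------------------------
-- Operational semantics

AllApart : ∀ {Ψ k} → Vec (Eqn Ψ) k → Set
AllApart ξ = ∀ i → ¬ Holds (lookup ξ i)

Least : ∀ {Ψ k} → Vec (Eqn Ψ) k → Fin k → Set
Least ξ j = Holds (lookup ξ j) × (∀ i → i < j → ¬ Holds (lookup ξ i))

data Val {Ψ} : Term Ψ 0 → Set where
  Π-val     : ∀ {A B} → Val (Πᵗ A B)
  Σ-val     : ∀ {A B} → Val (Σᵗ A B)
  Path-val  : ∀ {A M N} → Val (Pathᵗ A M N)
  Eq-val    : ∀ {A M N} → Val (Eqᵗ A M N)
  void-val  : Val voidᵗ
  nat-val   : Val natᵗ
  bool-val  : Val boolᵗ
  wbool-val : Val wboolᵗ
  S¹-val    : Val S¹ᵗ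
  U-val     : ∀ {κ j} → Val (U κ j)
  V-val     : ∀ {x A B E} → Val (V (name x) A B E)
  lam-val   : ∀ {M} → Val (lam M)
  pair-val  : ∀ {M N} → Val (pair M N)
  plam-val  : ∀ {M} → Val (plam M)
  star-val  : Val star
  z-val     : Val zᵗ
  s-val     : ∀ {M} → Val (sᵗ M)
  true-val  : Val trueᵗ
  false-val : Val falseᵗ
  base-val  : Val base
  loop-val  : ∀ {x} → Val (loop (name x))
  Vin-val   : ∀ {x M N} → Val (Vin (name x) M N)
  fcom-val  : ∀ {k r r′ M} {ξ : Vec (Eqn Ψ) k} {N} → r ≢ r′ → AllApart ξ → Val (fcom r r′ M ξ N)
  box-val   : ∀ {k r r′ M} {ξ : Vec (Eqn Ψ) k} {N} → r ≢ r′ → AllApart ξ → Val (box r r′ M ξ N)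

-- In the right-hand sides below, x, y, z, w name the dimension variables of
-- the informal rules; a bound name that is in scope is written name zero,
-- name (suc zero), ... according to its distance from its binder.

ghcom-rhs : ∀ {Ψ k} → Dim Ψ → Dim Ψ → Term Ψ 0 → Term Ψ 0 → Eqn Ψ → Term (suc Ψ) 0 →
            Vec (Eqn Ψ) k → Vec (Term (suc Ψ) 0) k → Term Ψ 0
ghcom-rhs r r′ A M (s , s′) N ξ Ns =
  hcom r r′ A M ((s , 𝟎) ∷ (s , 𝟏) ∷ (s , s′) ∷ ξ) (T false ∷ T true ∷ N ∷ Ns)
  where
  T : Bool → Term _ 0
  T ε = hcom (wkᵈ r) (name zero) (wk A) (wk M)
             ((wkᵈ s′ , const ε) ∷ (wkᵈ s′ , const (not ε)) ∷ map wkᵉ ξ)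
             (wk₁ N
              ∷ ghcom (wkᵈ (wkᵈ r)) (name zero) (wk (wk A)) (wk (wk M))
                      (map wkᵉ (map wkᵉ ξ)) (map wk₁ (map wk₁ Ns))
              ∷ map wk₁ Ns)

-- z.hcom_A^{r⇝z}(M; ξᵢ ↪ y.Nᵢ), and the same for fcom.
fill : ∀ {Ψ k} → Dim Ψ → Term Ψ 0 → Term Ψ 0 → Vec (Eqn Ψ) k → Vec (Term (suc Ψ) 0) k → Term (suc Ψ) 0
fill r A M ξ N = hcom (wkᵈ r) (name zero) (wk A) (wk M) (map wkᵉ ξ) (map wk₁ N)

ffill : ∀ {Ψ k} → Dim Ψ → Term Ψ 0 → Vec (Eqn Ψ) k → Vec (Term (suc Ψ) 0) k → Term (suc Ψ) 0
ffill r M ξ N = fcom (wkᵈ r) (name zero) (wk M) (map wkᵉ ξ) (map wk₁ N)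

hcomV-rhs : ∀ {Ψ k} → Dim Ψ → Dim Ψ → Fin Ψ → Term Ψ 0 → Term Ψ 0 → Term Ψ 0 → Term Ψ 0 →
            Vec (Eqn Ψ) k → Vec (Term (suc Ψ) 0) k → Term Ψ 0
hcomV-rhs r r′ x A B E M ξ N =
  Vin (name x) (O ⟨ r′ ⟩)
      (hcom r r′ B (Vproj (name x) M (fst E))
            (ξ ++ (name x , 𝟎) ∷ (name x , 𝟏) ∷ [])
            (map (λ Nᵢ → Vproj (name (suc x)) Nᵢ (fst (wk E))) N
             ++ app (fst (wk E)) O ∷ fill r B M ξ N ∷ []))
  where
  O : Term _ 0
  O = fill r A M ξ N

coeV₁-rhs : ∀ {Ψ} → Dim Ψ → Term (suc Ψ) 0 → Term (suc Ψ) 0 → Term (suc Ψ) 0 → Term Ψ 0 → Term Ψ 0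
coeV₁-rhs r′ A B E N = Vin r′ (fst O) P
  where
  C O P : Term _ 0
  C = coe 𝟏 r′ B N
  O = fst (app (snd (E ⟨ r′ ⟩)) C)
  P = hcom 𝟏 𝟎 (B ⟨ r′ ⟩) C ((r′ , 𝟎) ∷ (r′ , 𝟏) ∷ []) (snd (wk O) at name zero ∷ wk C ∷ [])

-- The reduct of coe_{x.V_x(A,B,E)}^{y⇝r′}(M).
coeVy-rhs : ∀ {Ψ} → Fin Ψ → Dim Ψ → Term (suc Ψ) 0 → Term (suc Ψ) 0 → Term (suc Ψ) 0 → Term Ψ 0 → Term Ψ 0
coeVy-rhs {Ψ} y r′ A B E M =
  Vin r′ (fst R)
      (hcom 𝟏 𝟎 (B ⟨ r′ ⟩) (P ⟨ r′ ⟩)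
            ((name y , 𝟎) ∷ (name y , 𝟏) ∷ (name y , r′) ∷ (r′ , 𝟎) ∷ [])
            (wk (O false ⟨ r′ ⟩)
             ∷ wk (O true ⟨ r′ ⟩)
             ∷ wk (Vproj r′ M (fst (E ⟨ r′ ⟩)))
             ∷ snd (wk R) at name zero
             ∷ []))
  where
  VT : Term (suc Ψ) 0
  VT = V (name zero) A B E

  -- O binds w; since w takes the position of x, E⟨w/x⟩ is E itself.
  O : Bool → Term (suc Ψ) 0
  O ε = Vproj (name zero) (coe (const ε) (name zero) (wk₁ VT) (wk M)) (fst E)

  -- P binds x.
  P : Term (suc Ψ) 0
  P = com (name (suc y)) (name zero) (wk₁ B)
          (wk (Vproj (name y) M (fst (E ⟨ name y ⟩))))
          ((name (suc y) , 𝟎) ∷ (name (suc y) , 𝟏) ∷ [])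
          (wk₁ (O false) ∷ wk₁ (O true) ∷ [])

  A₀ B₀ E₀ P₀ : Term Ψ 0
  A₀ = A ⟨ 𝟎 ⟩
  B₀ = B ⟨ 𝟎 ⟩
  E₀ = E ⟨ 𝟎 ⟩
  P₀ = P ⟨ 𝟎 ⟩

  Q : Bool → Term Ψ 0 → Term Ψ 0
  Q ε a =
    pair C
         (plam (com (const ε) (name (suc y)) (abs (suc y) (wk B₀)) (wk (P₀ ⟨ const ε / y ⟩))
                    ((name zero , 𝟎) ∷ (name zero , 𝟏) ∷ [])
                    (abs (suc y) (wk (app (fst E₀) C)) ∷ abs (suc y) (wk P₀) ∷ [])))
    where
    C : Term Ψ 0
    C = coe (const ε) (name y) (abs y A₀) a

  R : Term Ψ 0
  R = app (app (snd (app (snd E₀) P₀)) (Q false (M ⟨ 𝟎 / y ⟩)))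
          (Q true (coe 𝟏 𝟎 VT M ⟨ 𝟏 / y ⟩))
      at name y

-- The reduct of coe_{y.V_x(A,B,E)}^{r⇝r′}(M) for x ≠ y.
coeVx-rhs : ∀ {Ψ} → Dim Ψ → Dim Ψ → Fin Ψ → Term (suc Ψ) 0 → Term (suc Ψ) 0 → Term (suc Ψ) 0 → Term Ψ 0 → Term Ψ 0
coeVx-rhs r r′ x A B E M =
  Vin (name x) (coe r r′ A M)
      (com r r′ B (Vproj (name x) M (fst (E ⟨ r ⟩)))
           ((name x , 𝟎) ∷ (name x , 𝟏) ∷ [])
           (app (fst E) (coe (wkᵈ r) (name zero) (wk₁ A) (wk M))
            ∷ coe (wkᵈ r) (name zero) (wk₁ B) (wk M)
            ∷ []))

hcomFcom-rhs : ∀ {Ψ k l} → Dim Ψ → Dim Ψ →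
               (s s′ : Dim Ψ) → Term Ψ 0 → Vec (Eqn Ψ) l → Vec (Term (suc Ψ) 0) l →
               Term Ψ 0 → Vec (Eqn Ψ) k → Vec (Term (suc Ψ) 0) k → Term Ψ 0
hcomFcom-rhs {Ψ} r r′ s s′ A ζ B M ξ N =
  box s s′ Q ζ (map (λ Bⱼ → P Bⱼ ⟨ s′ ⟩) B)
  where
  -- P and F bind z.
  P : Term (suc Ψ) 0 → Term (suc Ψ) 0
  P Bⱼ = hcom (wkᵈ r) (wkᵈ r′) Bⱼ
              (coe (wkᵈ s′) (name zero) (wk₁ Bⱼ) (wk M))
              (map wkᵉ ξ)
              (map (λ Nᵢ → coe (wkᵈ (wkᵈ s′)) (name (suc zero)) (wk₁ (wk₁ Bⱼ)) (wk₁ Nᵢ)) N)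

  F : ∀ {Φ k} (s s′ : Dim Φ) → Term Φ 0 → Vec (Eqn Φ) k → Vec (Term (suc Φ) 0) k → Term Φ 0 → Term (suc Φ) 0
  F s s′ A ζ B c =
    hcom (wkᵈ s′) (name zero) (wk A) (wk (cap s s′ c ζ B)) (map wkᵉ ζ)
         (map (λ Bⱼ → coe (name zero) (wkᵈ (wkᵈ s)) (wk₁ (wk₁ Bⱼ))
                          (coe (wkᵈ (wkᵈ s′)) (name zero) (wk₁ (wk₁ Bⱼ)) (wk (wk c)))) B)

  F₀ : Term Ψ 0 → Term (suc Ψ) 0
  F₀ = F s s′ A ζ B

  -- F below the binder y of Nᵢ.
  F₁ : Term (suc Ψ) 0 → Term (suc (suc Ψ)) 0
  F₁ = F (wkᵈ s) (wkᵈ s′) (wk A) (map wkᵉ ζ) (map wk₁ B)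

  O Q : Term Ψ 0
  O = hcom r r′ A (F₀ M ⟨ s ⟩) ξ (map (λ Nᵢ → F₁ Nᵢ ⟨ wkᵈ s ⟩) N)
  Q = hcom s s′ A O
           (ξ ++ ζ ++ (r , r′) ∷ [])
           (map (λ Nᵢ → F₀ (Nᵢ ⟨ r′ ⟩)) N
            ++ map (λ Bⱼ → coe (name zero) (wkᵈ s) (wk₁ Bⱼ) (P Bⱼ)) B
            ++ F₀ M ∷ [])

-- Defined iff x # r, for x the most recently bound name.
strengthen : ∀ {Ψ} → Dim (suc Ψ) → Maybe (Dim Ψ)
strengthen (const ε)      = just (const ε)
strengthen (name zero)    = nothing
strengthen (name (suc x)) = just (name x)

strengthenᵉ : ∀ {Ψ} → Eqn (suc Ψ) → Maybe (Eqn Ψ)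
strengthenᵉ (r , r′) = Maybe.zip (strengthen r) (strengthen r′)

-- The entries ξᵢ ↪ Nᵢ with x # ξᵢ.
freshEntries : ∀ {Ψ k} → Vec (Eqn (suc Ψ)) k → Vec (Term (suc Ψ) 0) k → List (Eqn Ψ × Term (suc Ψ) 0)
freshEntries ξ N = mapMaybe (λ (e , Nᵢ) → Maybe.map (_, Nᵢ) (strengthenᵉ e)) (toList (zip ξ N))

gcomList : ∀ {Ψ} → Dim Ψ → Dim Ψ → Term (suc Ψ) 0 → Term Ψ 0 → List (Eqn Ψ × Term (suc Ψ) 0) → Term Ψ 0
gcomList r r′ A M T = gcom r r′ A M (map proj₁ (fromList T)) (map proj₂ (fromList T))

coeFcom-rhs : ∀ {Ψ k} → Dim Ψ → Dim Ψ →
              (s s′ : Dim (suc Ψ)) → Term (suc Ψ) 0 → Vec (Eqn (suc Ψ)) k → Vec (Term (suc (suc Ψ)) 0) k →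
              Term Ψ 0 → Term Ψ 0
coeFcom-rhs {Ψ} r r′ s s′ A ξ B M =
  box s s′
      (hcom s s′ A (wk P)
            (ξ ++ (wkᵈ r , wkᵈ r′) ∷ [])
            (map (λ Bᵢ → coe (name zero) (wkᵈ s) (wk₁ Bᵢ) (wk₁ (Q Bᵢ))) B
             ++ wk₁ O ∷ []))
      ξ
      (map (λ Bᵢ → wk₁ (Q Bᵢ) ⟨ s′ ⟩) B)
  ⟨ r′ ⟩
  where
  -- N binds x, then z.
  N : Term (suc (suc Ψ)) 0 → Term (suc (suc Ψ)) 0
  N Bᵢ = coe (wkᵈ s′) (name zero) (wk₁ Bᵢ)
             (wk (coe (wkᵈ r) (name zero) (wk₁ (Bᵢ ⟨ s′ ⟩)) (wk M)))

  -- O binds z.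
  O : Term (suc Ψ) 0
  O = fill s′ A (cap s s′ (wk M) ξ B) ξ (map (λ Bᵢ → coe (name zero) (wkᵈ s) (wk₁ Bᵢ) (N Bᵢ)) B) ⟨ r ⟩₁

  P : Term Ψ 0
  P = gcomList r r′ A (O ⟨ s ⟪ r ∷ idₛ ⟫ᵈ ⟩)
        (freshEntries (ξ ++ (s , s′) ∷ [])
                      (map (λ Bᵢ → N Bᵢ ⟨ s ⟩) B ++ coe (wkᵈ r) (name zero) (wk₁ A) (wk M) ∷ []))

  -- Q binds z.
  Q : Term (suc (suc Ψ)) 0 → Term (suc Ψ) 0
  Q Bₖ = gcom (wkᵈ (s ⟪ r′ ∷ idₛ ⟫ᵈ)) (name zero) (wk₁ (Bₖ ⟨ r′ ⟩₁)) (wk P)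
              (map wkᵉ (map proj₁ (fromList T) ++ (r , r′) ∷ []))
              (map wk₁ (map proj₂ (fromList T) ++ N Bₖ ⟨ r′ ⟩₁ ∷ []))
    where
    T : List (Eqn Ψ × Term (suc Ψ) 0)
    T = freshEntries ξ (map (λ Bᵢ → N Bᵢ ⟨ r′ ⟩₁) B)

infix 4 _⟼_ _⟼*_ _⇓_
data _⟼_ {Ψ} : Term Ψ 0 → Term Ψ 0 → Set where

  -- congruence
  hcom-cong   : ∀ {k r r′ A A′ M} {ξ : Vec (Eqn Ψ) k} {N} → A ⟼ A′ → hcom r r′ A M ξ N ⟼ hcom r r′ A′ M ξ N
  coe-cong    : ∀ {r r′ M} {A A′ : Term (suc Ψ) 0} → A ⟼ A′ → coe r r′ A M ⟼ coe r r′ A′ M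
  app-cong    : ∀ {M M′ N} → M ⟼ M′ → app M N ⟼ app M′ N
  fst-cong    : ∀ {M M′} → M ⟼ M′ → fst M ⟼ fst M′
  snd-cong    : ∀ {M M′} → M ⟼ M′ → snd M ⟼ snd M′
  at-cong     : ∀ {M M′ r} → M ⟼ M′ → M at r ⟼ M′ at r
  natrec-cong : ∀ {M M′ Z S} → M ⟼ M′ → natrec M Z S ⟼ natrec M′ Z S
  if-cong     : ∀ {A M M′ T F} → M ⟼ M′ → ifᵗ A M T F ⟼ ifᵗ A M′ T F
  S¹elim-cong : ∀ {A M M′ P L} → M ⟼ M′ → S¹elim A M P L ⟼ S¹elim A M′ P L
  Vproj-cong  : ∀ {x M M′ F} → M ⟼ M′ → Vproj (name x) M F ⟼ Vproj (name x) M′ F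
  cap-cong    : ∀ {k r r′ M M′} {ξ : Vec (Eqn Ψ) k} {B} → r ≢ r′ → AllApart ξ → M ⟼ M′ →
                cap r r′ M ξ B ⟼ cap r r′ M′ ξ B

  -- general Kan operations
  com-β  : ∀ {k r r′ A M} {ξ : Vec (Eqn Ψ) k} {N} →
           com r r′ A M ξ N ⟼
           hcom r r′ (A ⟨ r′ ⟩) (coe r r′ A M) ξ (map (λ Nᵢ → coe (name zero) (wkᵈ r′) (wk₁ A) Nᵢ) N)
  gcom-β : ∀ {k r r′ A M} {ξ : Vec (Eqn Ψ) k} {N} →
           gcom r r′ A M ξ N ⟼
           ghcom r r′ (A ⟨ r′ ⟩) (coe r r′ A M) ξ (map (λ Nᵢ → coe (name zero) (wkᵈ r′) (wk₁ A) Nᵢ) N)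
  fcom-cap : ∀ {k r r′ M} {ξ : Vec (Eqn Ψ) k} {N} → r ≡ r′ → fcom r r′ M ξ N ⟼ M
  fcom-tube : ∀ {k r r′ M} {ξ : Vec (Eqn Ψ) k} {N} j → r ≢ r′ → Least ξ j →
              fcom r r′ M ξ N ⟼ lookup N j ⟨ r′ ⟩
  ghcom-[] : ∀ {r r′ A M} → ghcom r r′ A M [] [] ⟼ M
  ghcom-∷ : ∀ {k r r′ A M e N} {ξ : Vec (Eqn Ψ) k} {Ns} →
            ghcom r r′ A M (e ∷ ξ) (N ∷ Ns) ⟼ ghcom-rhs r r′ A M e N ξ Ns

  -- functions
  app-β  : ∀ {M N} → app (lam M) N ⟼ M [ N ]
  hcom-Π : ∀ {k r r′ A B M} {ξ : Vec (Eqn Ψ) k} {N} →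
           hcom r r′ (Πᵗ A B) M ξ N ⟼
           lam (hcom r r′ B (app (wkᵛ M) (var zero)) ξ (map (λ Nᵢ → app (wkᵛ Nᵢ) (var zero)) N))
  coe-Π  : ∀ {r r′ A B M} →
           coe r r′ (Πᵗ A B) M ⟼
           lam (coe r r′ (B [ coe (wkᵈ r′) (name zero) (wk₁ (wkᵛ A)) (var zero) ])
                         (app (wkᵛ M) (coe r′ r (wkᵛ A) (var zero))))

  -- pairs
  fst-β  : ∀ {M N} → fst (pair M N) ⟼ M
  snd-β  : ∀ {M N} → snd (pair M N) ⟼ N
  hcom-Σ : ∀ {k r r′ A B M} {ξ : Vec (Eqn Ψ) k} {N} →
           hcom r r′ (Σᵗ A B) M ξ N ⟼
           pair (hcom r r′ A (fst M) ξ (map (λ Nᵢ → fst Nᵢ) N))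
                (com r r′ (wk B [ fill r A (fst M) ξ (map (λ Nᵢ → fst Nᵢ) N) ])
                          (snd M) ξ (map (λ Nᵢ → snd Nᵢ) N))
  coe-Σ  : ∀ {r r′ A B M} →
           coe r r′ (Σᵗ A B) M ⟼
           pair (coe r r′ A (fst M))
                (coe r r′ (B [ coe (wkᵈ r) (name zero) (wk₁ A) (wk (fst M)) ]) (snd M))

  -- paths
  at-β      : ∀ {M r} → plam M at r ⟼ M ⟨ r ⟩
  hcom-Path : ∀ {k r r′ A P₀ P₁ M} {ξ : Vec (Eqn Ψ) k} {N} →
              hcom r r′ (Pathᵗ A P₀ P₁) M ξ N ⟼
              plam (hcom (wkᵈ r) (wkᵈ r′) A (wk M at name zero)
                         ((name zero , 𝟎) ∷ (name zero , 𝟏) ∷ map wkᵉ ξ)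
                         (wk (wk P₀) ∷ wk (wk P₁) ∷ map (λ Nᵢ → wk₁ Nᵢ at name (suc zero)) N))
  coe-Path  : ∀ {r r′ A P₀ P₁ M} →
              coe r r′ (Pathᵗ A P₀ P₁) M ⟼
              plam (com (wkᵈ r) (wkᵈ r′) (swap A) (wk M at name zero)
                        ((name zero , 𝟎) ∷ (name zero , 𝟏) ∷ [])
                        (wk₁ P₀ ∷ wk₁ P₁ ∷ []))

  -- equality
  hcom-Eq : ∀ {k r r′ A E₀ E₁ M} {ξ : Vec (Eqn Ψ) k} {N} → hcom r r′ (Eqᵗ A E₀ E₁) M ξ N ⟼ star

  -- base types
  -- S binds n, then a; so a is zero.
  natrec-z : ∀ {Z S} → natrec zᵗ Z S ⟼ Z
  natrec-s : ∀ {M Z S} → natrec (sᵗ M) Z S ⟼ sub (natrec M Z S ∷ M ∷ []) S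
  if-true  : ∀ {A T F} → ifᵗ A trueᵗ T F ⟼ T
  if-false : ∀ {A T F} → ifᵗ A falseᵗ T F ⟼ F
  hcom-nat   : ∀ {k r r′ M} {ξ : Vec (Eqn Ψ) k} {N} → hcom r r′ natᵗ M ξ N ⟼ M
  hcom-bool  : ∀ {k r r′ M} {ξ : Vec (Eqn Ψ) k} {N} → hcom r r′ boolᵗ M ξ N ⟼ M
  hcom-wbool : ∀ {k r r′ M} {ξ : Vec (Eqn Ψ) k} {N} → hcom r r′ wboolᵗ M ξ N ⟼ fcom r r′ M ξ N
  hcom-S¹    : ∀ {k r r′ M} {ξ : Vec (Eqn Ψ) k} {N} → hcom r r′ S¹ᵗ M ξ N ⟼ fcom r r′ M ξ N
  coe-nat   : ∀ {r r′ M} → coe r r′ natᵗ M ⟼ M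
  coe-bool  : ∀ {r r′ M} → coe r r′ boolᵗ M ⟼ M
  coe-wbool : ∀ {r r′ M} → coe r r′ wboolᵗ M ⟼ M
  coe-S¹    : ∀ {r r′ M} → coe r r′ S¹ᵗ M ⟼ M
  loop-ε      : ∀ {ε} → loop (const ε) ⟼ base
  S¹elim-base : ∀ {A P L} → S¹elim A base P L ⟼ P
  S¹elim-loop : ∀ {A w P L} → S¹elim A (loop (name w)) P L ⟼ L ⟨ name w ⟩
  if-fcom     : ∀ {k r r′ A M T F} {ξ : Vec (Eqn Ψ) k} {N} → r ≢ r′ → AllApart ξ →
                ifᵗ A (fcom r r′ M ξ N) T F ⟼
                com r r′ (wk A [ ffill r M ξ N ]) (ifᵗ A M T F) ξ
                    (map (λ Nᵢ → ifᵗ (wk A) Nᵢ (wk T) (wk F)) N)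
  S¹elim-fcom : ∀ {k r r′ A M P L} {ξ : Vec (Eqn Ψ) k} {N} → r ≢ r′ → AllApart ξ →
                S¹elim A (fcom r r′ M ξ N) P L ⟼
                com r r′ (wk A [ ffill r M ξ N ]) (S¹elim A M P L) ξ
                    (map (λ Nᵢ → S¹elim (wk A) Nᵢ (wk P) (wk₁ L)) N)

  -- V types
  V-0       : ∀ {A B E} → V 𝟎 A B E ⟼ A
  V-1       : ∀ {A B E} → V 𝟏 A B E ⟼ B
  Vin-0     : ∀ {M N} → Vin 𝟎 M N ⟼ M
  Vin-1     : ∀ {M N} → Vin 𝟏 M N ⟼ N
  Vproj-0   : ∀ {M F} → Vproj 𝟎 M F ⟼ app F M
  Vproj-1   : ∀ {M F} → Vproj 𝟏 M F ⟼ M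
  Vproj-Vin : ∀ {x M N F} → Vproj (name x) (Vin (name x) M N) F ⟼ N
  hcom-V    : ∀ {k r r′ x A B E M} {ξ : Vec (Eqn Ψ) k} {N} →
              hcom r r′ (V (name x) A B E) M ξ N ⟼ hcomV-rhs r r′ x A B E M ξ N
  coe-V-0   : ∀ {r′ A B E M} →
              coe 𝟎 r′ (V (name zero) A B E) M ⟼ Vin r′ M (coe 𝟎 r′ B (app (fst (E ⟨ 𝟎 ⟩)) M))
  coe-V-1   : ∀ {r′ A B E N} →
              coe 𝟏 r′ (V (name zero) A B E) N ⟼ coeV₁-rhs r′ A B E N
  coe-V-y   : ∀ {y r′ A B E M} →
              coe (name y) r′ (V (name zero) A B E) M ⟼ coeVy-rhs y r′ A B E M
  coe-V-x   : ∀ {r r′ x A B E M} →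
              coe r r′ (V (name (suc x)) A B E) M ⟼ coeVx-rhs r r′ x A B E M

  -- universes and composite types
  hcom-U   : ∀ {k r r′ j M} {ξ : Vec (Eqn Ψ) k} {N} → hcom r r′ (U Kan j) M ξ N ⟼ fcom r r′ M ξ N
  coe-U    : ∀ {r r′ κ j M} → coe r r′ (U κ j) M ⟼ M
  box-cap  : ∀ {k r r′ M} {ξ : Vec (Eqn Ψ) k} {N} → r ≡ r′ → box r r′ M ξ N ⟼ M
  box-tube : ∀ {k r r′ M} {ξ : Vec (Eqn Ψ) k} {N} j → r ≢ r′ → Least ξ j → box r r′ M ξ N ⟼ lookup N j
  cap-cap  : ∀ {k r r′ M} {ξ : Vec (Eqn Ψ) k} {B} → r ≡ r′ → cap r r′ M ξ B ⟼ M
  cap-tube : ∀ {k r r′ M} {ξ : Vec (Eqn Ψ) k} {B} j → r ≢ r′ → Least ξ j →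
             cap r r′ M ξ B ⟼ coe r′ r (lookup B j) M
  cap-box  : ∀ {k r r′ M} {ξ : Vec (Eqn Ψ) k} {N B} → r ≢ r′ → AllApart ξ →
             cap r r′ (box r r′ M ξ N) ξ B ⟼ M
  hcom-fcom : ∀ {k l r r′ s s′ A M} {ζ : Vec (Eqn Ψ) l} {B} {ξ : Vec (Eqn Ψ) k} {N} → s ≢ s′ → AllApart ζ →
              hcom r r′ (fcom s s′ A ζ B) M ξ N ⟼ hcomFcom-rhs r r′ s s′ A ζ B M ξ N
  coe-fcom  : ∀ {k r r′ s s′ A M} {ξ : Vec (Eqn (suc Ψ)) k} {B} → s ≢ s′ → AllApart ξ →
              coe r r′ (fcom s s′ A ξ B) M ⟼ coeFcom-rhs r r′ s s′ A ξ B M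

_⟼*_ : ∀ {Ψ} → Term Ψ 0 → Term Ψ 0 → Set
_⟼*_ = Star _⟼_

_⇓_ : ∀ {Ψ} → Term Ψ 0 → Term Ψ 0 → Set
M ⇓ W = (M ⟼* W) × Val W

-- The side condition (†) on the equations of a value fcom.
Valid : ∀ {Ψ k} → Dim Ψ → Dim Ψ → Vec (Eqn Ψ) k → Set
Valid r r′ ξ =
  r ≢ r′ × AllApart ξ ×
  ∃₂ λ i j → ∃ λ s → lookup ξ i ≡ (s , 𝟎) × lookup ξ j ≡ (s , 𝟏)

------------------------------------------------------------------------
-- Relations
--
-- A relation φ is valued in Set ℓ; an equation φ = {...} between relations
-- is read extensionally (_≃_).  The type system at stage n of the hierarchy
-- uses ℓ = level n, because the universe relations "for some φ, τ(Ψ,A,B,φ)"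
-- raise the level; the limit system, which contains all universes, uses
-- relations valued in Setω.  Agda has no polymorphism over both kinds of
-- sort, so the definitions in Relations and System are repeated verbatim
-- in Relationsω and Systemω with the sorts changed.
--
-- Candidates are not restricted to values by a separate condition: every
-- operator below relates values only, and yields relations on values only.

module Relations (ℓ : Level) where

  Rel : ℕ → Set (lsuc ℓ)
  Rel Ψ = Term Ψ 0 → Term Ψ 0 → Set ℓ

  ΨRel : ℕ → Set (lsuc ℓ)
  ΨRel Ψ = ∀ {Ψ′} → Ψ′ ⇒ Ψ → Rel Ψ′

  infixl 20 _·_
  _·_ : ∀ {Ψ Ψ′} → ΨRel Ψ → Ψ′ ⇒ Ψ → ΨRel Ψ′
  (α · ψ) ψ′ = α (ψ ⨾ ψ′)

  infix 4 _≃_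
  record _≃_ {Ψ} (φ χ : Rel Ψ) : Set ℓ where
    constructor equal
    field
      to   : ∀ {M N} → φ M N → χ M N
      from : ∀ {M N} → χ M N → φ M N

  -- R^⇓
  record Eval {Ψ} (R : Rel Ψ) (M N : Term Ψ 0) : Set ℓ where
    constructor eval
    field
      {M₀ N₀} : Term Ψ 0
      M⇓      : M ⇓ M₀
      N⇓      : N ⇓ N₀
      related : R M₀ N₀

  record TmAt {Ψ Ψ₁ Ψ₂} (α : ΨRel Ψ) (M N : Term Ψ 0) (ψ₁ : Ψ₁ ⇒ Ψ) (ψ₂ : Ψ₂ ⇒ Ψ₁) : Set ℓ where
    constructor tmAt
    field
      {M₁ N₁} : Term Ψ₁ 0
      M⇓      : M ⟪ ψ₁ ⟫ ⇓ M₁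
      N⇓      : N ⟪ ψ₁ ⟫ ⇓ N₁
      M₁-M    : Eval (α (ψ₁ ⨾ ψ₂)) (M₁ ⟪ ψ₂ ⟫) (M ⟪ ψ₁ ⟫ ⟪ ψ₂ ⟫)
      M-M₁    : Eval (α (ψ₁ ⨾ ψ₂)) (M ⟪ ψ₁ ⟫ ⟪ ψ₂ ⟫) (M₁ ⟪ ψ₂ ⟫)
      N₁-N    : Eval (α (ψ₁ ⨾ ψ₂)) (N₁ ⟪ ψ₂ ⟫) (N ⟪ ψ₁ ⟫ ⟪ ψ₂ ⟫)
      N-N₁    : Eval (α (ψ₁ ⨾ ψ₂)) (N ⟪ ψ₁ ⟫ ⟪ ψ₂ ⟫) (N₁ ⟪ ψ₂ ⟫)
      M₁-N₁   : Eval (α (ψ₁ ⨾ ψ₂)) (M₁ ⟪ ψ₂ ⟫) (N₁ ⟪ ψ₂ ⟫)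

  Tm : ∀ {Ψ} → ΨRel Ψ → Rel Ψ
  Tm {Ψ} α M N = ∀ {Ψ₁ Ψ₂} (ψ₁ : Ψ₁ ⇒ Ψ) (ψ₂ : Ψ₂ ⇒ Ψ₁) → TmAt α M N ψ₁ ψ₂

  Coh : ∀ {Ψ} → ΨRel Ψ → Set ℓ
  Coh {Ψ} α = ∀ {Ψ′} (ψ : Ψ′ ⇒ Ψ) {M₀ N₀} → α ψ M₀ N₀ → Tm (α · ψ) M₀ N₀

------------------------------------------------------------------------
-- The inductive element relations ℕ, 𝔹 and ℂ

open Relations lzero using () renaming (Rel to Rel₀; ΨRel to ΨRel₀; Tm to Tm₀)

-- R(Ψ), for a context-indexed relation R.
indexed : (∀ Ψ → Rel₀ Ψ) → ∀ {Ψ} → ΨRel₀ Ψ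
indexed R {Ψ′ = Ψ′} ψ = R Ψ′

data FKan (R : ∀ Ψ → Rel₀ Ψ) (Ψ : ℕ) : Rel₀ Ψ where
  fkan : ∀ {k r r′ M M′} {ξ : Vec (Eqn Ψ) k} {N N′} →
         Valid r r′ ξ →
         Tm₀ (indexed R) M M′ →
         (∀ {Ψ′} i j (ψ : Ψ′ ⇒ suc Ψ) → Holds (wkᵉ (lookup ξ i) ⟪ ψ ⟫ᵉ) → Holds (wkᵉ (lookup ξ j) ⟪ ψ ⟫ᵉ) →
            Tm₀ (indexed R) (lookup N i ⟪ ψ ⟫) (lookup N′ j ⟪ ψ ⟫)) →
         (∀ {Ψ′} i (ψ : Ψ′ ⇒ Ψ) → Holds (lookup ξ i ⟪ ψ ⟫ᵉ) →
            Tm₀ (indexed R) (lookup N i ⟨ r ⟩ ⟪ ψ ⟫) (M ⟪ ψ ⟫)) →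
         FKan R Ψ (fcom r r′ M ξ N) (fcom r r′ M′ ξ N′)

data ℕᴿ (Ψ : ℕ) : Rel₀ Ψ where
  zᴿ : ℕᴿ Ψ zᵗ zᵗ
  sᴿ : ∀ {M M′} → Tm₀ (indexed ℕᴿ) M M′ → ℕᴿ Ψ (sᵗ M) (sᵗ M′)

data Boolᴿ (Ψ : ℕ) : Rel₀ Ψ where
  trueᴿ  : Boolᴿ Ψ trueᵗ trueᵗ
  falseᴿ : Boolᴿ Ψ falseᵗ falseᵗ

data 𝔹ᴿ (Ψ : ℕ) : Rel₀ Ψ where
  trueᴿ  : 𝔹ᴿ Ψ trueᵗ trueᵗ
  falseᴿ : 𝔹ᴿ Ψ falseᵗ falseᵗ
  fkanᴿ  : ∀ {M M′} → FKan 𝔹ᴿ Ψ M M′ → 𝔹ᴿ Ψ M M′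

data ℂᴿ (Ψ : ℕ) : Rel₀ Ψ where
  baseᴿ : ℂᴿ Ψ base base
  loopᴿ : ∀ x → ℂᴿ Ψ (loop (name x)) (loop (name x))
  fkanᴿ : ∀ {M M′} → FKan ℂᴿ Ψ M M′ → ℂᴿ Ψ M M′

------------------------------------------------------------------------
-- Candidate cubical type systems and the operators on them

module System (ℓ : Level) where

  open Relations ℓ

  Cand : Set (lsuc (lsuc ℓ))
  Cand = ∀ Ψ → Term Ψ 0 → Term Ψ 0 → Rel Ψ → Set (lsuc ℓ)

  record EvalTy (τ : Cand) (Ψ : ℕ) (A B : Term Ψ 0) (φ : Rel Ψ) : Set (lsuc ℓ) where
    constructor eval
    field
      {A₀ B₀} : Term Ψ 0
      A⇓      : A ⇓ A₀
      B⇓      : B ⇓ B₀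
      related : τ Ψ A₀ B₀ φ

  record PTyAt (τ : Cand) {Ψ Ψ₁ Ψ₂} (A B : Term Ψ 0) (ψ₁ : Ψ₁ ⇒ Ψ) (ψ₂ : Ψ₂ ⇒ Ψ₁) : Set (lsuc ℓ) where
    constructor ptyAt
    field
      {A₁ B₁} : Term Ψ₁ 0
      A⇓      : A ⟪ ψ₁ ⟫ ⇓ A₁
      B⇓      : B ⟪ ψ₁ ⟫ ⇓ B₁
      φ       : Rel Ψ₂
      A₁-A    : EvalTy τ Ψ₂ (A₁ ⟪ ψ₂ ⟫) (A ⟪ ψ₁ ⟫ ⟪ ψ₂ ⟫) φ
      A-A₁    : EvalTy τ Ψ₂ (A ⟪ ψ₁ ⟫ ⟪ ψ₂ ⟫) (A₁ ⟪ ψ₂ ⟫) φ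
      B₁-B    : EvalTy τ Ψ₂ (B₁ ⟪ ψ₂ ⟫) (B ⟪ ψ₁ ⟫ ⟪ ψ₂ ⟫) φ
      B-B₁    : EvalTy τ Ψ₂ (B ⟪ ψ₁ ⟫ ⟪ ψ₂ ⟫) (B₁ ⟪ ψ₂ ⟫) φ
      A₁-B₁   : EvalTy τ Ψ₂ (A₁ ⟪ ψ₂ ⟫) (B₁ ⟪ ψ₂ ⟫) φ

  record PTy (τ : Cand) (Ψ : ℕ) (A B : Term Ψ 0) (α : ΨRel Ψ) : Set (lsuc ℓ) where
    constructor mkPTy
    field
      types    : ∀ {Ψ′} (ψ : Ψ′ ⇒ Ψ) → EvalTy τ Ψ′ (A ⟪ ψ ⟫) (B ⟪ ψ ⟫) (α ψ)
      coherent : ∀ {Ψ₁ Ψ₂} (ψ₁ : Ψ₁ ⇒ Ψ) (ψ₂ : Ψ₂ ⇒ Ψ₁) → PTyAt τ A B ψ₁ ψ₂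

  -- PTy(τ)(Ψ,A,B,_)
  record SomePTy (τ : Cand) (Ψ : ℕ) (A B : Term Ψ 0) : Set (lsuc ℓ) where
    constructor somePTy
    field
      α   : ΨRel Ψ
      pty : PTy τ Ψ A B α

  -- The families β, α, η below are indexed by all ψ, M, M′, i, j, but nothing
  -- is required of, or read off from, indices outside the stated conditions.

  -- β^{ψ,M,M′}
  Fam : ℕ → Set (lsuc ℓ)
  Fam Ψ = ∀ {Ψ′} → Ψ′ ⇒ Ψ → Term Ψ′ 0 → Term Ψ′ 0 → ΨRel Ψ′

  data Funᴿ {Ψ} (α : ΨRel Ψ) (β : Fam Ψ) : Rel Ψ where
    lamᴿ : ∀ {N N′} →
           (∀ {Ψ′} (ψ : Ψ′ ⇒ Ψ) M M′ → Tm (α · ψ) M M′ → Tm (β ψ M M′) (N ⟪ ψ ⟫ [ M ]) (N′ ⟪ ψ ⟫ [ M′ ])) →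
           Funᴿ α β (lam N) (lam N′)

  data Pairᴿ {Ψ} (α : ΨRel Ψ) (β : Fam Ψ) : Rel Ψ where
    pairᴿ : ∀ {M M′ N N′} → Tm α M M′ → Tm (β idₛ M M′) N N′ → Pairᴿ α β (pair M N) (pair M′ N′)

  data Pathᴿ {Ψ} (α : ΨRel (suc Ψ)) (P₀ P₁ : Term Ψ 0) : Rel Ψ where
    plamᴿ : ∀ {M M′} → Tm α M M′ → (∀ ε → Tm (α · (const ε ∷ idₛ)) (M ⟨ const ε ⟩) (if ε then P₁ else P₀)) →
            Pathᴿ α P₀ P₁ (plam M) (plam M′)

  data Eqᴿ {Ψ} (α : ΨRel Ψ) (M N : Term Ψ 0) : Rel Ψ where
    starᴿ : Tm α M N → Eqᴿ α M N star star

  -- α^ψ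
  VFam : ℕ → Set (lsuc ℓ)
  VFam Ψ = ∀ {Ψ′} → Ψ′ ⇒ Ψ → ΨRel Ψ′

  data Vᴿ {Ψ} (x : Fin Ψ) (α : VFam Ψ) (β : ΨRel Ψ) (E : Term Ψ 0) : Rel Ψ where
    vinᴿ : ∀ {M M′ N N′} → Tm β N N′ →
           (∀ {Ψ′} (ψ : Ψ′ ⇒ Ψ) → lookup ψ x ≡ 𝟎 → Tm (α ψ) (M ⟪ ψ ⟫) (M′ ⟪ ψ ⟫)) →
           (∀ {Ψ′} (ψ : Ψ′ ⇒ Ψ) → lookup ψ x ≡ 𝟎 → Tm (β · ψ) (app (fst (E ⟪ ψ ⟫)) (M ⟪ ψ ⟫)) (N ⟪ ψ ⟫)) →
           Vᴿ x α β E (Vin (name x) M N) (Vin (name x) M′ N′)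

  -- β^{ψ,i,j}
  FcomFam : ℕ → ℕ → Set (lsuc ℓ)
  FcomFam Ψ k = ∀ {Ψ′} → Ψ′ ⇒ suc Ψ → Fin k → Fin k → ΨRel Ψ′

  data Fcomᴿ {Ψ k} (r r′ : Dim Ψ) (ξ : Vec (Eqn Ψ) k) (B : Vec (Term (suc Ψ) 0) k)
             (α : ΨRel Ψ) (β : FcomFam Ψ k) : Rel Ψ where
    boxᴿ : ∀ {M M′ N N′} → Tm α M M′ →
           (∀ {Ψ′} i j (ψ : Ψ′ ⇒ Ψ) → Holds (lookup ξ i ⟪ ψ ⟫ᵉ) → Holds (lookup ξ j ⟪ ψ ⟫ᵉ) →
              Tm (β (lift ψ) i j · (r′ ⟪ ψ ⟫ᵈ ∷ idₛ)) (lookup N i ⟪ ψ ⟫) (lookup N′ j ⟪ ψ ⟫)) →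
           (∀ {Ψ′} i (ψ : Ψ′ ⇒ Ψ) → Holds (lookup ξ i ⟪ ψ ⟫ᵉ) →
              Tm (α · ψ) (M ⟪ ψ ⟫) (coe (r′ ⟪ ψ ⟫ᵈ) (r ⟪ ψ ⟫ᵈ) (lookup B i ⟪ lift ψ ⟫) (lookup N i ⟪ ψ ⟫))) →
           Fcomᴿ r r′ ξ B α β (box r r′ M ξ N) (box r r′ M′ ξ N′)

  data Fun (τ : Cand) (Ψ : ℕ) : Term Ψ 0 → Term Ψ 0 → Rel Ψ → Set (lsuc ℓ) where
    funᵀ : ∀ {A A′ B B′ φ} (α : ΨRel Ψ) (β : Fam Ψ) →
           PTy τ Ψ A A′ α → Coh α →
           (∀ {Ψ′} (ψ : Ψ′ ⇒ Ψ) M M′ → Tm (α · ψ) M M′ → PTy τ Ψ′ (B ⟪ ψ ⟫ [ M ]) (B′ ⟪ ψ ⟫ [ M′ ]) (β ψ M M′)) →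
           (∀ {Ψ′} (ψ : Ψ′ ⇒ Ψ) M M′ → Tm (α · ψ) M M′ → Coh (β ψ M M′)) →
           φ ≃ Funᴿ α β →
           Fun τ Ψ (Πᵗ A B) (Πᵗ A′ B′) φ

  data Pair (τ : Cand) (Ψ : ℕ) : Term Ψ 0 → Term Ψ 0 → Rel Ψ → Set (lsuc ℓ) where
    pairᵀ : ∀ {A A′ B B′ φ} (α : ΨRel Ψ) (β : Fam Ψ) →
            PTy τ Ψ A A′ α → Coh α →
            (∀ {Ψ′} (ψ : Ψ′ ⇒ Ψ) M M′ → Tm (α · ψ) M M′ → PTy τ Ψ′ (B ⟪ ψ ⟫ [ M ]) (B′ ⟪ ψ ⟫ [ M′ ]) (β ψ M M′)) →
            (∀ {Ψ′} (ψ : Ψ′ ⇒ Ψ) M M′ → Tm (α · ψ) M M′ → Coh (β ψ M M′)) →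
            φ ≃ Pairᴿ α β →
            Pair τ Ψ (Σᵗ A B) (Σᵗ A′ B′) φ

  data Path (τ : Cand) (Ψ : ℕ) : Term Ψ 0 → Term Ψ 0 → Rel Ψ → Set (lsuc ℓ) where
    pathᵀ : ∀ {A A′ P₀ P₁ P₀′ P₁′ φ} (α : ΨRel (suc Ψ)) →
            PTy τ (suc Ψ) A A′ α → Coh α →
            (∀ ε → Tm (α · (const ε ∷ idₛ)) (if ε then P₁ else P₀) (if ε then P₁′ else P₀′)) →
            φ ≃ Pathᴿ α P₀ P₁ →
            Path τ Ψ (Pathᵗ A P₀ P₁) (Pathᵗ A′ P₀′ P₁′) φ

  data Eq (τ : Cand) (Ψ : ℕ) : Term Ψ 0 → Term Ψ 0 → Rel Ψ → Set (lsuc ℓ) where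
    eqᵀ : ∀ {A A′ M M′ N N′ φ} (α : ΨRel Ψ) →
          PTy τ Ψ A A′ α → Coh α →
          Tm α M M′ → Tm α N N′ →
          φ ≃ Eqᴿ α M N →
          Eq τ Ψ (Eqᵗ A M N) (Eqᵗ A′ M′ N′) φ

  data VTy (τ : Cand) (Ψ : ℕ) : Term Ψ 0 → Term Ψ 0 → Rel Ψ → Set (lsuc ℓ) where
    vᵀ : ∀ {x A A′ B B′ E E′ φ} (β : ΨRel Ψ) (α η : VFam Ψ) →
         PTy τ Ψ B B′ β → Coh β →
         (∀ {Ψ′} (ψ : Ψ′ ⇒ Ψ) → lookup ψ x ≡ 𝟎 → PTy τ Ψ′ (A ⟪ ψ ⟫) (A′ ⟪ ψ ⟫) (α ψ)) →
         (∀ {Ψ′} (ψ : Ψ′ ⇒ Ψ) → lookup ψ x ≡ 𝟎 → Coh (α ψ)) →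
         (∀ {Ψ′} (ψ : Ψ′ ⇒ Ψ) → lookup ψ x ≡ 𝟎 →
            PTy τ Ψ′ (Equiv (A ⟪ ψ ⟫) (B ⟪ ψ ⟫)) (Equiv (A ⟪ ψ ⟫) (B ⟪ ψ ⟫)) (η ψ)) →
         (∀ {Ψ′} (ψ : Ψ′ ⇒ Ψ) → lookup ψ x ≡ 𝟎 → Tm (η ψ) (E ⟪ ψ ⟫) (E′ ⟪ ψ ⟫)) →
         φ ≃ Vᴿ x α β E →
         VTy τ Ψ (V (name x) A B E) (V (name x) A′ B′ E′) φ

  data Fcom (τ : Cand) (Ψ : ℕ) : Term Ψ 0 → Term Ψ 0 → Rel Ψ → Set (lsuc ℓ) where
    fcomᵀ : ∀ {k r r′ A A′} {ξ : Vec (Eqn Ψ) k} {B B′ φ} (α : ΨRel Ψ) (β : FcomFam Ψ k) →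
            Valid r r′ ξ →
            PTy τ Ψ A A′ α → Coh α →
            (∀ {Ψ′} i j (ψ : Ψ′ ⇒ suc Ψ) → Holds (wkᵉ (lookup ξ i) ⟪ ψ ⟫ᵉ) → Holds (wkᵉ (lookup ξ j) ⟪ ψ ⟫ᵉ) →
               PTy τ Ψ′ (lookup B i ⟪ ψ ⟫) (lookup B′ j ⟪ ψ ⟫) (β ψ i j)) →
            (∀ {Ψ′} i j (ψ : Ψ′ ⇒ suc Ψ) → Holds (wkᵉ (lookup ξ i) ⟪ ψ ⟫ᵉ) → Holds (wkᵉ (lookup ξ j) ⟪ ψ ⟫ᵉ) →
               Coh (β ψ i j)) →
            (∀ {Ψ′} i (ψ : Ψ′ ⇒ Ψ) → Holds (lookup ξ i ⟪ ψ ⟫ᵉ) →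
               SomePTy τ Ψ′ (lookup B i ⟨ r ⟩ ⟪ ψ ⟫) (A ⟪ ψ ⟫)) →
            φ ≃ Fcomᴿ r r′ ξ B α β →
            Fcom τ Ψ (fcom r r′ A ξ B) (fcom r r′ A′ ξ B′) φ

  data Void (Ψ : ℕ) : Term Ψ 0 → Term Ψ 0 → Rel Ψ → Set (lsuc ℓ) where
    voidᵀ : ∀ {φ} → φ ≃ (λ M N → Lift ℓ ⊥) → Void Ψ voidᵗ voidᵗ φ

  data Nat (Ψ : ℕ) : Term Ψ 0 → Term Ψ 0 → Rel Ψ → Set (lsuc ℓ) where
    natᵀ : ∀ {φ} → φ ≃ (λ M N → Lift ℓ (ℕᴿ Ψ M N)) → Nat Ψ natᵗ natᵗ φ

  data BoolTy (Ψ : ℕ) : Term Ψ 0 → Term Ψ 0 → Rel Ψ → Set (lsuc ℓ) where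
    boolᵀ : ∀ {φ} → φ ≃ (λ M N → Lift ℓ (Boolᴿ Ψ M N)) → BoolTy Ψ boolᵗ boolᵗ φ

  data WB (Ψ : ℕ) : Term Ψ 0 → Term Ψ 0 → Rel Ψ → Set (lsuc ℓ) where
    wboolᵀ : ∀ {φ} → φ ≃ (λ M N → Lift ℓ (𝔹ᴿ Ψ M N)) → WB Ψ wboolᵗ wboolᵗ φ

  data Circ (Ψ : ℕ) : Term Ψ 0 → Term Ψ 0 → Rel Ψ → Set (lsuc ℓ) where
    S¹ᵀ : ∀ {φ} → φ ≃ (λ M N → Lift ℓ (ℂᴿ Ψ M N)) → Circ Ψ S¹ᵗ S¹ᵗ φ

  data UPre (ν : Cand) (Ψ : ℕ) : Term Ψ 0 → Term Ψ 0 → Rel Ψ → Set (lsuc ℓ) where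
    upreᵀ : ∀ {j φ} → ν Ψ (U pre j) (U pre j) φ → UPre ν Ψ (U pre j) (U pre j) φ

  data UKan (ν : Cand) (Ψ : ℕ) : Term Ψ 0 → Term Ψ 0 → Rel Ψ → Set (lsuc ℓ) where
    ukanᵀ : ∀ {j φ} → ν Ψ (U Kan j) (U Kan j) φ → UKan ν Ψ (U Kan j) (U Kan j) φ

  data P (ν σ τ : Cand) (Ψ : ℕ) (A B : Term Ψ 0) (φ : Rel Ψ) : Set (lsuc ℓ) where
    inFun  : Fun τ Ψ A B φ → P ν σ τ Ψ A B φ
    inPair : Pair τ Ψ A B φ → P ν σ τ Ψ A B φ
    inPath : Path τ Ψ A B φ → P ν σ τ Ψ A B φ
    inEq   : Eq τ Ψ A B φ → P ν σ τ Ψ A B φ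
    inV    : VTy τ Ψ A B φ → P ν σ τ Ψ A B φ
    inFcom : Fcom σ Ψ A B φ → P ν σ τ Ψ A B φ
    inVoid : Void Ψ A B φ → P ν σ τ Ψ A B φ
    inNat  : Nat Ψ A B φ → P ν σ τ Ψ A B φ
    inBool : BoolTy Ψ A B φ → P ν σ τ Ψ A B φ
    inWB   : WB Ψ A B φ → P ν σ τ Ψ A B φ
    inCirc : Circ Ψ A B φ → P ν σ τ Ψ A B φ
    inUPre : UPre ν Ψ A B φ → P ν σ τ Ψ A B φ
    inUKan : UKan ν Ψ A B φ → P ν σ τ Ψ A B φ

  data K (ν σ : Cand) (Ψ : ℕ) (A B : Term Ψ 0) (φ : Rel Ψ) : Set (lsuc ℓ) where
    inFun  : Fun σ Ψ A B φ → K ν σ Ψ A B φ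
    inPair : Pair σ Ψ A B φ → K ν σ Ψ A B φ
    inPath : Path σ Ψ A B φ → K ν σ Ψ A B φ
    inV    : VTy σ Ψ A B φ → K ν σ Ψ A B φ
    inFcom : Fcom σ Ψ A B φ → K ν σ Ψ A B φ
    inVoid : Void Ψ A B φ → K ν σ Ψ A B φ
    inNat  : Nat Ψ A B φ → K ν σ Ψ A B φ
    inBool : BoolTy Ψ A B φ → K ν σ Ψ A B φ
    inWB   : WB Ψ A B φ → K ν σ Ψ A B φ
    inCirc : Circ Ψ A B φ → K ν σ Ψ A B φ
    inUKan : UKan ν Ψ A B φ → K ν σ Ψ A B φ

  -- μσ.K(ν,σ) and μτ.P(ν,σ,τ)
  data μKan (ν : Cand) (Ψ : ℕ) (A B : Term Ψ 0) (φ : Rel Ψ) : Set (lsuc ℓ) where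
    roll : K ν (μKan ν) Ψ A B φ → μKan ν Ψ A B φ

  data μpre (ν σ : Cand) (Ψ : ℕ) (A B : Term Ψ 0) (φ : Rel Ψ) : Set (lsuc ℓ) where
    roll : P ν σ (μpre ν σ) Ψ A B φ → μpre ν σ Ψ A B φ

  system : Kind → Cand → Cand
  system pre ν = μpre ν (μKan ν)
  system Kan ν = μKan ν

------------------------------------------------------------------------
-- The finite stages

level : ℕ → Level
level zero    = lzero
level (suc n) = lsuc (level n)

-- The part of a hierarchy of universes below n: each of the relations T
-- interprets a universe U κ j with j < n.
data Universes n (T : ∀ {j} → j <′ n → Kind → ∀ Ψ → Relations.Rel (level n) Ψ) (Ψ : ℕ) :
               Term Ψ 0 → Term Ψ 0 → Relations.Rel (level n) Ψ → Set (lsuc (level n)) where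
  universe : ∀ {j φ} (j<n : j <′ n) κ → Relations._≃_ (level n) φ (T j<n κ Ψ) →
             Universes n T Ψ (U κ j) (U κ j) φ

-- {(A,B) | τ^κ_j(Ψ,A,B,_)} for j < n, lifted to level n.
universeRel : ∀ n {j} → j <′ n → Kind → ∀ Ψ → Relations.Rel (level n) Ψ
universeRel (suc n) (≤′-reflexive refl) κ Ψ A B = ∃ λ φ → System.system (level n) κ (Universes n (universeRel n)) Ψ A B φ
universeRel (suc n) (≤′-step j<n)       κ Ψ A B = Lift _ (universeRel n j<n κ Ψ A B)

νᶠ : ∀ n → System.Cand (level n)
νᶠ n = Universes n (universeRel n)

τᶠ : Kind → ∀ n → System.Cand (level n)
τᶠ κ n = System.system (level n) κ (νᶠ n)

------------------------------------------------------------------------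
-- The limit system

record Liftω {a} (A : Set a) : Setω where
  constructor liftω
  field
    lowerω : A

module Relationsω where

  Rel : ℕ → Setω₁
  Rel Ψ = Term Ψ 0 → Term Ψ 0 → Setω

  ΨRel : ℕ → Setω₁
  ΨRel Ψ = ∀ {Ψ′} → Ψ′ ⇒ Ψ → Rel Ψ′

  infixl 20 _·_
  _·_ : ∀ {Ψ Ψ′} → ΨRel Ψ → Ψ′ ⇒ Ψ → ΨRel Ψ′
  (α · ψ) ψ′ = α (ψ ⨾ ψ′)

  infix 4 _≃_
  record _≃_ {Ψ} (φ χ : Rel Ψ) : Setω where
    constructor equal
    field
      to   : ∀ {M N} → φ M N → χ M N
      from : ∀ {M N} → χ M N → φ M N

  -- R^⇓
  record Eval {Ψ} (R : Rel Ψ) (M N : Term Ψ 0) : Setω where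
    constructor eval
    field
      {M₀ N₀} : Term Ψ 0
      M⇓      : M ⇓ M₀
      N⇓      : N ⇓ N₀
      related : R M₀ N₀

  record TmAt {Ψ Ψ₁ Ψ₂} (α : ΨRel Ψ) (M N : Term Ψ 0) (ψ₁ : Ψ₁ ⇒ Ψ) (ψ₂ : Ψ₂ ⇒ Ψ₁) : Setω where
    constructor tmAt
    field
      {M₁ N₁} : Term Ψ₁ 0
      M⇓      : M ⟪ ψ₁ ⟫ ⇓ M₁
      N⇓      : N ⟪ ψ₁ ⟫ ⇓ N₁
      M₁-M    : Eval (α (ψ₁ ⨾ ψ₂)) (M₁ ⟪ ψ₂ ⟫) (M ⟪ ψ₁ ⟫ ⟪ ψ₂ ⟫)
      M-M₁    : Eval (α (ψ₁ ⨾ ψ₂)) (M ⟪ ψ₁ ⟫ ⟪ ψ₂ ⟫) (M₁ ⟪ ψ₂ ⟫)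
      N₁-N    : Eval (α (ψ₁ ⨾ ψ₂)) (N₁ ⟪ ψ₂ ⟫) (N ⟪ ψ₁ ⟫ ⟪ ψ₂ ⟫)
      N-N₁    : Eval (α (ψ₁ ⨾ ψ₂)) (N ⟪ ψ₁ ⟫ ⟪ ψ₂ ⟫) (N₁ ⟪ ψ₂ ⟫)
      M₁-N₁   : Eval (α (ψ₁ ⨾ ψ₂)) (M₁ ⟪ ψ₂ ⟫) (N₁ ⟪ ψ₂ ⟫)

  Tm : ∀ {Ψ} → ΨRel Ψ → Rel Ψ
  Tm {Ψ} α M N = ∀ {Ψ₁ Ψ₂} (ψ₁ : Ψ₁ ⇒ Ψ) (ψ₂ : Ψ₂ ⇒ Ψ₁) → TmAt α M N ψ₁ ψ₂

  Coh : ∀ {Ψ} → ΨRel Ψ → Setω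
  Coh {Ψ} α = ∀ {Ψ′} (ψ : Ψ′ ⇒ Ψ) {M₀ N₀} → α ψ M₀ N₀ → Tm (α · ψ) M₀ N₀

module Systemω where

  open Relationsω

  Cand : Setω₂
  Cand = ∀ Ψ → Term Ψ 0 → Term Ψ 0 → Rel Ψ → Setω₁

  record EvalTy (τ : Cand) (Ψ : ℕ) (A B : Term Ψ 0) (φ : Rel Ψ) : Setω₁ where
    constructor eval
    field
      {A₀ B₀} : Term Ψ 0
      A⇓      : A ⇓ A₀
      B⇓      : B ⇓ B₀
      related : τ Ψ A₀ B₀ φ

  record PTyAt (τ : Cand) {Ψ Ψ₁ Ψ₂} (A B : Term Ψ 0) (ψ₁ : Ψ₁ ⇒ Ψ) (ψ₂ : Ψ₂ ⇒ Ψ₁) : Setω₁ where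
    constructor ptyAt
    field
      {A₁ B₁} : Term Ψ₁ 0
      A⇓      : A ⟪ ψ₁ ⟫ ⇓ A₁
      B⇓      : B ⟪ ψ₁ ⟫ ⇓ B₁
      φ       : Rel Ψ₂
      A₁-A    : EvalTy τ Ψ₂ (A₁ ⟪ ψ₂ ⟫) (A ⟪ ψ₁ ⟫ ⟪ ψ₂ ⟫) φ
      A-A₁    : EvalTy τ Ψ₂ (A ⟪ ψ₁ ⟫ ⟪ ψ₂ ⟫) (A₁ ⟪ ψ₂ ⟫) φ
      B₁-B    : EvalTy τ Ψ₂ (B₁ ⟪ ψ₂ ⟫) (B ⟪ ψ₁ ⟫ ⟪ ψ₂ ⟫) φ
      B-B₁    : EvalTy τ Ψ₂ (B ⟪ ψ₁ ⟫ ⟪ ψ₂ ⟫) (B₁ ⟪ ψ₂ ⟫) φ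
      A₁-B₁   : EvalTy τ Ψ₂ (A₁ ⟪ ψ₂ ⟫) (B₁ ⟪ ψ₂ ⟫) φ

  record PTy (τ : Cand) (Ψ : ℕ) (A B : Term Ψ 0) (α : ΨRel Ψ) : Setω₁ where
    constructor mkPTy
    field
      types    : ∀ {Ψ′} (ψ : Ψ′ ⇒ Ψ) → EvalTy τ Ψ′ (A ⟪ ψ ⟫) (B ⟪ ψ ⟫) (α ψ)
      coherent : ∀ {Ψ₁ Ψ₂} (ψ₁ : Ψ₁ ⇒ Ψ) (ψ₂ : Ψ₂ ⇒ Ψ₁) → PTyAt τ A B ψ₁ ψ₂

  -- PTy(τ)(Ψ,A,B,_)
  record SomePTy (τ : Cand) (Ψ : ℕ) (A B : Term Ψ 0) : Setω₁ where
    constructor somePTy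
    field
      α   : ΨRel Ψ
      pty : PTy τ Ψ A B α

  -- The families β, α, η below are indexed by all ψ, M, M′, i, j, but nothing
  -- is required of, or read off from, indices outside the stated conditions.

  -- β^{ψ,M,M′}
  Fam : ℕ → Setω₁
  Fam Ψ = ∀ {Ψ′} → Ψ′ ⇒ Ψ → Term Ψ′ 0 → Term Ψ′ 0 → ΨRel Ψ′

  data Funᴿ {Ψ} (α : ΨRel Ψ) (β : Fam Ψ) : Rel Ψ where
    lamᴿ : ∀ {N N′} →
           (∀ {Ψ′} (ψ : Ψ′ ⇒ Ψ) M M′ → Tm (α · ψ) M M′ → Tm (β ψ M M′) (N ⟪ ψ ⟫ [ M ]) (N′ ⟪ ψ ⟫ [ M′ ])) →
           Funᴿ α β (lam N) (lam N′)

  data Pairᴿ {Ψ} (α : ΨRel Ψ) (β : Fam Ψ) : Rel Ψ where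
    pairᴿ : ∀ {M M′ N N′} → Tm α M M′ → Tm (β idₛ M M′) N N′ → Pairᴿ α β (pair M N) (pair M′ N′)

  data Pathᴿ {Ψ} (α : ΨRel (suc Ψ)) (P₀ P₁ : Term Ψ 0) : Rel Ψ where
    plamᴿ : ∀ {M M′} → Tm α M M′ → (∀ ε → Tm (α · (const ε ∷ idₛ)) (M ⟨ const ε ⟩) (if ε then P₁ else P₀)) →
            Pathᴿ α P₀ P₁ (plam M) (plam M′)

  data Eqᴿ {Ψ} (α : ΨRel Ψ) (M N : Term Ψ 0) : Rel Ψ where
    starᴿ : Tm α M N → Eqᴿ α M N star star

  -- α^ψ
  VFam : ℕ → Setω₁
  VFam Ψ = ∀ {Ψ′} → Ψ′ ⇒ Ψ → ΨRel Ψ′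

  data Vᴿ {Ψ} (x : Fin Ψ) (α : VFam Ψ) (β : ΨRel Ψ) (E : Term Ψ 0) : Rel Ψ where
    vinᴿ : ∀ {M M′ N N′} → Tm β N N′ →
           (∀ {Ψ′} (ψ : Ψ′ ⇒ Ψ) → lookup ψ x ≡ 𝟎 → Tm (α ψ) (M ⟪ ψ ⟫) (M′ ⟪ ψ ⟫)) →
           (∀ {Ψ′} (ψ : Ψ′ ⇒ Ψ) → lookup ψ x ≡ 𝟎 → Tm (β · ψ) (app (fst (E ⟪ ψ ⟫)) (M ⟪ ψ ⟫)) (N ⟪ ψ ⟫)) →
           Vᴿ x α β E (Vin (name x) M N) (Vin (name x) M′ N′)

  -- β^{ψ,i,j}
  FcomFam : ℕ → ℕ → Setω₁
  FcomFam Ψ k = ∀ {Ψ′} → Ψ′ ⇒ suc Ψ → Fin k → Fin k → ΨRel Ψ′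

  data Fcomᴿ {Ψ k} (r r′ : Dim Ψ) (ξ : Vec (Eqn Ψ) k) (B : Vec (Term (suc Ψ) 0) k)
             (α : ΨRel Ψ) (β : FcomFam Ψ k) : Rel Ψ where
    boxᴿ : ∀ {M M′ N N′} → Tm α M M′ →
           (∀ {Ψ′} i j (ψ : Ψ′ ⇒ Ψ) → Holds (lookup ξ i ⟪ ψ ⟫ᵉ) → Holds (lookup ξ j ⟪ ψ ⟫ᵉ) →
              Tm (β (lift ψ) i j · (r′ ⟪ ψ ⟫ᵈ ∷ idₛ)) (lookup N i ⟪ ψ ⟫) (lookup N′ j ⟪ ψ ⟫)) →
           (∀ {Ψ′} i (ψ : Ψ′ ⇒ Ψ) → Holds (lookup ξ i ⟪ ψ ⟫ᵉ) →
              Tm (α · ψ) (M ⟪ ψ ⟫) (coe (r′ ⟪ ψ ⟫ᵈ) (r ⟪ ψ ⟫ᵈ) (lookup B i ⟪ lift ψ ⟫) (lookup N i ⟪ ψ ⟫))) →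
           Fcomᴿ r r′ ξ B α β (box r r′ M ξ N) (box r r′ M′ ξ N′)

  data Fun (τ : Cand) (Ψ : ℕ) : Term Ψ 0 → Term Ψ 0 → Rel Ψ → Setω₁ where
    funᵀ : ∀ {A A′ B B′ φ} (α : ΨRel Ψ) (β : Fam Ψ) →
           PTy τ Ψ A A′ α → Coh α →
           (∀ {Ψ′} (ψ : Ψ′ ⇒ Ψ) M M′ → Tm (α · ψ) M M′ → PTy τ Ψ′ (B ⟪ ψ ⟫ [ M ]) (B′ ⟪ ψ ⟫ [ M′ ]) (β ψ M M′)) →
           (∀ {Ψ′} (ψ : Ψ′ ⇒ Ψ) M M′ → Tm (α · ψ) M M′ → Coh (β ψ M M′)) →
           φ ≃ Funᴿ α β →
           Fun τ Ψ (Πᵗ A B) (Πᵗ A′ B′) φ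

  data Pair (τ : Cand) (Ψ : ℕ) : Term Ψ 0 → Term Ψ 0 → Rel Ψ → Setω₁ where
    pairᵀ : ∀ {A A′ B B′ φ} (α : ΨRel Ψ) (β : Fam Ψ) →
            PTy τ Ψ A A′ α → Coh α →
            (∀ {Ψ′} (ψ : Ψ′ ⇒ Ψ) M M′ → Tm (α · ψ) M M′ → PTy τ Ψ′ (B ⟪ ψ ⟫ [ M ]) (B′ ⟪ ψ ⟫ [ M′ ]) (β ψ M M′)) →
            (∀ {Ψ′} (ψ : Ψ′ ⇒ Ψ) M M′ → Tm (α · ψ) M M′ → Coh (β ψ M M′)) →
            φ ≃ Pairᴿ α β →
            Pair τ Ψ (Σᵗ A B) (Σᵗ A′ B′) φ

  data Path (τ : Cand) (Ψ : ℕ) : Term Ψ 0 → Term Ψ 0 → Rel Ψ → Setω₁ where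
    pathᵀ : ∀ {A A′ P₀ P₁ P₀′ P₁′ φ} (α : ΨRel (suc Ψ)) →
            PTy τ (suc Ψ) A A′ α → Coh α →
            (∀ ε → Tm (α · (const ε ∷ idₛ)) (if ε then P₁ else P₀) (if ε then P₁′ else P₀′)) →
            φ ≃ Pathᴿ α P₀ P₁ →
            Path τ Ψ (Pathᵗ A P₀ P₁) (Pathᵗ A′ P₀′ P₁′) φ

  data Eq (τ : Cand) (Ψ : ℕ) : Term Ψ 0 → Term Ψ 0 → Rel Ψ → Setω₁ where
    eqᵀ : ∀ {A A′ M M′ N N′ φ} (α : ΨRel Ψ) →
          PTy τ Ψ A A′ α → Coh α →
          Tm α M M′ → Tm α N N′ →
          φ ≃ Eqᴿ α M N →
          Eq τ Ψ (Eqᵗ A M N) (Eqᵗ A′ M′ N′) φ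

  data VTy (τ : Cand) (Ψ : ℕ) : Term Ψ 0 → Term Ψ 0 → Rel Ψ → Setω₁ where
    vᵀ : ∀ {x A A′ B B′ E E′ φ} (β : ΨRel Ψ) (α η : VFam Ψ) →
         PTy τ Ψ B B′ β → Coh β →
         (∀ {Ψ′} (ψ : Ψ′ ⇒ Ψ) → lookup ψ x ≡ 𝟎 → PTy τ Ψ′ (A ⟪ ψ ⟫) (A′ ⟪ ψ ⟫) (α ψ)) →
         (∀ {Ψ′} (ψ : Ψ′ ⇒ Ψ) → lookup ψ x ≡ 𝟎 → Coh (α ψ)) →
         (∀ {Ψ′} (ψ : Ψ′ ⇒ Ψ) → lookup ψ x ≡ 𝟎 →
            PTy τ Ψ′ (Equiv (A ⟪ ψ ⟫) (B ⟪ ψ ⟫)) (Equiv (A ⟪ ψ ⟫) (B ⟪ ψ ⟫)) (η ψ)) →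
         (∀ {Ψ′} (ψ : Ψ′ ⇒ Ψ) → lookup ψ x ≡ 𝟎 → Tm (η ψ) (E ⟪ ψ ⟫) (E′ ⟪ ψ ⟫)) →
         φ ≃ Vᴿ x α β E →
         VTy τ Ψ (V (name x) A B E) (V (name x) A′ B′ E′) φ

  data Fcom (τ : Cand) (Ψ : ℕ) : Term Ψ 0 → Term Ψ 0 → Rel Ψ → Setω₁ where
    fcomᵀ : ∀ {k r r′ A A′} {ξ : Vec (Eqn Ψ) k} {B B′ φ} (α : ΨRel Ψ) (β : FcomFam Ψ k) →
            Valid r r′ ξ →
            PTy τ Ψ A A′ α → Coh α →
            (∀ {Ψ′} i j (ψ : Ψ′ ⇒ suc Ψ) → Holds (wkᵉ (lookup ξ i) ⟪ ψ ⟫ᵉ) → Holds (wkᵉ (lookup ξ j) ⟪ ψ ⟫ᵉ) →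
               PTy τ Ψ′ (lookup B i ⟪ ψ ⟫) (lookup B′ j ⟪ ψ ⟫) (β ψ i j)) →
            (∀ {Ψ′} i j (ψ : Ψ′ ⇒ suc Ψ) → Holds (wkᵉ (lookup ξ i) ⟪ ψ ⟫ᵉ) → Holds (wkᵉ (lookup ξ j) ⟪ ψ ⟫ᵉ) →
               Coh (β ψ i j)) →
            (∀ {Ψ′} i (ψ : Ψ′ ⇒ Ψ) → Holds (lookup ξ i ⟪ ψ ⟫ᵉ) →
               SomePTy τ Ψ′ (lookup B i ⟨ r ⟩ ⟪ ψ ⟫) (A ⟪ ψ ⟫)) →
            φ ≃ Fcomᴿ r r′ ξ B α β →
            Fcom τ Ψ (fcom r r′ A ξ B) (fcom r r′ A′ ξ B′) φ

  data Void (Ψ : ℕ) : Term Ψ 0 → Term Ψ 0 → Rel Ψ → Setω₁ where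
    voidᵀ : ∀ {φ} → φ ≃ (λ M N → Liftω ⊥) → Void Ψ voidᵗ voidᵗ φ

  data Nat (Ψ : ℕ) : Term Ψ 0 → Term Ψ 0 → Rel Ψ → Setω₁ where
    natᵀ : ∀ {φ} → φ ≃ (λ M N → Liftω (ℕᴿ Ψ M N)) → Nat Ψ natᵗ natᵗ φ

  data BoolTy (Ψ : ℕ) : Term Ψ 0 → Term Ψ 0 → Rel Ψ → Setω₁ where
    boolᵀ : ∀ {φ} → φ ≃ (λ M N → Liftω (Boolᴿ Ψ M N)) → BoolTy Ψ boolᵗ boolᵗ φ

  data WB (Ψ : ℕ) : Term Ψ 0 → Term Ψ 0 → Rel Ψ → Setω₁ where
    wboolᵀ : ∀ {φ} → φ ≃ (λ M N → Liftω (𝔹ᴿ Ψ M N)) → WB Ψ wboolᵗ wboolᵗ φ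

  data Circ (Ψ : ℕ) : Term Ψ 0 → Term Ψ 0 → Rel Ψ → Setω₁ where
    S¹ᵀ : ∀ {φ} → φ ≃ (λ M N → Liftω (ℂᴿ Ψ M N)) → Circ Ψ S¹ᵗ S¹ᵗ φ

  data UPre (ν : Cand) (Ψ : ℕ) : Term Ψ 0 → Term Ψ 0 → Rel Ψ → Setω₁ where
    upreᵀ : ∀ {j φ} → ν Ψ (U pre j) (U pre j) φ → UPre ν Ψ (U pre j) (U pre j) φ

  data UKan (ν : Cand) (Ψ : ℕ) : Term Ψ 0 → Term Ψ 0 → Rel Ψ → Setω₁ where
    ukanᵀ : ∀ {j φ} → ν Ψ (U Kan j) (U Kan j) φ → UKan ν Ψ (U Kan j) (U Kan j) φ

  data P (ν σ τ : Cand) (Ψ : ℕ) (A B : Term Ψ 0) (φ : Rel Ψ) : Setω₁ where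
    inFun  : Fun τ Ψ A B φ → P ν σ τ Ψ A B φ
    inPair : Pair τ Ψ A B φ → P ν σ τ Ψ A B φ
    inPath : Path τ Ψ A B φ → P ν σ τ Ψ A B φ
    inEq   : Eq τ Ψ A B φ → P ν σ τ Ψ A B φ
    inV    : VTy τ Ψ A B φ → P ν σ τ Ψ A B φ
    inFcom : Fcom σ Ψ A B φ → P ν σ τ Ψ A B φ
    inVoid : Void Ψ A B φ → P ν σ τ Ψ A B φ
    inNat  : Nat Ψ A B φ → P ν σ τ Ψ A B φ
    inBool : BoolTy Ψ A B φ → P ν σ τ Ψ A B φ
    inWB   : WB Ψ A B φ → P ν σ τ Ψ A B φ
    inCirc : Circ Ψ A B φ → P ν σ τ Ψ A B φ
    inUPre : UPre ν Ψ A B φ → P ν σ τ Ψ A B φ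
    inUKan : UKan ν Ψ A B φ → P ν σ τ Ψ A B φ

  data K (ν σ : Cand) (Ψ : ℕ) (A B : Term Ψ 0) (φ : Rel Ψ) : Setω₁ where
    inFun  : Fun σ Ψ A B φ → K ν σ Ψ A B φ
    inPair : Pair σ Ψ A B φ → K ν σ Ψ A B φ
    inPath : Path σ Ψ A B φ → K ν σ Ψ A B φ
    inV    : VTy σ Ψ A B φ → K ν σ Ψ A B φ
    inFcom : Fcom σ Ψ A B φ → K ν σ Ψ A B φ
    inVoid : Void Ψ A B φ → K ν σ Ψ A B φ
    inNat  : Nat Ψ A B φ → K ν σ Ψ A B φ
    inBool : BoolTy Ψ A B φ → K ν σ Ψ A B φ
    inWB   : WB Ψ A B φ → K ν σ Ψ A B φ
    inCirc : Circ Ψ A B φ → K ν σ Ψ A B φ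
    inUKan : UKan ν Ψ A B φ → K ν σ Ψ A B φ

  -- μσ.K(ν,σ) and μτ.P(ν,σ,τ)
  data μKan (ν : Cand) (Ψ : ℕ) (A B : Term Ψ 0) (φ : Rel Ψ) : Setω₁ where
    roll : K ν (μKan ν) Ψ A B φ → μKan ν Ψ A B φ

  data μpre (ν σ : Cand) (Ψ : ℕ) (A B : Term Ψ 0) (φ : Rel Ψ) : Setω₁ where
    roll : P ν σ (μpre ν σ) Ψ A B φ → μpre ν σ Ψ A B φ

  system : Kind → Cand → Cand
  system pre ν = μpre ν (μKan ν)
  system Kan ν = μKan ν

  data νω (Ψ : ℕ) : Term Ψ 0 → Term Ψ 0 → Rel Ψ → Setω₁ where
    universe : ∀ {φ} j κ → φ ≃ (λ A B → Liftω (∃ λ φ′ → τᶠ κ j Ψ A B φ′)) →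
               νω Ψ (U κ j) (U κ j) φ

  τω : Kind → Cand
  τω κ = system κ νω

------------------------------------------------------------------------
-- Judgments, relative to a type system τ

  -- A ≐ B type_pre [Ψ]
  record Type (τ : Cand) (Ψ : ℕ) (A B : Term Ψ 0) : Setω₁ where
    constructor mkType
    field
      ⟦A⟧ : ΨRel Ψ
      pty : PTy τ Ψ A B ⟦A⟧
      coh : Coh ⟦A⟧

  -- M ≐ N ∈ A [Ψ], including its presupposition A ≐ A type_pre [Ψ], whose
  -- relation is ⟦A⟧.
  record Elem (τ : Cand) (Ψ : ℕ) (M N A : Term Ψ 0) : Setω₁ where
    constructor mkElem
    field
      isType  : Type τ Ψ A A
      related : Tm (Type.⟦A⟧ isType) M N

{-# OPTIONS --safe #-}

-- Since 𝒰 κ i and 𝒰 κ j are the equalities of types of stages i ≤ j, the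
-- elements carry over because the stages are increasing (raise).  The difficulty
-- is to see that U κ j is a type at all, that is, that equality of types at
-- stage j is coherent.
--
-- Coherence needs type equality to be a partial equivalence relation.  For
-- fcom and V this looks circular, as the relation of an fcom type mentions
-- coe, of which nothing is known.  But the relation of a type refers to its
-- left-hand representative only.  So it is determined by that representative
-- (functionality), it is transitive, and it is symmetric for elements that are
-- self-related on the right; and both TmAt and PTyAt contain enough
-- self-relatedness to turn this conditional symmetry into symmetry.  Hence no
-- Kan operation has to be shown well behaved.

module Submission where

open import Defs
open import Data.Nat using (ℕ; _≤_)
import Data.Bool.Properties as Bool
open import Data.Bool.Base using (true; false)
open import Data.Empty using (⊥; ⊥-elim)
open import Data.Fin.Base using (Fin; zero; suc)
import Data.Fin.Properties as Fin
open import Data.List.Relation.Unary.All using (All; []; _∷_)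
open import Data.Maybe.Base using (Maybe; just; nothing)
open import Data.Maybe.Properties using (just-injective)
open import Data.Nat.Base using (zero; suc; s≤s; _+_; _≤′_; _<′_; ≤′-reflexive; ≤′-step)
open import Data.Nat.Properties using (≤⇒≤′; ≤′⇒≤; 1+n≰n)
open import Data.Product.Base using (_×_; _,_; ∃; proj₁; proj₂)
open import Data.Sum.Base using (_⊎_; inj₁; inj₂)
open import Data.Vec.Base using (Vec; []; _∷_; map; lookup; tabulate; allFin)
open import Data.Vec.Properties using (lookup-map; lookup∘tabulate; lookup-allFin; map-∘; map-cong; map-id; tabulate-∘)
open import Function.Base using (id)
open import Level using (Level; Lift; _⊔_; lower) renaming (zero to lzero; suc to lsuc; lift to liftᴸ)
open import Relation.Binary.Construct.Closure.ReflexiveTransitive using (_◅_) renaming (ε to stop)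
open import Relation.Binary.Definitions using (tri<; tri≈; tri>)
open import Relation.Binary.PropositionalEquality hiding ([_])
open import Relation.Nullary using (Dec; yes; no)
open import Relation.Nullary.Decidable using (map′)

-- Dimension substitutions

-- The operators are parametric in their candidate, and `Good (τ κ)` is itself a candidate. Hence
-- `Fun (Goodτ κ)` is a `Fun` derivation each of whose premises carries the induction hypothesis:
-- every closure step is a lemma about a single operator, and the recursion proper only decorates
-- derivations. `Linked` plays the same role for element relations.
--
-- Two premises speak of the left-hand type only: a V type asks that `Equiv A B` be a type, an fcom
-- type that `B i ⟨ r ⟩` equal the base `A`. In the induction, symmetry takes them from the
-- self-relatedness of the right-hand type; that every right-hand type is self-related is shown
-- afterwards. For V this rests on exchanging equal types inside `Equiv` without changing its
-- relation, which is proved by recursion on the shape of `Equiv`.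
--
-- Coherence then needs a case analysis only for V and fcom, since no other type value can reduce
-- after a dimension substitution.

⟪⟫ᵈ-⨾ : ∀ {Ψ Ψ₁ Ψ₂} (r : Dim Ψ) (ψ₁ : Ψ₁ ⇒ Ψ) (ψ₂ : Ψ₂ ⇒ Ψ₁) → r ⟪ ψ₁ ⟫ᵈ ⟪ ψ₂ ⟫ᵈ ≡ r ⟪ ψ₁ ⨾ ψ₂ ⟫ᵈ
⟪⟫ᵈ-⨾ (const ε) ψ₁ ψ₂ = refl
⟪⟫ᵈ-⨾ (name x)  ψ₁ ψ₂ = sym (lookup-map x (_⟪ ψ₂ ⟫ᵈ) ψ₁)

⟪⟫ᵈ-id : ∀ {Ψ} (r : Dim Ψ) → r ⟪ idₛ ⟫ᵈ ≡ r
⟪⟫ᵈ-id (const ε) = refl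
⟪⟫ᵈ-id (name x)  = lookup∘tabulate name x

⟪⟫ᵈ-wk : ∀ {Ψ Ψ′} (r : Dim Ψ) (s : Dim Ψ′) (ψ : Ψ′ ⇒ Ψ) → wkᵈ r ⟪ s ∷ ψ ⟫ᵈ ≡ r ⟪ ψ ⟫ᵈ
⟪⟫ᵈ-wk (const ε) s ψ = refl
⟪⟫ᵈ-wk (name x)  s ψ = cong (_⟪ s ∷ ψ ⟫ᵈ) (lookup∘tabulate (λ y → name (suc y)) x)

⨾-assoc : ∀ {Ψ Ψ₁ Ψ₂ Ψ₃} (ψ₁ : Ψ₁ ⇒ Ψ) (ψ₂ : Ψ₂ ⇒ Ψ₁) (ψ₃ : Ψ₃ ⇒ Ψ₂) →
          (ψ₁ ⨾ ψ₂) ⨾ ψ₃ ≡ ψ₁ ⨾ (ψ₂ ⨾ ψ₃)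
⨾-assoc ψ₁ ψ₂ ψ₃ =
  trans (sym (map-∘ (_⟪ ψ₃ ⟫ᵈ) (_⟪ ψ₂ ⟫ᵈ) ψ₁)) (map-cong (λ r → ⟪⟫ᵈ-⨾ r ψ₂ ψ₃) ψ₁)

⨾-idʳ : ∀ {Ψ Ψ₁} (ψ : Ψ₁ ⇒ Ψ) → ψ ⨾ idₛ ≡ ψ
⨾-idʳ ψ = trans (map-cong ⟪⟫ᵈ-id ψ) (map-id ψ)

tabulate-⨾ : ∀ {Ψ Ψ₁ Ψ₂} (f : Fin Ψ → Dim Ψ₁) (ψ : Ψ₂ ⇒ Ψ₁) → tabulate f ⨾ ψ ≡ tabulate (λ x → f x ⟪ ψ ⟫ᵈ)
tabulate-⨾ f ψ = sym (tabulate-∘ (_⟪ ψ ⟫ᵈ) f)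

tabulate-lookup : ∀ {Ψ Ψ′} (ψ : Ψ′ ⇒ Ψ) → tabulate (lookup ψ) ≡ ψ
tabulate-lookup []      = refl
tabulate-lookup (r ∷ ψ) = cong (r ∷_) (tabulate-lookup ψ)

⨾-idˡ : ∀ {Ψ Ψ₁} (ψ : Ψ₁ ⇒ Ψ) → idₛ ⨾ ψ ≡ ψ
⨾-idˡ ψ = trans (tabulate-⨾ name ψ) (tabulate-lookup ψ)

wkₛ-∷ : ∀ {Ψ Ψ′} (s : Dim Ψ′) (ψ : Ψ′ ⇒ Ψ) → wkₛ ⨾ (s ∷ ψ) ≡ ψ
wkₛ-∷ s ψ = trans (tabulate-⨾ (λ x → name (suc x)) (s ∷ ψ)) (tabulate-lookup ψ)

lift-⨾-∷ : ∀ {Ψ Ψ₁ Ψ₂} (ψ₁ : Ψ₁ ⇒ Ψ) (s : Dim Ψ₂) (ψ₂ : Ψ₂ ⇒ Ψ₁) → lift ψ₁ ⨾ (s ∷ ψ₂) ≡ s ∷ ψ₁ ⨾ ψ₂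
lift-⨾-∷ ψ₁ s ψ₂ = cong (s ∷_) (trans (⨾-assoc ψ₁ wkₛ (s ∷ ψ₂)) (cong (ψ₁ ⨾_) (wkₛ-∷ s ψ₂)))

lift-⨾ : ∀ {Ψ Ψ₁ Ψ₂} (ψ₁ : Ψ₁ ⇒ Ψ) (ψ₂ : Ψ₂ ⇒ Ψ₁) → lift ψ₁ ⨾ lift ψ₂ ≡ lift (ψ₁ ⨾ ψ₂)
lift-⨾ ψ₁ ψ₂ = trans (lift-⨾-∷ ψ₁ (name zero) (map wkᵈ ψ₂))
  (cong (name zero ∷_) (sym (⨾-assoc ψ₁ ψ₂ wkₛ)))

lift-id : ∀ {Ψ} → lift (idₛ {Ψ}) ≡ idₛ
lift-id = cong (name zero ∷_) (⨾-idˡ wkₛ)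

lifts-⨾ : ∀ d {Ψ Ψ₁ Ψ₂} (ψ₁ : Ψ₁ ⇒ Ψ) (ψ₂ : Ψ₂ ⇒ Ψ₁) → lifts d ψ₁ ⨾ lifts d ψ₂ ≡ lifts d (ψ₁ ⨾ ψ₂)
lifts-⨾ zero    ψ₁ ψ₂ = refl
lifts-⨾ (suc d) ψ₁ ψ₂ = trans (lift-⨾ (lifts d ψ₁) (lifts d ψ₂)) (cong lift (lifts-⨾ d ψ₁ ψ₂))

lifts-id : ∀ d {Ψ} → lifts d (idₛ {Ψ}) ≡ idₛ
lifts-id zero    = refl
lifts-id (suc d) = trans (cong lift (lifts-id d)) lift-id

-- The action on terms

infixl 9 _⨾ᵛ_
_⨾ᵛ_ : ∀ {m m₁ m₂} → Vec (Fin m₁) m → Vec (Fin m₂) m₁ → Vec (Fin m₂) m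
ρ₁ ⨾ᵛ ρ₂ = map (lookup ρ₂) ρ₁

liftsᵛ-⨾ : ∀ t {m m₁ m₂} (ρ₁ : Vec (Fin m₁) m) (ρ₂ : Vec (Fin m₂) m₁) →
           liftsᵛ t ρ₁ ⨾ᵛ liftsᵛ t ρ₂ ≡ liftsᵛ t (ρ₁ ⨾ᵛ ρ₂)
liftsᵛ-⨾ zero    ρ₁ ρ₂ = refl
liftsᵛ-⨾ (suc t) ρ₁ ρ₂ = cong (zero ∷_) (begin
  map (lookup (zero ∷ map suc σ₂)) (map suc σ₁) ≡⟨ map-∘ _ suc σ₁ ⟨
  map (λ a → lookup (map suc σ₂) a) σ₁          ≡⟨ map-cong (λ a → lookup-map a suc σ₂) σ₁ ⟩
  map (λ a → suc (lookup σ₂ a)) σ₁              ≡⟨ map-∘ suc (lookup σ₂) σ₁ ⟩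
  map suc (σ₁ ⨾ᵛ σ₂)                            ≡⟨ cong (map suc) (liftsᵛ-⨾ t ρ₁ ρ₂) ⟩
  map suc (liftsᵛ t (ρ₁ ⨾ᵛ ρ₂))                 ∎)
  where
  open ≡-Reasoning
  σ₁ = liftsᵛ t ρ₁
  σ₂ = liftsᵛ t ρ₂

liftsᵛ-id : ∀ t {m} → liftsᵛ t (allFin m) ≡ allFin (t + m)
liftsᵛ-id zero    = refl
liftsᵛ-id (suc t) = cong (zero ∷_) (trans (cong (map suc) (liftsᵛ-id t)) (sym (tabulate-∘ suc id)))

act-act : ∀ {Ψ Ψ₁ Ψ₂} (ψ₁ : Ψ₁ ⇒ Ψ) (ψ₂ : Ψ₂ ⇒ Ψ₁) {m m₁ m₂} (ρ₁ : Vec (Fin m₁) m) (ρ₂ : Vec (Fin m₂) m₁) M →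
  act ψ₂ ρ₂ (act ψ₁ ρ₁ M) ≡ act (ψ₁ ⨾ ψ₂) (ρ₁ ⨾ᵛ ρ₂) M
act-actArgs : ∀ {Ψ Ψ₁ Ψ₂} (ψ₁ : Ψ₁ ⇒ Ψ) (ψ₂ : Ψ₂ ⇒ Ψ₁) {m m₁ m₂}
  (ρ₁ : Vec (Fin m₁) m) (ρ₂ : Vec (Fin m₂) m₁) {ss} (as : All (Arg Ψ m) ss) →
  actArgs ψ₂ ρ₂ (actArgs ψ₁ ρ₁ as) ≡ actArgs (ψ₁ ⨾ ψ₂) (ρ₁ ⨾ᵛ ρ₂) as
act-actArg : ∀ {Ψ Ψ₁ Ψ₂} (ψ₁ : Ψ₁ ⇒ Ψ) (ψ₂ : Ψ₂ ⇒ Ψ₁) {m m₁ m₂}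
  (ρ₁ : Vec (Fin m₁) m) (ρ₂ : Vec (Fin m₂) m₁) {s} (a : Arg Ψ m s) →
  actArg ψ₂ ρ₂ (actArg ψ₁ ρ₁ a) ≡ actArg (ψ₁ ⨾ ψ₂) (ρ₁ ⨾ᵛ ρ₂) a
act-actVec : ∀ {Ψ Ψ₁ Ψ₂} (ψ₁ : Ψ₁ ⇒ Ψ) (ψ₂ : Ψ₂ ⇒ Ψ₁) {m m₁ m₂}
  (ρ₁ : Vec (Fin m₁) m) (ρ₂ : Vec (Fin m₂) m₁) {k} (N : Vec (Term Ψ m) k) →
  actVec ψ₂ ρ₂ (actVec ψ₁ ρ₁ N) ≡ actVec (ψ₁ ⨾ ψ₂) (ρ₁ ⨾ᵛ ρ₂) N

act-act ψ₁ ψ₂ ρ₁ ρ₂ (var a)   = cong var (sym (lookup-map a (lookup ρ₂) ρ₁))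
act-act ψ₁ ψ₂ ρ₁ ρ₂ (op o as) = cong (op o) (act-actArgs ψ₁ ψ₂ ρ₁ ρ₂ as)

act-actArgs ψ₁ ψ₂ ρ₁ ρ₂ []       = refl
act-actArgs ψ₁ ψ₂ ρ₁ ρ₂ (a ∷ as) = cong₂ _∷_ (act-actArg ψ₁ ψ₂ ρ₁ ρ₂ a) (act-actArgs ψ₁ ψ₂ ρ₁ ρ₂ as)

act-actArg ψ₁ ψ₂ ρ₁ ρ₂ (dim r)        = cong dim (⟪⟫ᵈ-⨾ r ψ₁ ψ₂)
act-actArg ψ₁ ψ₂ ρ₁ ρ₂ (tm {d} {t} M) = cong tm (trans
  (act-act (lifts d ψ₁) (lifts d ψ₂) (liftsᵛ t ρ₁) (liftsᵛ t ρ₂) M)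
  (cong₂ (λ ψ ρ → act ψ ρ M) (lifts-⨾ d ψ₁ ψ₂) (liftsᵛ-⨾ t ρ₁ ρ₂)))
act-actArg ψ₁ ψ₂ ρ₁ ρ₂ (eqns ξ)       = cong eqns (trans
  (sym (map-∘ (_⟪ ψ₂ ⟫ᵉ) (_⟪ ψ₁ ⟫ᵉ) ξ))
  (map-cong (λ (r , r′) → cong₂ _,_ (⟪⟫ᵈ-⨾ r ψ₁ ψ₂) (⟪⟫ᵈ-⨾ r′ ψ₁ ψ₂)) ξ))
act-actArg ψ₁ ψ₂ ρ₁ ρ₂ (tms {d} N)    = cong tms (trans
  (act-actVec (lifts d ψ₁) (lifts d ψ₂) ρ₁ ρ₂ N)
  (cong (λ ψ → actVec ψ (ρ₁ ⨾ᵛ ρ₂) N) (lifts-⨾ d ψ₁ ψ₂)))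

act-actVec ψ₁ ψ₂ ρ₁ ρ₂ []      = refl
act-actVec ψ₁ ψ₂ ρ₁ ρ₂ (M ∷ N) = cong₂ _∷_ (act-act ψ₁ ψ₂ ρ₁ ρ₂ M) (act-actVec ψ₁ ψ₂ ρ₁ ρ₂ N)

act-id     : ∀ {Ψ m} (M : Term Ψ m) → act idₛ (allFin m) M ≡ M
actArgs-id : ∀ {Ψ m ss} (as : All (Arg Ψ m) ss) → actArgs idₛ (allFin m) as ≡ as
actArg-id  : ∀ {Ψ m s} (a : Arg Ψ m s) → actArg idₛ (allFin m) a ≡ a
actVec-id  : ∀ {Ψ m k} (N : Vec (Term Ψ m) k) → actVec idₛ (allFin m) N ≡ N

act-id (var a)   = cong var (lookup-allFin a)
act-id (op o as) = cong (op o) (actArgs-id as)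

actArgs-id []       = refl
actArgs-id (a ∷ as) = cong₂ _∷_ (actArg-id a) (actArgs-id as)

actArg-id (dim r)        = cong dim (⟪⟫ᵈ-id r)
actArg-id (tm {d} {t} M) = cong tm (trans
  (cong₂ (λ ψ ρ → act ψ ρ M) (lifts-id d) (liftsᵛ-id t)) (act-id M))
actArg-id (eqns ξ)       = cong eqns (trans
  (map-cong (λ (r , r′) → cong₂ _,_ (⟪⟫ᵈ-id r) (⟪⟫ᵈ-id r′)) ξ) (map-id ξ))
actArg-id (tms {d} N)    = cong tms (trans
  (cong (λ ψ → actVec ψ (allFin _) N) (lifts-id d)) (actVec-id N))

actVec-id []      = refl
actVec-id (M ∷ N) = cong₂ _∷_ (act-id M) (actVec-id N)

⟪⟫-⨾ : ∀ {Ψ Ψ₁ Ψ₂} (M : Term Ψ 0) (ψ₁ : Ψ₁ ⇒ Ψ) (ψ₂ : Ψ₂ ⇒ Ψ₁) → M ⟪ ψ₁ ⟫ ⟪ ψ₂ ⟫ ≡ M ⟪ ψ₁ ⨾ ψ₂ ⟫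
⟪⟫-⨾ M ψ₁ ψ₂ = act-act ψ₁ ψ₂ [] [] M

⟪⟫-⨾₁ : ∀ {Ψ Ψ₁ Ψ₂} (M : Term Ψ 1) (ψ₁ : Ψ₁ ⇒ Ψ) (ψ₂ : Ψ₂ ⇒ Ψ₁) → M ⟪ ψ₁ ⟫ ⟪ ψ₂ ⟫ ≡ M ⟪ ψ₁ ⨾ ψ₂ ⟫
⟪⟫-⨾₁ M ψ₁ ψ₂ = act-act ψ₁ ψ₂ (zero ∷ []) (zero ∷ []) M

lookup-actVec : ∀ {Ψ Ψ′ m m′ k} (ψ : Ψ′ ⇒ Ψ) (ρ : Vec (Fin m′) m) (N : Vec (Term Ψ m) k) i →
                lookup (actVec ψ ρ N) i ≡ act ψ ρ (lookup N i)
lookup-actVec ψ ρ (M ∷ N) zero    = refl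
lookup-actVec ψ ρ (M ∷ N) (suc i) = lookup-actVec ψ ρ N i

lookup-liftθ : ∀ d t {Ψ m m₁ m₂} (θ : Vec (Term Ψ m₂) m₁) (ρ : Vec (Fin m₁) m) (ρ′ : Vec (Fin m₂) m) →
               (∀ a → lookup θ (lookup ρ a) ≡ var (lookup ρ′ a)) →
               ∀ a → lookup (liftθ d t θ) (lookup (liftsᵛ t ρ) a) ≡ var (lookup (liftsᵛ t ρ′) a)
lookup-liftθ zero zero θ ρ ρ′ h a = h a
lookup-liftθ (suc d) zero θ ρ ρ′ h a = begin
  lookup (map wk (liftθ d zero θ)) (lookup ρ a) ≡⟨ lookup-map (lookup ρ a) wk (liftθ d zero θ) ⟩
  wk (lookup (liftθ d zero θ) (lookup ρ a))     ≡⟨ cong wk (lookup-liftθ d zero θ ρ ρ′ h a) ⟩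
  var (lookup (allFin _) (lookup ρ′ a))         ≡⟨ cong var (lookup-allFin _) ⟩
  var (lookup ρ′ a)                             ∎
  where open ≡-Reasoning
lookup-liftθ d (suc t) θ ρ ρ′ h a = trans (cong (λ θ′ → lookup θ′ _) (liftθ-suc d t θ)) (extended a)
  where
  open ≡-Reasoning
  -- `liftθ` splits on `d` first, so this clause is definitional only once `d` is a constructor.
  liftθ-suc : ∀ d t {Ψ m m′} (θ : Vec (Term Ψ m′) m) → liftθ d (suc t) θ ≡ var zero ∷ map wkᵛ (liftθ d t θ)
  liftθ-suc zero    t θ = refl
  liftθ-suc (suc d) t θ = refl

  extended : ∀ a → lookup (var zero ∷ map wkᵛ (liftθ d t θ)) (lookup (liftsᵛ (suc t) ρ) a) ≡
                   var (lookup (liftsᵛ (suc t) ρ′) a)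
  extended zero    = refl
  extended (suc a) = begin
    lookup (var zero ∷ map wkᵛ (liftθ d t θ)) (lookup (map suc (liftsᵛ t ρ)) a)
      ≡⟨ cong (lookup (var zero ∷ map wkᵛ (liftθ d t θ))) (lookup-map a suc (liftsᵛ t ρ)) ⟩
    lookup (map wkᵛ (liftθ d t θ)) (lookup (liftsᵛ t ρ) a)
      ≡⟨ lookup-map _ wkᵛ (liftθ d t θ) ⟩
    wkᵛ (lookup (liftθ d t θ) (lookup (liftsᵛ t ρ) a))
      ≡⟨ cong wkᵛ (lookup-liftθ d t θ ρ ρ′ h a) ⟩
    var (lookup (tabulate suc) (lookup (liftsᵛ t ρ′) a))
      ≡⟨ cong var (lookup∘tabulate suc _) ⟩
    var (suc (lookup (liftsᵛ t ρ′) a))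
      ≡⟨ cong var (lookup-map a suc (liftsᵛ t ρ′)) ⟨
    var (lookup (map suc (liftsᵛ t ρ′)) a) ∎

-- Substitutions that are renamings on the image of `ρ` are preserved under binders. The case of
-- interest is `ρ` empty: substitution leaves a closed term alone.
sub-act : ∀ {Ψ Ψ₁ m m₁ m₂} (ψ : Ψ₁ ⇒ Ψ) (θ : Vec (Term Ψ₁ m₂) m₁) (ρ : Vec (Fin m₁) m) (ρ′ : Vec (Fin m₂) m) →
          (∀ a → lookup θ (lookup ρ a) ≡ var (lookup ρ′ a)) →
          ∀ M → sub θ (act ψ ρ M) ≡ act ψ ρ′ M
sub-actArgs : ∀ {Ψ Ψ₁ m m₁ m₂} (ψ : Ψ₁ ⇒ Ψ) (θ : Vec (Term Ψ₁ m₂) m₁) (ρ : Vec (Fin m₁) m) (ρ′ : Vec (Fin m₂) m) →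
              (∀ a → lookup θ (lookup ρ a) ≡ var (lookup ρ′ a)) →
              ∀ {ss} (as : All (Arg Ψ m) ss) → subArgs θ (actArgs ψ ρ as) ≡ actArgs ψ ρ′ as
sub-actArg : ∀ {Ψ Ψ₁ m m₁ m₂} (ψ : Ψ₁ ⇒ Ψ) (θ : Vec (Term Ψ₁ m₂) m₁) (ρ : Vec (Fin m₁) m) (ρ′ : Vec (Fin m₂) m) →
             (∀ a → lookup θ (lookup ρ a) ≡ var (lookup ρ′ a)) →
             ∀ {s} (a : Arg Ψ m s) → subArg θ (actArg ψ ρ a) ≡ actArg ψ ρ′ a
sub-actVec : ∀ {Ψ Ψ₁ m m₁ m₂} (ψ : Ψ₁ ⇒ Ψ) (θ : Vec (Term Ψ₁ m₂) m₁) (ρ : Vec (Fin m₁) m) (ρ′ : Vec (Fin m₂) m) →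
             (∀ a → lookup θ (lookup ρ a) ≡ var (lookup ρ′ a)) →
             ∀ {k} (N : Vec (Term Ψ m) k) → subVec θ (actVec ψ ρ N) ≡ actVec ψ ρ′ N

sub-act ψ θ ρ ρ′ h (var a)   = h a
sub-act ψ θ ρ ρ′ h (op o as) = cong (op o) (sub-actArgs ψ θ ρ ρ′ h as)

sub-actArgs ψ θ ρ ρ′ h []       = refl
sub-actArgs ψ θ ρ ρ′ h (a ∷ as) = cong₂ _∷_ (sub-actArg ψ θ ρ ρ′ h a) (sub-actArgs ψ θ ρ ρ′ h as)

sub-actArg ψ θ ρ ρ′ h (dim r)        = refl
sub-actArg ψ θ ρ ρ′ h (tm {d} {t} M) =
  cong tm (sub-act (lifts d ψ) (liftθ d t θ) (liftsᵛ t ρ) (liftsᵛ t ρ′) (lookup-liftθ d t θ ρ ρ′ h) M)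
sub-actArg ψ θ ρ ρ′ h (eqns ξ)       = refl
sub-actArg ψ θ ρ ρ′ h (tms {d} N)    =
  cong tms (sub-actVec (lifts d ψ) (liftθ d 0 θ) ρ ρ′ (lookup-liftθ d 0 θ ρ ρ′ h) N)

sub-actVec ψ θ ρ ρ′ h []      = refl
sub-actVec ψ θ ρ ρ′ h (M ∷ N) = cong₂ _∷_ (sub-act ψ θ ρ ρ′ h M) (sub-actVec ψ θ ρ ρ′ h N)

-- Determinism of evaluation

infix 4 _≟ᵈ_
_≟ᵈ_ : ∀ {Ψ} (r s : Dim Ψ) → Dec (r ≡ s)
const ε ≟ᵈ const ε′ = map′ (cong const) (λ { refl → refl }) (ε Bool.≟ ε′)
const ε ≟ᵈ name y   = no λ ()
name x  ≟ᵈ const ε  = no λ ()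
name x  ≟ᵈ name y   = map′ (cong name) (λ { refl → refl }) (x Fin.≟ y)

least? : ∀ {Ψ k} (ξ : Vec (Eqn Ψ) k) → (∃ λ j → Least ξ j) ⊎ AllApart ξ
least? [] = inj₂ λ ()
least? ((r , r′) ∷ ξ) with r ≟ᵈ r′
... | yes h = inj₁ (zero , h , λ _ ())
... | no ¬h with least? ξ
...   | inj₁ (j , h , l) = inj₁ (suc j , h , λ { zero _ → ¬h ; (suc i) (s≤s i<j) → l i i<j })
...   | inj₂ ap          = inj₂ λ { zero → ¬h ; (suc i) → ap i }

least-unique : ∀ {Ψ k} (ξ : Vec (Eqn Ψ) k) {i j} → Least ξ i → Least ξ j → i ≡ j
least-unique ξ {i} {j} (hᵢ , lᵢ) (hⱼ , lⱼ) with Fin.<-cmp i j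
... | tri< i<j _ _ = ⊥-elim (lⱼ i i<j hᵢ)
... | tri≈ _ i≡j _ = i≡j
... | tri> _ _ j<i = ⊥-elim (lᵢ j j<i hⱼ)

-- The three exclusive behaviours common to `fcom`, `box` and `cap`; the dimensions alone decide
-- between them.
data View {Ψ k} (r r′ : Dim Ψ) (ξ : Vec (Eqn Ψ) k) : Set where
  cap-view   : r ≡ r′ → View r r′ ξ
  tube-view  : r ≢ r′ → ∀ j → Least ξ j → View r r′ ξ
  value-view : r ≢ r′ → AllApart ξ → View r r′ ξ

view : ∀ {Ψ k} (r r′ : Dim Ψ) (ξ : Vec (Eqn Ψ) k) → View r r′ ξ
view r r′ ξ with r ≟ᵈ r′ | least? ξ
... | yes h | _            = cap-view h
... | no ¬h | inj₁ (j , l) = tube-view ¬h j l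
... | no ¬h | inj₂ ap      = value-view ¬h ap

-- The result ignores the proofs inside the view, so the equations below hold for every view and
-- never compute `view`.
byView : ∀ {Ψ k} {r r′ : Dim Ψ} {ξ : Vec (Eqn Ψ) k} {X : Set} → View r r′ ξ → X → (Fin k → X) → X → X
byView (cap-view _)      c t v = c
byView (tube-view _ j _) c t v = t j
byView (value-view _ _)  c t v = v

module _ {Ψ k} {r r′ : Dim Ψ} {ξ : Vec (Eqn Ψ) k} {X : Set} {c : X} {t : Fin k → X} {v : X} where

  byView-cap : (w : View r r′ ξ) → r ≡ r′ → byView w c t v ≡ c
  byView-cap (cap-view _)       h = refl
  byView-cap (tube-view ¬h _ _) h = ⊥-elim (¬h h)
  byView-cap (value-view ¬h _)  h = ⊥-elim (¬h h)

  byView-tube : (w : View r r′ ξ) → ∀ j → r ≢ r′ → Least ξ j → byView w c t v ≡ t j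
  byView-tube (cap-view h)       j ¬h l = ⊥-elim (¬h h)
  byView-tube (tube-view _ i l′) j ¬h l = cong t (least-unique ξ l′ l)
  byView-tube (value-view _ ap)  j ¬h l = ⊥-elim (ap j (proj₁ l))

  byView-value : (w : View r r′ ξ) → r ≢ r′ → AllApart ξ → byView w c t v ≡ v
  byView-value (cap-view h)      ¬h ap = ⊥-elim (¬h h)
  byView-value (tube-view _ j l) ¬h ap = ⊥-elim (ap j (proj₁ l))
  byView-value (value-view _ _)  ¬h ap = refl

-- Contracts a redex with principal argument M, unless M itself steps.
principal : ∀ {Ψ Ψ′} → Maybe (Term Ψ 0) → (Term Ψ 0 → Term Ψ′ 0) → Maybe (Term Ψ′ 0) → Maybe (Term Ψ′ 0)
principal (just M′) f N = just (f M′)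
principal nothing   f N = N

principal-value : ∀ {Ψ Ψ′} {m : Maybe (Term Ψ 0)} {f : Term Ψ 0 → Term Ψ′ 0} {N} →
                  m ≡ nothing → principal m f N ≡ N
principal-value refl = refl

hcom-next : ∀ {Ψ k} → Dim Ψ → Dim Ψ → Term Ψ 0 → Term Ψ 0 → Vec (Eqn Ψ) k → Vec (Term (suc Ψ) 0) k → Maybe (Term Ψ 0)
hcom-next r r′ (Πᵗ A B) M ξ N =
  just (lam (hcom r r′ B (app (wkᵛ M) (var zero)) ξ (map (λ Nᵢ → app (wkᵛ Nᵢ) (var zero)) N)))
hcom-next r r′ (Σᵗ A B) M ξ N =
  just (pair (hcom r r′ A (fst M) ξ (map (λ Nᵢ → fst Nᵢ) N))
             (com r r′ (wk B [ fill r A (fst M) ξ (map (λ Nᵢ → fst Nᵢ) N) ]) (snd M) ξ (map (λ Nᵢ → snd Nᵢ) N)))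
hcom-next r r′ (Pathᵗ A P₀ P₁) M ξ N =
  just (plam (hcom (wkᵈ r) (wkᵈ r′) A (wk M at name zero)
                   ((name zero , 𝟎) ∷ (name zero , 𝟏) ∷ map wkᵉ ξ)
                   (wk (wk P₀) ∷ wk (wk P₁) ∷ map (λ Nᵢ → wk₁ Nᵢ at name (suc zero)) N)))
hcom-next r r′ (Eqᵗ A E₀ E₁)       M ξ N = just star
hcom-next r r′ natᵗ                M ξ N = just M
hcom-next r r′ boolᵗ               M ξ N = just M
hcom-next r r′ wboolᵗ              M ξ N = just (fcom r r′ M ξ N)
hcom-next r r′ S¹ᵗ                 M ξ N = just (fcom r r′ M ξ N)
hcom-next r r′ (U Kan j)           M ξ N = just (fcom r r′ M ξ N)
hcom-next r r′ (V (name x) A B E)  M ξ N = just (hcomV-rhs r r′ x A B E M ξ N)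
hcom-next r r′ (fcom s s′ A ζ B)   M ξ N = just (hcomFcom-rhs r r′ s s′ A ζ B M ξ N)
hcom-next r r′ _                   M ξ N = nothing

coe-next : ∀ {Ψ} → Dim Ψ → Dim Ψ → Term (suc Ψ) 0 → Term Ψ 0 → Maybe (Term Ψ 0)
coe-next r r′ (Πᵗ A B) M =
  just (lam (coe r r′ (B [ coe (wkᵈ r′) (name zero) (wk₁ (wkᵛ A)) (var zero) ])
                      (app (wkᵛ M) (coe r′ r (wkᵛ A) (var zero)))))
coe-next r r′ (Σᵗ A B) M =
  just (pair (coe r r′ A (fst M)) (coe r r′ (B [ coe (wkᵈ r) (name zero) (wk₁ A) (wk (fst M)) ]) (snd M)))
coe-next r r′ (Pathᵗ A P₀ P₁) M =
  just (plam (com (wkᵈ r) (wkᵈ r′) (swap A) (wk M at name zero)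
                  ((name zero , 𝟎) ∷ (name zero , 𝟏) ∷ []) (wk₁ P₀ ∷ wk₁ P₁ ∷ [])))
coe-next r r′ natᵗ      M = just M
coe-next r r′ boolᵗ     M = just M
coe-next r r′ wboolᵗ    M = just M
coe-next r r′ S¹ᵗ       M = just M
coe-next r r′ (U κ j)   M = just M
coe-next r r′ (V (name zero) A B E) M    = just (coeV-rhs r)
  where
  coeV-rhs : Dim _ → Term _ 0
  coeV-rhs 𝟎        = Vin r′ M (coe 𝟎 r′ B (app (fst (E ⟨ 𝟎 ⟩)) M))
  coeV-rhs 𝟏        = coeV₁-rhs r′ A B E M
  coeV-rhs (name y) = coeVy-rhs y r′ A B E M
coe-next r r′ (V (name (suc x)) A B E) M = just (coeVx-rhs r r′ x A B E M)
coe-next r r′ (fcom s s′ A ξ B)        M = just (coeFcom-rhs r r′ s s′ A ξ B M)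
coe-next r r′ _                        M = nothing

-- next may be defined on stuck terms (Vproj and cap do not compare labels): only
-- next-step and next-value are needed.
next : ∀ {Ψ} → Term Ψ 0 → Maybe (Term Ψ 0)
next (hcom r r′ A M ξ N) = principal (next A) (λ A′ → hcom r r′ A′ M ξ N) (hcom-next r r′ A M ξ N)
next (coe r r′ A M)      = principal (next A) (λ A′ → coe r r′ A′ M) (coe-next r r′ A M)
next (com r r′ A M ξ N)  =
  just (hcom r r′ (A ⟨ r′ ⟩) (coe r r′ A M) ξ (map (λ Nᵢ → coe (name zero) (wkᵈ r′) (wk₁ A) Nᵢ) N))
next (gcom r r′ A M ξ N) =
  just (ghcom r r′ (A ⟨ r′ ⟩) (coe r r′ A M) ξ (map (λ Nᵢ → coe (name zero) (wkᵈ r′) (wk₁ A) Nᵢ) N))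
next (fcom r r′ M ξ N)   = byView (view r r′ ξ) (just M) (λ j → just (lookup N j ⟨ r′ ⟩)) nothing
next (ghcom r r′ A M [] [])            = just M
next (ghcom r r′ A M (e ∷ ξ) (N ∷ Ns)) = just (ghcom-rhs r r′ A M e N ξ Ns)
next (box r r′ M ξ N)    = byView (view r r′ ξ) (just M) (λ j → just (lookup N j)) nothing
next (cap r r′ M ξ B)    = byView (view r r′ ξ) (just M) (λ j → just (coe r′ r (lookup B j) M))
  (principal (next M) (λ M′ → cap r r′ M′ ξ B) (case M))
  where
  case : Term _ 0 → Maybe (Term _ 0)
  case (box _ _ M _ _) = just M
  case _               = nothing
next (app M N)           = principal (next M) (λ M′ → app M′ N) (case M)
  where
  case : Term _ 0 → Maybe (Term _ 0)
  case (lam M) = just (M [ N ])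
  case _       = nothing
next (fst M)             = principal (next M) (λ M′ → fst M′) (case M)
  where
  case : Term _ 0 → Maybe (Term _ 0)
  case (pair M N) = just M
  case _          = nothing
next (snd M)             = principal (next M) (λ M′ → snd M′) (case M)
  where
  case : Term _ 0 → Maybe (Term _ 0)
  case (pair M N) = just N
  case _          = nothing
next (M at r)            = principal (next M) (λ M′ → M′ at r) (case M)
  where
  case : Term _ 0 → Maybe (Term _ 0)
  case (plam M) = just (M ⟨ r ⟩)
  case _        = nothing
next (natrec M Z S)      = principal (next M) (λ M′ → natrec M′ Z S) (case M)
  where
  case : Term _ 0 → Maybe (Term _ 0)
  case zᵗ     = just Z
  case (sᵗ M) = just (sub (natrec M Z S ∷ M ∷ []) S)
  case _      = nothing
next (ifᵗ A M T F)       = principal (next M) (λ M′ → ifᵗ A M′ T F) (case M)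
  where
  case : Term _ 0 → Maybe (Term _ 0)
  case trueᵗ             = just T
  case falseᵗ            = just F
  case (fcom r r′ M ξ N) = just (com r r′ (wk A [ ffill r M ξ N ]) (ifᵗ A M T F) ξ
                                     (map (λ Nᵢ → ifᵗ (wk A) Nᵢ (wk T) (wk F)) N))
  case _                 = nothing
next (S¹elim A M P L)    = principal (next M) (λ M′ → S¹elim A M′ P L) (case M)
  where
  case : Term _ 0 → Maybe (Term _ 0)
  case base              = just P
  case (loop (name w))   = just (L ⟨ name w ⟩)
  case (fcom r r′ M ξ N) = just (com r r′ (wk A [ ffill r M ξ N ]) (S¹elim A M P L) ξ
                                     (map (λ Nᵢ → S¹elim (wk A) Nᵢ (wk P) (wk₁ L)) N))
  case _                 = nothing
next (loop (const ε))    = just base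
next (V 𝟎 A B E)         = just A
next (V 𝟏 A B E)         = just B
next (Vin 𝟎 M N)         = just M
next (Vin 𝟏 M N)         = just N
next (Vproj 𝟎 M F)       = just (app F M)
next (Vproj 𝟏 M F)       = just M
next (Vproj (name x) M F) = principal (next M) (λ M′ → Vproj (name x) M′ F) (case M)
  where
  case : Term _ 0 → Maybe (Term _ 0)
  case (Vin _ M N) = just N
  case _           = nothing
next _                   = nothing

next-value : ∀ {Ψ} {M : Term Ψ 0} → Val M → next M ≡ nothing
next-value Π-val = refl
next-value Σ-val = refl
next-value Path-val = refl
next-value Eq-val = refl
next-value void-val = refl
next-value nat-val = refl
next-value bool-val = refl
next-value wbool-val = refl
next-value S¹-val = refl
next-value U-val = refl
next-value V-val = refl
next-value lam-val = refl
next-value pair-val = refl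
next-value plam-val = refl
next-value star-val = refl
next-value z-val = refl
next-value s-val = refl
next-value true-val = refl
next-value false-val = refl
next-value base-val = refl
next-value loop-val = refl
next-value Vin-val = refl
next-value (fcom-val {r = r} {r′} {ξ = ξ} ¬h ap) = byView-value (view r r′ ξ) ¬h ap
next-value (box-val {r = r} {r′} {ξ = ξ} ¬h ap) = byView-value (view r r′ ξ) ¬h ap

-- Placing reduction inside the graph of a function takes one case per rule; a direct proof of
-- determinism would take one per pair of rules.
next-step : ∀ {Ψ} {M N : Term Ψ 0} → M ⟼ N → next M ≡ just N
next-step (hcom-cong s) rewrite next-step s = refl
next-step (coe-cong s) rewrite next-step s = refl
next-step (app-cong s) rewrite next-step s = refl
next-step (fst-cong s) rewrite next-step s = refl
next-step (snd-cong s) rewrite next-step s = refl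
next-step (at-cong s) rewrite next-step s = refl
next-step (natrec-cong s) rewrite next-step s = refl
next-step (if-cong s) rewrite next-step s = refl
next-step (S¹elim-cong s) rewrite next-step s = refl
next-step (Vproj-cong s) rewrite next-step s = refl
next-step (cap-cong {r = r} {r′} {ξ = ξ} ¬h ap s) rewrite next-step s = byView-value (view r r′ ξ) ¬h ap
next-step com-β = refl
next-step gcom-β = refl
next-step (fcom-cap {r = r} {r′} {ξ = ξ} h) = byView-cap (view r r′ ξ) h
next-step (fcom-tube {r = r} {r′} {ξ = ξ} j ¬h l) = byView-tube (view r r′ ξ) j ¬h l
next-step ghcom-[] = refl
next-step ghcom-∷ = refl
next-step app-β = refl
next-step hcom-Π = refl
next-step coe-Π = refl
next-step fst-β = refl
next-step snd-β = refl
next-step hcom-Σ = refl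
next-step coe-Σ = refl
next-step at-β = refl
next-step hcom-Path = refl
next-step coe-Path = refl
next-step hcom-Eq = refl
next-step natrec-z = refl
next-step natrec-s = refl
next-step if-true = refl
next-step if-false = refl
next-step hcom-nat = refl
next-step hcom-bool = refl
next-step hcom-wbool = refl
next-step hcom-S¹ = refl
next-step coe-nat = refl
next-step coe-bool = refl
next-step coe-wbool = refl
next-step coe-S¹ = refl
next-step loop-ε = refl
next-step S¹elim-base = refl
next-step S¹elim-loop = refl
-- An `fcom` that gets eliminated is a value, so `next` finds no step in the principal argument and
-- contracts the redex.
next-step (if-fcom {M = M} {N = N} ¬h ap) = principal-value (next-value (fcom-val {M = M} {N = N} ¬h ap))
next-step (S¹elim-fcom {M = M} {N = N} ¬h ap) = principal-value (next-value (fcom-val {M = M} {N = N} ¬h ap))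
next-step V-0 = refl
next-step V-1 = refl
next-step Vin-0 = refl
next-step Vin-1 = refl
next-step Vproj-0 = refl
next-step Vproj-1 = refl
next-step Vproj-Vin = refl
next-step hcom-V = refl
next-step coe-V-0 = refl
next-step coe-V-1 = refl
next-step coe-V-y = refl
next-step coe-V-x = refl
next-step hcom-U = refl
next-step coe-U = refl
next-step (box-cap {r = r} {r′} {ξ = ξ} h) = byView-cap (view r r′ ξ) h
next-step (box-tube {r = r} {r′} {ξ = ξ} j ¬h l) = byView-tube (view r r′ ξ) j ¬h l
next-step (cap-cap {r = r} {r′} {ξ = ξ} h) = byView-cap (view r r′ ξ) h
next-step (cap-tube {r = r} {r′} {ξ = ξ} j ¬h l) = byView-tube (view r r′ ξ) j ¬h l
next-step (cap-box {r = r} {r′} {M} {ξ} {N} ¬h ap) =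
  trans (byView-value (view r r′ ξ) ¬h ap) (principal-value (next-value (box-val {M = M} {N = N} ¬h ap)))
next-step (hcom-fcom {A = A} {B = B} ¬h ap) = principal-value (next-value (fcom-val {M = A} {N = B} ¬h ap))
next-step (coe-fcom {A = A} {B = B} ¬h ap) = principal-value (next-value (fcom-val {M = A} {N = B} ¬h ap))

⟼-deterministic : ∀ {Ψ} {M N N′ : Term Ψ 0} → M ⟼ N → M ⟼ N′ → N ≡ N′
⟼-deterministic s t = just-injective (trans (sym (next-step s)) (next-step t))

value-stuck : ∀ {Ψ} {M N : Term Ψ 0} → Val M → M ⟼ N → ⊥
value-stuck v s with () ← trans (sym (next-value v)) (next-step s)

⟼*-deterministic : ∀ {Ψ} {M W W′ : Term Ψ 0} → M ⟼* W → Val W → M ⟼* W′ → Val W′ → W ≡ W′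
⟼*-deterministic stop      v stop     v′ = refl
⟼*-deterministic stop      v (t ◅ _)  v′ = ⊥-elim (value-stuck v t)
⟼*-deterministic (s ◅ _)  v stop     v′ = ⊥-elim (value-stuck v′ s)
⟼*-deterministic (s ◅ ss) v (t ◅ ts) v′ with refl ← ⟼-deterministic s t = ⟼*-deterministic ss v ts v′

⇓-deterministic : ∀ {Ψ} {M W W′ : Term Ψ 0} → M ⇓ W → M ⇓ W′ → W ≡ W′
⇓-deterministic (ss , v) (ts , v′) = ⟼*-deterministic ss v ts v′

value-⇓ : ∀ {Ψ} {M W : Term Ψ 0} → Val M → M ⇓ W → M ≡ W
value-⇓ v M⇓W = ⇓-deterministic (stop , v) M⇓W

⇓-value : ∀ {Ψ} {M W : Term Ψ 0} → M ⇓ W → W ⇓ W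
⇓-value (_ , v) = stop , v

⟼-⇓ : ∀ {Ψ} {M M′ W : Term Ψ 0} → M ⟼ M′ → M′ ⇓ W → M ⇓ W
⟼-⇓ s (ss , v) = s ◅ ss , v

-- Partial equivalence relations

module Elements (ℓ : Level) where

  open Relations ℓ

  ≃-refl : ∀ {Ψ} {φ : Rel Ψ} → φ ≃ φ
  ≃-refl = equal (λ r → r) (λ r → r)

  ≃-sym : ∀ {Ψ} {φ χ : Rel Ψ} → φ ≃ χ → χ ≃ φ
  ≃-sym e = equal (_≃_.from e) (_≃_.to e)

  ≃-trans : ∀ {Ψ} {φ χ ω : Rel Ψ} → φ ≃ χ → χ ≃ ω → φ ≃ ω
  ≃-trans e e′ = equal (λ r → _≃_.to e′ (_≃_.to e r)) (λ r → _≃_.from e (_≃_.from e′ r))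

  -- Symmetry is only asked for when the right-hand side is self-related: the
  -- relations of V and fcom types refer to the left-hand term alone.
  record Linked {Ψ} (R : Rel Ψ) (M N : Term Ψ 0) : Set ℓ where
    constructor linked
    field
      rel  : R M N
      tr   : ∀ {P} → R N P → R M P
      csym : R N N → R N M

  CPER : ∀ {Ψ} → Rel Ψ → Set ℓ
  CPER R = ∀ {M N} → R M N → Linked R M N

  CPERs : ∀ {Ψ} → ΨRel Ψ → Set ℓ
  CPERs {Ψ} α = ∀ {Ψ′} (ψ : Ψ′ ⇒ Ψ) → CPER (α ψ)

  infix 4 _≃ₛ_
  _≃ₛ_ : ∀ {Ψ} → ΨRel Ψ → ΨRel Ψ → Set ℓ
  _≃ₛ_ {Ψ} α β = ∀ {Ψ′} (ψ : Ψ′ ⇒ Ψ) → α ψ ≃ β ψ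

  CPER-≃ : ∀ {Ψ} {R S : Rel Ψ} → R ≃ S → CPER S → CPER R
  CPER-≃ e c r = linked r
    (λ s → from (Linked.tr (c (to r)) (to s)))
    (λ s → from (Linked.csym (c (to r)) (to s)))
    where open _≃_ e

  Eval-map : ∀ {Ψ} {R S : Rel Ψ} → (∀ {M N} → R M N → S M N) → ∀ {M N} → Eval R M N → Eval S M N
  Eval-map f (eval m n r) = eval m n (f r)

  Eval-tr : ∀ {Ψ} {R : Rel Ψ} {M N P} → Eval (Linked R) M N → Eval R N P → Eval R M P
  Eval-tr (eval m n r) (eval n′ p s) with refl ← ⇓-deterministic n n′ = eval m p (Linked.tr r s)

  Eval-csym : ∀ {Ψ} {R : Rel Ψ} {M N} → Eval (Linked R) M N → Eval R N N → Eval R N M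
  Eval-csym (eval m n r) (eval n′ n″ s)
    with refl ← ⇓-deterministic n n′ | refl ← ⇓-deterministic n n″ = eval n m (Linked.csym r s)

  Tm-map : ∀ {Ψ} {α β : ΨRel Ψ} → (∀ {Ψ′} (ψ : Ψ′ ⇒ Ψ) {M N} → α ψ M N → β ψ M N) →
           ∀ {M N} → Tm α M N → Tm β M N
  Tm-map f t ψ₁ ψ₂ with tmAt m n a b c d e ← t ψ₁ ψ₂ =
    tmAt m n (Eval-map (f _) a) (Eval-map (f _) b) (Eval-map (f _) c) (Eval-map (f _) d) (Eval-map (f _) e)

  Tm-≃ : ∀ {Ψ} {α β : ΨRel Ψ} → α ≃ₛ β → ∀ {M N} → Tm α M N → Tm β M N
  Tm-≃ e = Tm-map (λ ψ → _≃_.to (e ψ))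

  Tm-subst : ∀ {Ψ Ψ′} {α : ΨRel Ψ} {M N} → Tm α M N → (ψ : Ψ′ ⇒ Ψ) → Tm (α · ψ) (M ⟪ ψ ⟫) (N ⟪ ψ ⟫)
  Tm-subst {α = α} {M} {N} t ψ ψ₁ ψ₂ with tmAt m n a b c d e ← t (ψ ⨾ ψ₁) ψ₂ =
    tmAt (subst (_⇓ _) M≡ m) (subst (_⇓ _) N≡ n)
         (cast refl Mψ₂≡ a) (cast Mψ₂≡ refl b) (cast refl Nψ₂≡ c) (cast Nψ₂≡ refl d) (cast refl refl e)
    where
    M≡ : M ⟪ ψ ⨾ ψ₁ ⟫ ≡ M ⟪ ψ ⟫ ⟪ ψ₁ ⟫
    M≡ = sym (⟪⟫-⨾ M ψ ψ₁)
    N≡ : N ⟪ ψ ⨾ ψ₁ ⟫ ≡ N ⟪ ψ ⟫ ⟪ ψ₁ ⟫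
    N≡ = sym (⟪⟫-⨾ N ψ ψ₁)
    Mψ₂≡ : M ⟪ ψ ⨾ ψ₁ ⟫ ⟪ ψ₂ ⟫ ≡ M ⟪ ψ ⟫ ⟪ ψ₁ ⟫ ⟪ ψ₂ ⟫
    Mψ₂≡ = cong (_⟪ ψ₂ ⟫) M≡
    Nψ₂≡ : N ⟪ ψ ⨾ ψ₁ ⟫ ⟪ ψ₂ ⟫ ≡ N ⟪ ψ ⟫ ⟪ ψ₁ ⟫ ⟪ ψ₂ ⟫
    Nψ₂≡ = cong (_⟪ ψ₂ ⟫) N≡
    cast : ∀ {X X′ Y Y′} → X ≡ X′ → Y ≡ Y′ → Eval (α ((ψ ⨾ ψ₁) ⨾ ψ₂)) X Y → Eval (α (ψ ⨾ (ψ₁ ⨾ ψ₂))) X′ Y′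
    cast refl refl = subst (λ χ → Eval (α χ) _ _) (⨾-assoc ψ ψ₁ ψ₂)

  ≡⇒≃ₛ : ∀ {Ψ Ψ′} (α : ΨRel Ψ) {ψ ψ′ : Ψ′ ⇒ Ψ} → ψ ≡ ψ′ → α · ψ ≃ₛ α · ψ′
  ≡⇒≃ₛ α refl _ = ≃-refl

  ·-⨾ : ∀ {Ψ Ψ₁ Ψ₂} (α : ΨRel Ψ) (ψ₁ : Ψ₁ ⇒ Ψ) (ψ₂ : Ψ₂ ⇒ Ψ₁) → α · ψ₁ · ψ₂ ≃ₛ α · (ψ₁ ⨾ ψ₂)
  ·-⨾ α ψ₁ ψ₂ ψ rewrite ⨾-assoc ψ₁ ψ₂ ψ = ≃-refl

  ·-id : ∀ {Ψ} (α : ΨRel Ψ) → α · idₛ ≃ₛ α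
  ·-id α ψ rewrite ⨾-idˡ ψ = ≃-refl

  ≃ₛ-sym : ∀ {Ψ} {α β : ΨRel Ψ} → α ≃ₛ β → β ≃ₛ α
  ≃ₛ-sym e ψ = ≃-sym (e ψ)

  ≃ₛ-trans : ∀ {Ψ} {α β γ : ΨRel Ψ} → α ≃ₛ β → β ≃ₛ γ → α ≃ₛ γ
  ≃ₛ-trans e e′ ψ = ≃-trans (e ψ) (e′ ψ)

  Coh-· : ∀ {Ψ Ψ′} {α : ΨRel Ψ} → Coh α → (ψ : Ψ′ ⇒ Ψ) → Coh (α · ψ)
  Coh-· {α = α} c ψ ψ′ r = Tm-≃ (≃ₛ-sym (·-⨾ α ψ ψ′)) (c (ψ ⨾ ψ′) r)

  -- The relations are given as α ψ with α hereditarily linked, so that these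
  -- lemmas also serve as induction steps.
  module _ {Ψ} {α : ΨRel Ψ} {M N} (t : Tm (λ ψ → Linked (α ψ)) M N) where

    Tm-rel : Tm α M N
    Tm-rel = Tm-map (λ ψ → Linked.rel) t

    -- `N₁-N` followed by `N-N₁` relates `N₁ ⟪ ψ₂ ⟫` to itself, which discharges the condition on
    -- symmetry.
    Tm-sym : Tm α N M
    Tm-sym ψ₁ ψ₂ with tmAt m n a b c d e ← t ψ₁ ψ₂ =
      tmAt n m (Eval-map Linked.rel c) (Eval-map Linked.rel d) (Eval-map Linked.rel a) (Eval-map Linked.rel b)
           (Eval-csym e (Eval-tr c (Eval-map Linked.rel d)))

    Tm-tr : ∀ {P} → Tm α N P → Tm α M P
    Tm-tr u ψ₁ ψ₂ with tmAt m n a b c d e ← t ψ₁ ψ₂ | tmAt n′ p a′ b′ c′ d′ e′ ← u ψ₁ ψ₂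
      with refl ← ⇓-deterministic n n′ =
      tmAt m p (Eval-map Linked.rel a) (Eval-map Linked.rel b) c′ d′ (Eval-tr e e′)

  module TmPER {Ψ} {α : ΨRel Ψ} (c : CPERs α) where

    private
      hereditarily : ∀ {M N} → Tm α M N → Tm (λ ψ → Linked (α ψ)) M N
      hereditarily = Tm-map (λ ψ → c ψ)

    symᵀ : ∀ {M N} → Tm α M N → Tm α N M
    symᵀ t = Tm-sym (hereditarily t)

    transᵀ : ∀ {M N P} → Tm α M N → Tm α N P → Tm α M P
    transᵀ t = Tm-tr (hereditarily t)

    reflˡ : ∀ {M N} → Tm α M N → Tm α M M
    reflˡ t = transᵀ t (symᵀ t)

    reflʳ : ∀ {M N} → Tm α M N → Tm α N N
    reflʳ t = transᵀ (symᵀ t) t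

-- ℕ, 𝔹 and ℂ

module _ where

  open Relations lzero
  open Elements lzero

  Linked₀ : (∀ Ψ → Rel Ψ) → ∀ Ψ → Rel Ψ
  Linked₀ R Ψ = Linked (R Ψ)

  ℕ-cper : ∀ {Ψ} → CPER (ℕᴿ Ψ)
  -- This is `Tm-map` written out, so that the recursive calls of `ℕ-cper` are on visible
  -- subderivations.
  ℕ-tm   : ∀ {Ψ M N} → Tm {Ψ} (indexed ℕᴿ) M N → Tm {Ψ} (indexed (Linked₀ ℕᴿ)) M N
  ℕ-tmAt : ∀ {Ψ Ψ₁ Ψ₂ M N} {ψ₁ : Ψ₁ ⇒ Ψ} {ψ₂ : Ψ₂ ⇒ Ψ₁} →
           TmAt (indexed ℕᴿ) M N ψ₁ ψ₂ → TmAt (indexed (Linked₀ ℕᴿ)) M N ψ₁ ψ₂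
  ℕ-eval : ∀ {Ψ M N} → Eval (ℕᴿ Ψ) M N → Eval (Linked (ℕᴿ Ψ)) M N

  ℕ-cper zᴿ     = linked zᴿ (λ r → r) (λ r → r)
  ℕ-cper (sᴿ t) = linked (sᴿ t) (λ { (sᴿ u) → sᴿ (Tm-tr (ℕ-tm t) u) }) (λ _ → sᴿ (Tm-sym (ℕ-tm t)))
  ℕ-tm t ψ₁ ψ₂ = ℕ-tmAt (t ψ₁ ψ₂)
  ℕ-tmAt (tmAt m n a b c d e) = tmAt m n (ℕ-eval a) (ℕ-eval b) (ℕ-eval c) (ℕ-eval d) (ℕ-eval e)
  ℕ-eval (eval m n r) = eval m n (ℕ-cper r)

  Bool-cper : ∀ {Ψ} → CPER (Boolᴿ Ψ)
  Bool-cper trueᴿ  = linked trueᴿ (λ r → r) (λ r → r)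
  Bool-cper falseᴿ = linked falseᴿ (λ r → r) (λ r → r)

  -- The condition relating `N i ⟨ r ⟩` to `M` mentions the left-hand term only: transitivity keeps
  -- the first one, symmetry takes it from the self-related right-hand term. On tubes, transitivity
  -- from `i` to `j` passes through entry `i` of the middle term.
  FKan-cper : ∀ {R : ∀ Ψ → Rel Ψ} {Ψ M N} → FKan (Linked₀ R) Ψ M N → Linked (FKan R Ψ) M N
  FKan-cper (fkan v m n b) = linked
    (fkan v (Tm-rel m) (λ i j ψ h h′ → Tm-rel (n i j ψ h h′)) (λ i ψ h → Tm-rel (b i ψ h)))
    (λ { (fkan v m′ n′ b′) → fkan v (Tm-tr m m′)
           (λ i j ψ h h′ → Tm-tr (n i i ψ h h) (n′ i j ψ h h′))
           (λ i ψ h → Tm-rel (b i ψ h)) })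
    (λ { (fkan v m′ n′ b′) → fkan v (Tm-sym m) (λ i j ψ h h′ → Tm-sym (n j i ψ h′ h)) b′ })

  𝔹-cper : ∀ {Ψ} → CPER (𝔹ᴿ Ψ)
  𝔹-fkan : ∀ {Ψ M N} → FKan 𝔹ᴿ Ψ M N → FKan (Linked₀ 𝔹ᴿ) Ψ M N
  𝔹-tm   : ∀ {Ψ M N} → Tm {Ψ} (indexed 𝔹ᴿ) M N → Tm {Ψ} (indexed (Linked₀ 𝔹ᴿ)) M N
  𝔹-tmAt : ∀ {Ψ Ψ₁ Ψ₂ M N} {ψ₁ : Ψ₁ ⇒ Ψ} {ψ₂ : Ψ₂ ⇒ Ψ₁} →
           TmAt (indexed 𝔹ᴿ) M N ψ₁ ψ₂ → TmAt (indexed (Linked₀ 𝔹ᴿ)) M N ψ₁ ψ₂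
  𝔹-eval : ∀ {Ψ M N} → Eval (𝔹ᴿ Ψ) M N → Eval (Linked (𝔹ᴿ Ψ)) M N

  𝔹-cper trueᴿ  = linked trueᴿ (λ r → r) (λ r → r)
  𝔹-cper falseᴿ = linked falseᴿ (λ r → r) (λ r → r)
  -- Matching on `fkan` reveals that both terms are `fcom`s, which excludes `true` and `false` in
  -- the two functions below.
  𝔹-cper {Ψ} (fkanᴿ f@(fkan _ _ _ _)) with linked r t c ← FKan-cper (𝔹-fkan f) = linked (fkanᴿ r)
    (λ { (fkanᴿ g) → fkanᴿ (t g) })
    (λ { (fkanᴿ g) → fkanᴿ (c g) })
  𝔹-fkan (fkan v m n b) =
    fkan v (𝔹-tm m) (λ i j ψ h h′ → 𝔹-tm (n i j ψ h h′)) (λ i ψ h → 𝔹-tm (b i ψ h))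
  𝔹-tm t ψ₁ ψ₂ = 𝔹-tmAt (t ψ₁ ψ₂)
  𝔹-tmAt (tmAt m n a b c d e) = tmAt m n (𝔹-eval a) (𝔹-eval b) (𝔹-eval c) (𝔹-eval d) (𝔹-eval e)
  𝔹-eval (eval m n r) = eval m n (𝔹-cper r)

  ℂ-cper : ∀ {Ψ} → CPER (ℂᴿ Ψ)
  ℂ-fkan : ∀ {Ψ M N} → FKan ℂᴿ Ψ M N → FKan (Linked₀ ℂᴿ) Ψ M N
  ℂ-tm   : ∀ {Ψ M N} → Tm {Ψ} (indexed ℂᴿ) M N → Tm {Ψ} (indexed (Linked₀ ℂᴿ)) M N
  ℂ-tmAt : ∀ {Ψ Ψ₁ Ψ₂ M N} {ψ₁ : Ψ₁ ⇒ Ψ} {ψ₂ : Ψ₂ ⇒ Ψ₁} →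
           TmAt (indexed ℂᴿ) M N ψ₁ ψ₂ → TmAt (indexed (Linked₀ ℂᴿ)) M N ψ₁ ψ₂
  ℂ-eval : ∀ {Ψ M N} → Eval (ℂᴿ Ψ) M N → Eval (Linked (ℂᴿ Ψ)) M N

  ℂ-cper baseᴿ     = linked baseᴿ (λ r → r) (λ r → r)
  ℂ-cper (loopᴿ x) = linked (loopᴿ x) (λ r → r) (λ r → r)
  ℂ-cper (fkanᴿ f@(fkan _ _ _ _)) with linked r t c ← FKan-cper (ℂ-fkan f) = linked (fkanᴿ r)
    (λ { (fkanᴿ g) → fkanᴿ (t g) })
    (λ { (fkanᴿ g) → fkanᴿ (c g) })
  ℂ-fkan (fkan v m n b) =
    fkan v (ℂ-tm m) (λ i j ψ h h′ → ℂ-tm (n i j ψ h h′)) (λ i ψ h → ℂ-tm (b i ψ h))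
  ℂ-tm t ψ₁ ψ₂ = ℂ-tmAt (t ψ₁ ψ₂)
  ℂ-tmAt (tmAt m n a b c d e) = tmAt m n (ℂ-eval a) (ℂ-eval b) (ℂ-eval c) (ℂ-eval d) (ℂ-eval e)
  ℂ-eval (eval m n r) = eval m n (ℂ-cper r)

-- Equality of types

module Types (ℓ : Level) where

  open Relations ℓ
  open System ℓ
  open Elements ℓ

  EvalTy-map : ∀ {σ τ : Cand} → (∀ {Ψ A B φ} → σ Ψ A B φ → τ Ψ A B φ) →
               ∀ {Ψ A B φ} → EvalTy σ Ψ A B φ → EvalTy τ Ψ A B φ
  EvalTy-map f (eval a b r) = eval a b (f r)

  PTyAt-map : ∀ {σ τ : Cand} → (∀ {Ψ A B φ} → σ Ψ A B φ → τ Ψ A B φ) →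
              ∀ {Ψ Ψ₁ Ψ₂ A B} {ψ₁ : Ψ₁ ⇒ Ψ} {ψ₂ : Ψ₂ ⇒ Ψ₁} → PTyAt σ A B ψ₁ ψ₂ → PTyAt τ A B ψ₁ ψ₂
  PTyAt-map {σ} {τ} f (ptyAt m n φ a b c d e) = ptyAt m n φ (g a) (g b) (g c) (g d) (g e)
    where
    g : ∀ {Ψ A B φ} → EvalTy σ Ψ A B φ → EvalTy τ Ψ A B φ
    g = EvalTy-map {σ} {τ} f

  PTy-map : ∀ {σ τ : Cand} → (∀ {Ψ A B φ} → σ Ψ A B φ → τ Ψ A B φ) →
            ∀ {Ψ A B} {α : ΨRel Ψ} → PTy σ Ψ A B α → PTy τ Ψ A B α
  PTy-map {σ} {τ} f (mkPTy t c) = mkPTy (λ ψ → EvalTy-map {σ} {τ} f (t ψ)) (λ ψ₁ ψ₂ → PTyAt-map {σ} {τ} f (c ψ₁ ψ₂))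

  PTy-subst : ∀ {τ : Cand} {Ψ Ψ′ A B} {α : ΨRel Ψ} → PTy τ Ψ A B α → (ψ : Ψ′ ⇒ Ψ) →
              PTy τ Ψ′ (A ⟪ ψ ⟫) (B ⟪ ψ ⟫) (α · ψ)
  PTy-subst {τ} {A = A} {B} {α} (mkPTy t c) ψ = mkPTy
    (λ ψ′ → cast (sym (⟪⟫-⨾ A ψ ψ′)) (sym (⟪⟫-⨾ B ψ ψ′)) (t (ψ ⨾ ψ′)))
    (λ ψ₁ ψ₂ → shift ψ₁ ψ₂ (c (ψ ⨾ ψ₁) ψ₂))
    where
    cast : ∀ {Ψ X X′ Y Y′ φ} → X ≡ X′ → Y ≡ Y′ → EvalTy τ Ψ X Y φ → EvalTy τ Ψ X′ Y′ φ
    cast refl refl r = r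

    shift : ∀ {Ψ₁ Ψ₂} (ψ₁ : Ψ₁ ⇒ _) (ψ₂ : Ψ₂ ⇒ Ψ₁) →
            PTyAt τ A B (ψ ⨾ ψ₁) ψ₂ → PTyAt τ (A ⟪ ψ ⟫) (B ⟪ ψ ⟫) ψ₁ ψ₂
    shift ψ₁ ψ₂ (ptyAt m n φ a b c d e) =
      ptyAt (subst (_⇓ _) A≡ m) (subst (_⇓ _) B≡ n) φ
            (cast refl (cong (_⟪ ψ₂ ⟫) A≡) a) (cast (cong (_⟪ ψ₂ ⟫) A≡) refl b)
            (cast refl (cong (_⟪ ψ₂ ⟫) B≡) c) (cast (cong (_⟪ ψ₂ ⟫) B≡) refl d) e
      where
      A≡ : A ⟪ ψ ⨾ ψ₁ ⟫ ≡ A ⟪ ψ ⟫ ⟪ ψ₁ ⟫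
      A≡ = sym (⟪⟫-⨾ A ψ ψ₁)
      B≡ : B ⟪ ψ ⨾ ψ₁ ⟫ ≡ B ⟪ ψ ⟫ ⟪ ψ₁ ⟫
      B≡ = sym (⟪⟫-⨾ B ψ ψ₁)

  -- B ≐ B supplies those premises of B ≐ A that concern B alone, for V and fcom
  -- types; after the induction it is no restriction, by τ-reflʳ.
  record Good (τ : Cand) (Ψ : ℕ) (A B : Term Ψ 0) (φ : Rel Ψ) : Set (lsuc ℓ) where
    constructor good
    field
      rel  : τ Ψ A B φ
      fun  : ∀ {C χ} → τ Ψ A C χ → φ ≃ χ
      tr   : ∀ {C χ} → τ Ψ B C χ → ∃ λ ω → τ Ψ A C ω
      csym : ∀ {χ} → τ Ψ B B χ → ∃ λ ω → τ Ψ B A ω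
      cper : CPER φ

  -- Below, functionality is what allows the same α to be kept throughout.
  module PTyGood {τ : Cand} (resp : ∀ {Ψ A B φ χ} → χ ≃ φ → τ Ψ A B φ → τ Ψ A B χ) where

    EvalTy-resp : ∀ {Ψ A B φ χ} → χ ≃ φ → EvalTy τ Ψ A B φ → EvalTy τ Ψ A B χ
    EvalTy-resp e (eval a b r) = eval a b (resp e r)

    EvalTy-rel : ∀ {Ψ A B φ} → EvalTy (Good τ) Ψ A B φ → EvalTy τ Ψ A B φ
    EvalTy-rel (eval a b g) = eval a b (Good.rel g)

    EvalTy-fun : ∀ {Ψ A B C φ χ} → EvalTy (Good τ) Ψ A B φ → EvalTy τ Ψ A C χ → φ ≃ χ
    EvalTy-fun (eval a b g) (eval a′ c r) with refl ← ⇓-deterministic a a′ = Good.fun g r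

    EvalTy-tr : ∀ {Ψ A B C φ χ} → EvalTy (Good τ) Ψ A B φ → EvalTy τ Ψ B C χ → EvalTy τ Ψ A C φ
    EvalTy-tr (eval a b g) (eval b′ c r) with refl ← ⇓-deterministic b b′
      with _ , s ← Good.tr g r =
      eval a c (resp (Good.fun g s) s)

    -- `csym` leaves the relation of `B ≐ A` open. The derivation with `B` on the left at `φ` pins
    -- it down by functionality.
    EvalTy-sym : ∀ {Ψ A B C φ χ} → EvalTy (Good τ) Ψ A B φ → EvalTy (Good τ) Ψ B C φ → EvalTy τ Ψ B B χ →
                 EvalTy τ Ψ B A φ
    EvalTy-sym (eval a b g) (eval b′ c g′) (eval b″ b‴ r)
      with refl ← ⇓-deterministic b b′ | refl ← ⇓-deterministic b b″ | refl ← ⇓-deterministic b b‴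
      with _ , s ← Good.csym g r = eval b a (resp (Good.fun g′ s) s)

    EvalTy-idˡ : ∀ {σ : Cand} {Ψ A A₁ B φ} → A ⇓ A₁ → EvalTy σ Ψ (A₁ ⟪ idₛ ⟫) B φ → EvalTy σ Ψ A B φ
    EvalTy-idˡ {A₁ = A₁} a r with eval a′ b s ← subst (λ X → EvalTy _ _ X _ _) (act-id A₁) r
      with refl ← ⇓-deterministic (⇓-value a) a′ = eval a b s

    EvalTy-idʳ : ∀ {σ : Cand} {Ψ A B B₁ φ} → B ⇓ B₁ → EvalTy σ Ψ A (B₁ ⟪ idₛ ⟫) φ → EvalTy σ Ψ A B φ
    EvalTy-idʳ {B₁ = B₁} b r with eval a b′ s ← subst (λ X → EvalTy _ _ _ X _) (act-id B₁) r
      with refl ← ⇓-deterministic (⇓-value b) b′ = eval a b s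

    -- `coherent` at `ψ₂ = idₛ` already contains `types`, because a value evaluates to itself; only
    -- the relations remain to be compared.
    PTy-intro : ∀ {Ψ A B} {α : ΨRel Ψ} (c : ∀ {Ψ₁ Ψ₂} (ψ₁ : Ψ₁ ⇒ Ψ) (ψ₂ : Ψ₂ ⇒ Ψ₁) → PTyAt τ A B ψ₁ ψ₂) →
                (∀ {Ψ′} (ψ : Ψ′ ⇒ Ψ) → α ψ ≃ PTyAt.φ (c ψ idₛ)) → PTy τ Ψ A B α
    PTy-intro c α≃ = mkPTy
      (λ ψ → let p = c ψ idₛ in
             EvalTy-resp (α≃ ψ) (EvalTy-idˡ (PTyAt.A⇓ p) (EvalTy-idʳ (PTyAt.B⇓ p) (PTyAt.A₁-B₁ p))))
      c

    PTy-resp : ∀ {Ψ A B} {α β : ΨRel Ψ} → β ≃ₛ α → PTy τ Ψ A B α → PTy τ Ψ A B β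
    PTy-resp e (mkPTy t c) = mkPTy (λ ψ → EvalTy-resp (e ψ) (t ψ)) c

    module _ {Ψ A B} {α : ΨRel Ψ} (p : PTy (Good τ) Ψ A B α) where

      private
        at : ∀ {Ψ₁ Ψ₂} (ψ₁ : Ψ₁ ⇒ Ψ) (ψ₂ : Ψ₂ ⇒ Ψ₁) → PTyAt (Good τ) A B ψ₁ ψ₂
        at = PTy.coherent p

        α≃ : ∀ {Ψ′} (ψ : Ψ′ ⇒ Ψ) → α ψ ≃ PTyAt.φ (at ψ idₛ)
        α≃ ψ = EvalTy-fun (PTy.types p ψ)
          (EvalTy-idˡ q.A⇓ (EvalTy-idʳ q.B⇓ (EvalTy-rel q.A₁-B₁)))
          where module q = PTyAt (at ψ idₛ)

      relᴾ : PTy τ Ψ A B α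
      relᴾ = PTy-map Good.rel p

      funᴾ : ∀ {C} {β : ΨRel Ψ} → PTy τ Ψ A C β → α ≃ₛ β
      funᴾ q ψ = EvalTy-fun (PTy.types p ψ) (PTy.types q ψ)

      -- `PTyAt` holds `B₁ ≐ B` at the same `φ` as `A₁ ≐ B₁`. So functionality applies with `B` on
      -- the left, before any symmetry is known.
      funʳᴾ : ∀ {C} {β : ΨRel Ψ} → PTy τ Ψ B C β → α ≃ₛ β
      funʳᴾ q ψ = ≃-trans (α≃ ψ) (EvalTy-fun
        (EvalTy-idˡ (PTyAt.B⇓ (at ψ idₛ)) (PTyAt.B₁-B (at ψ idₛ))) (PTy.types q ψ))

      trᴾ : ∀ {C} {β : ΨRel Ψ} → PTy τ Ψ B C β → PTy τ Ψ A C α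
      trᴾ {C} q = PTy-intro tr-at α≃
        where
        tr-at : ∀ {Ψ₁ Ψ₂} (ψ₁ : Ψ₁ ⇒ Ψ) (ψ₂ : Ψ₂ ⇒ Ψ₁) → PTyAt τ A C ψ₁ ψ₂
        tr-at ψ₁ ψ₂ = ptyAt ab.A⇓ bc.B⇓ ab.φ (EvalTy-rel ab.A₁-A) (EvalTy-rel ab.A-A₁)
          (EvalTy-resp φ≃ bc.B₁-B) (EvalTy-resp φ≃ bc.B-B₁) (EvalTy-tr ab.A₁-B₁ (at-B₁ bc.A₁-B₁))
          where
          module ab = PTyAt (at ψ₁ ψ₂)
          module bc = PTyAt (PTy.coherent q ψ₁ ψ₂)
          at-B₁ : ∀ {X} → EvalTy τ _ (bc.A₁ ⟪ ψ₂ ⟫) X bc.φ → EvalTy τ _ (ab.B₁ ⟪ ψ₂ ⟫) X bc.φ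
          at-B₁ = subst (λ B₁ → EvalTy τ _ (B₁ ⟪ ψ₂ ⟫) _ bc.φ) (⇓-deterministic bc.A⇓ ab.B⇓)
          -- The two coherence relations are chosen independently, but both come from derivations
          -- with `B₁ ⟪ ψ₂ ⟫` on the left.
          φ≃ : ab.φ ≃ bc.φ
          φ≃ = EvalTy-fun ab.B₁-B (at-B₁ bc.A₁-A)

      -- As in `Tm-sym`, `B₁-B` and `B-B₁` compose to the self-relatedness that `csym` asks for.
      symᴾ : PTy τ Ψ B A α
      symᴾ = PTy-intro (λ ψ₁ ψ₂ → let open PTyAt (at ψ₁ ψ₂) in
        ptyAt B⇓ A⇓ φ (EvalTy-rel B₁-B) (EvalTy-rel B-B₁) (EvalTy-rel A₁-A) (EvalTy-rel A-A₁)
              (EvalTy-sym A₁-B₁ B₁-B (EvalTy-tr B₁-B (EvalTy-rel B-B₁)))) α≃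

      reflˡᴾ : PTy τ Ψ A A α
      reflˡᴾ = trᴾ symᴾ

      reflʳᴾ : PTy τ Ψ B B α
      reflʳᴾ = PTy-intro (λ ψ₁ ψ₂ → let open PTyAt (at ψ₁ ψ₂) in
        ptyAt B⇓ B⇓ φ (EvalTy-rel B₁-B) (EvalTy-rel B-B₁) (EvalTy-rel B₁-B) (EvalTy-rel B-B₁)
              (EvalTy-tr B₁-B (EvalTy-rel B-B₁))) α≃

      cperᴾ : CPERs α
      cperᴾ ψ = Good.cper (EvalTy.related (PTy.types p ψ))

-- Element relations: invariance under extensional equality, conditional PERs

Holds-lift : ∀ {Ψ Ψ′} (e : Eqn Ψ) (ψ : Ψ′ ⇒ Ψ) → Holds (e ⟪ ψ ⟫ᵉ) → Holds (wkᵉ e ⟪ lift ψ ⟫ᵉ)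
Holds-lift (r , r′) ψ h = trans (wk-lift r) (trans (cong wkᵈ h) (sym (wk-lift r′)))
  where
  wk-lift : ∀ s → wkᵈ s ⟪ lift ψ ⟫ᵈ ≡ wkᵈ (s ⟪ ψ ⟫ᵈ)
  wk-lift s = trans (⟪⟫ᵈ-wk s (name zero) (map wkᵈ ψ)) (sym (⟪⟫ᵈ-⨾ s ψ wkₛ))

module ElementRelations (ℓ : Level) where

  open Relations ℓ
  open System ℓ
  open Elements ℓ

  ·-≃ₛ : ∀ {Ψ Ψ′} {α β : ΨRel Ψ} → α ≃ₛ β → (ψ : Ψ′ ⇒ Ψ) → α · ψ ≃ₛ β · ψ
  ·-≃ₛ e ψ χ = e (ψ ⨾ χ)

  CPERs-· : ∀ {Ψ Ψ′} {α : ΨRel Ψ} → CPERs α → (ψ : Ψ′ ⇒ Ψ) → CPERs (α · ψ)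
  CPERs-· c ψ χ = c (ψ ⨾ χ)

  -- A family is unconstrained at unrelated arguments, so two families for the same type can be
  -- compared at related ones only.
  Agree : ∀ {Ψ} → ΨRel Ψ → Fam Ψ → Fam Ψ → Set ℓ
  Agree {Ψ} α β β′ = ∀ {Ψ′} (ψ : Ψ′ ⇒ Ψ) M M′ → Tm (α · ψ) M M′ → β ψ M M′ ≃ₛ β′ ψ M M′

  Agree-sym : ∀ {Ψ} {α α′ : ΨRel Ψ} {β β′ : Fam Ψ} → α ≃ₛ α′ → Agree α β β′ → Agree α′ β′ β
  Agree-sym e b ψ M M′ t = ≃ₛ-sym (b ψ M M′ (Tm-≃ (≃ₛ-sym (·-≃ₛ e ψ)) t))

  module _ {Ψ} {α α′ : ΨRel Ψ} {β β′ : Fam Ψ} (a : α ≃ₛ α′) (b : Agree α β β′) where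

    Funᴿ-map : ∀ {M N} → Funᴿ α β M N → Funᴿ α′ β′ M N
    Funᴿ-map (lamᴿ n) = lamᴿ λ ψ M M′ t →
      let t′ = Tm-≃ (≃ₛ-sym (·-≃ₛ a ψ)) t in Tm-≃ (b ψ M M′ t′) (n ψ M M′ t′)

    Pairᴿ-map : ∀ {M N} → Pairᴿ α β M N → Pairᴿ α′ β′ M N
    Pairᴿ-map (pairᴿ m n) = pairᴿ (Tm-≃ a m) (Tm-≃ (b idₛ _ _ (Tm-≃ (≃ₛ-sym (·-id α)) m)) n)

  Funᴿ-≃ : ∀ {Ψ} {α α′ : ΨRel Ψ} {β β′ : Fam Ψ} → α ≃ₛ α′ → Agree α β β′ → Funᴿ α β ≃ Funᴿ α′ β′
  Funᴿ-≃ a b = equal (Funᴿ-map a b) (Funᴿ-map (≃ₛ-sym a) (Agree-sym a b))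

  Pairᴿ-≃ : ∀ {Ψ} {α α′ : ΨRel Ψ} {β β′ : Fam Ψ} → α ≃ₛ α′ → Agree α β β′ → Pairᴿ α β ≃ Pairᴿ α′ β′
  Pairᴿ-≃ a b = equal (Pairᴿ-map a b) (Pairᴿ-map (≃ₛ-sym a) (Agree-sym a b))

  Pathᴿ-map : ∀ {Ψ} {α α′ : ΨRel (suc Ψ)} {P₀ P₁ M N} → α ≃ₛ α′ → Pathᴿ α P₀ P₁ M N → Pathᴿ α′ P₀ P₁ M N
  Pathᴿ-map a (plamᴿ m p) = plamᴿ (Tm-≃ a m) (λ ε → Tm-≃ (·-≃ₛ a (const ε ∷ idₛ)) (p ε))

  Pathᴿ-≃ : ∀ {Ψ} {α α′ : ΨRel (suc Ψ)} {P₀ P₁} → α ≃ₛ α′ → Pathᴿ α P₀ P₁ ≃ Pathᴿ α′ P₀ P₁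
  Pathᴿ-≃ a = equal (Pathᴿ-map a) (Pathᴿ-map (≃ₛ-sym a))

  Eqᴿ-map : ∀ {Ψ} {α α′ : ΨRel Ψ} {P Q M N} → α ≃ₛ α′ → Eqᴿ α P Q M N → Eqᴿ α′ P Q M N
  Eqᴿ-map a (starᴿ m) = starᴿ (Tm-≃ a m)

  Eqᴿ-≃ : ∀ {Ψ} {α α′ : ΨRel Ψ} {P Q} → α ≃ₛ α′ → Eqᴿ α P Q ≃ Eqᴿ α′ P Q
  Eqᴿ-≃ a = equal (Eqᴿ-map a) (Eqᴿ-map (≃ₛ-sym a))

  Vᴿ-map : ∀ {Ψ x} {α α′ : VFam Ψ} {β β′ : ΨRel Ψ} {E M N} →
           (∀ {Ψ′} (ψ : Ψ′ ⇒ Ψ) → lookup ψ x ≡ 𝟎 → α ψ ≃ₛ α′ ψ) → β ≃ₛ β′ → Vᴿ x α β E M N → Vᴿ x α′ β′ E M N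
  Vᴿ-map a b (vinᴿ n m e) = vinᴿ (Tm-≃ b n) (λ ψ h → Tm-≃ (a ψ h) (m ψ h)) (λ ψ h → Tm-≃ (·-≃ₛ b ψ) (e ψ h))

  Vᴿ-≃ : ∀ {Ψ x} {α α′ : VFam Ψ} {β β′ : ΨRel Ψ} {E} →
         (∀ {Ψ′} (ψ : Ψ′ ⇒ Ψ) → lookup ψ x ≡ 𝟎 → α ψ ≃ₛ α′ ψ) → β ≃ₛ β′ → Vᴿ x α β E ≃ Vᴿ x α′ β′ E
  Vᴿ-≃ a b = equal (Vᴿ-map a b) (Vᴿ-map (λ ψ h → ≃ₛ-sym (a ψ h)) (≃ₛ-sym b))

  Active : ∀ {Ψ Ψ′ k} → Vec (Eqn Ψ) k → Fin k → Ψ′ ⇒ suc Ψ → Set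
  Active ξ i ψ = Holds (wkᵉ (lookup ξ i) ⟪ ψ ⟫ᵉ)

  FcomAgree : ∀ {Ψ k} → Vec (Eqn Ψ) k → FcomFam Ψ k → FcomFam Ψ k → Set ℓ
  FcomAgree {Ψ} ξ β β′ = ∀ {Ψ′} i j (ψ : Ψ′ ⇒ suc Ψ) → Active ξ i ψ → Active ξ j ψ → β ψ i j ≃ₛ β′ ψ i j

  Fcomᴿ-map : ∀ {Ψ k r r′ ξ B} {α α′ : ΨRel Ψ} {β β′ : FcomFam Ψ k} {M N} → α ≃ₛ α′ → FcomAgree ξ β β′ →
              Fcomᴿ r r′ ξ B α β M N → Fcomᴿ r r′ ξ B α′ β′ M N
  Fcomᴿ-map {r′ = r′} {ξ} a b (boxᴿ m n c) = boxᴿ (Tm-≃ a m)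
    (λ i j ψ h h′ → Tm-≃
      (·-≃ₛ (b i j (lift ψ) (Holds-lift (lookup ξ i) ψ h) (Holds-lift (lookup ξ j) ψ h′)) (r′ ⟪ ψ ⟫ᵈ ∷ idₛ)) (n i j ψ h h′))
    (λ i ψ h → Tm-≃ (·-≃ₛ a ψ) (c i ψ h))

  Fcomᴿ-≃ : ∀ {Ψ k r r′ ξ B} {α α′ : ΨRel Ψ} {β β′ : FcomFam Ψ k} → α ≃ₛ α′ → FcomAgree ξ β β′ →
            Fcomᴿ r r′ ξ B α β ≃ Fcomᴿ r r′ ξ B α′ β′
  Fcomᴿ-≃ a b = equal (Fcomᴿ-map a b) (Fcomᴿ-map (≃ₛ-sym a) (λ i j ψ h h′ → ≃ₛ-sym (b i j ψ h h′)))

  Pathᴿ-cper : ∀ {Ψ} {α : ΨRel (suc Ψ)} {P₀ P₁} → CPERs α → CPER (Pathᴿ α P₀ P₁)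
  Pathᴿ-cper c (plamᴿ m p) = linked (plamᴿ m p)
    (λ { (plamᴿ m′ p′) → plamᴿ (transᵀ m m′) p })
    (λ { (plamᴿ m′ p′) → plamᴿ (symᵀ m) p′ })
    where open TmPER c

  Eqᴿ-cper : ∀ {Ψ} {α : ΨRel Ψ} {P Q} → CPER (Eqᴿ α P Q)
  Eqᴿ-cper (starᴿ m) = linked (starᴿ m) (λ { (starᴿ _) → starᴿ m }) (λ _ → starᴿ m)

  -- As for `FKan`: the equation between `app (fst E) M` and `N` concerns the left-hand term, so
  -- symmetry borrows it from the self-related right-hand one.
  Vᴿ-cper : ∀ {Ψ x} {α : VFam Ψ} {β : ΨRel Ψ} {E} →
            (∀ {Ψ′} (ψ : Ψ′ ⇒ Ψ) → lookup ψ x ≡ 𝟎 → CPERs (α ψ)) → CPERs β → CPER (Vᴿ x α β E)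
  Vᴿ-cper a b (vinᴿ n m e) = linked (vinᴿ n m e)
    (λ { (vinᴿ n′ m′ e′) → vinᴿ (B.transᵀ n n′) (λ ψ h → TmPER.transᵀ (a ψ h) (m ψ h) (m′ ψ h)) e })
    (λ { (vinᴿ n′ m′ e′) → vinᴿ (B.symᵀ n) (λ ψ h → TmPER.symᵀ (a ψ h) (m ψ h)) e′ })
    where module B = TmPER b

  Lift-cper : ∀ {Ψ} {R : Relations.Rel lzero Ψ} → Elements.CPER lzero R → CPER (λ M N → Lift ℓ (R M N))
  Lift-cper c (liftᴸ r) = linked (liftᴸ r)
    (λ s → liftᴸ (Elements.Linked.tr (c r) (Lift.lower s)))
    (λ s → liftᴸ (Elements.Linked.csym (c r) (Lift.lower s)))

-- Replacing A by A′ and B by B′ inside a type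

-- A type built from A and B, up to bound names and variables; other arguments are ignored.
data Shape : Set where
  atA atB : Shape
  Πˢ Σˢ   : Shape → Shape → Shape
  Pathˢ   : Shape → Shape

contrˢ : Shape → Shape
contrˢ s = Σˢ s (Πˢ s (Πˢ s (Pathˢ s)))

equivˢ : Shape
equivˢ = Σˢ (Πˢ atA atB) (Πˢ atB (contrˢ (Σˢ atA (Pathˢ atB))))

-- Rep s ψ X X′: X has shape s over Aψ and Bψ, and X′ is X with A′ψ and B′ψ in their place.
data Rep {Ψ₀} (A A′ B B′ : Term Ψ₀ 0) : Shape → ∀ {Ψ m} → Ψ ⇒ Ψ₀ → Term Ψ m → Term Ψ m → Set where
  repA    : ∀ {Ψ m} {ψ : Ψ ⇒ Ψ₀} {X X′ : Term Ψ m} → X ≡ act ψ [] A → X′ ≡ act ψ [] A′ →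
            Rep A A′ B B′ atA ψ X X′
  repB    : ∀ {Ψ m} {ψ : Ψ ⇒ Ψ₀} {X X′ : Term Ψ m} → X ≡ act ψ [] B → X′ ≡ act ψ [] B′ →
            Rep A A′ B B′ atB ψ X X′
  repΠ    : ∀ {s t Ψ m} {ψ : Ψ ⇒ Ψ₀} {X X′ : Term Ψ m} {Y Y′} → Rep A A′ B B′ s ψ X X′ →
            Rep A A′ B B′ t ψ Y Y′ → Rep A A′ B B′ (Πˢ s t) ψ (Πᵗ X Y) (Πᵗ X′ Y′)
  repΣ    : ∀ {s t Ψ m} {ψ : Ψ ⇒ Ψ₀} {X X′ : Term Ψ m} {Y Y′} → Rep A A′ B B′ s ψ X X′ →
            Rep A A′ B B′ t ψ Y Y′ → Rep A A′ B B′ (Σˢ s t) ψ (Σᵗ X Y) (Σᵗ X′ Y′)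
  repPath : ∀ {s Ψ m} {ψ : Ψ ⇒ Ψ₀} {X X′ : Term (suc Ψ) m} {P Q} → Rep A A′ B B′ s (ψ ⨾ wkₛ) X X′ →
            Rep A A′ B B′ (Pathˢ s) ψ (Pathᵗ X P Q) (Pathᵗ X′ P Q)

module _ {Ψ₀} {A A′ B B′ : Term Ψ₀ 0} where

  wk-lift : ∀ {Ψ Ψ′} (ψ : Ψ ⇒ Ψ₀) (χ : Ψ′ ⇒ Ψ) → (ψ ⨾ wkₛ) ⨾ lift χ ≡ (ψ ⨾ χ) ⨾ wkₛ
  wk-lift ψ χ = trans (⨾-assoc ψ wkₛ (lift χ))
    (trans (cong (ψ ⨾_) (wkₛ-∷ (name zero) (map wkᵈ χ))) (sym (⨾-assoc ψ χ wkₛ)))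

  Rep-act : ∀ {s Ψ Ψ′ m m′} {ψ : Ψ ⇒ Ψ₀} {X X′ : Term Ψ m} (χ : Ψ′ ⇒ Ψ) (ρ : Vec (Fin m′) m) →
            Rep A A′ B B′ s ψ X X′ → Rep A A′ B B′ s (ψ ⨾ χ) (act χ ρ X) (act χ ρ X′)
  Rep-act {ψ = ψ} χ ρ (repA refl refl) = repA (act-act ψ χ [] ρ A) (act-act ψ χ [] ρ A′)
  Rep-act {ψ = ψ} χ ρ (repB refl refl) = repB (act-act ψ χ [] ρ B) (act-act ψ χ [] ρ B′)
  Rep-act χ ρ (repΠ x y) = repΠ (Rep-act χ ρ x) (Rep-act χ _ y)
  Rep-act χ ρ (repΣ x y) = repΣ (Rep-act χ ρ x) (Rep-act χ _ y)
  Rep-act {ψ = ψ} χ ρ (repPath x) =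
    repPath (subst (λ ω → Rep A A′ B B′ _ ω _ _) (wk-lift ψ χ) (Rep-act (lift χ) ρ x))

  -- The four parameters have no free term variables. A substitution therefore affects only path
  -- endpoints, and those equally on both sides.
  Rep-sub : ∀ {s Ψ m m′} {ψ : Ψ ⇒ Ψ₀} {X X′ : Term Ψ m} (θ : Vec (Term Ψ m′) m) →
            Rep A A′ B B′ s ψ X X′ → Rep A A′ B B′ s ψ (sub θ X) (sub θ X′)
  Rep-sub {ψ = ψ} θ (repA refl refl) = repA (sub-act ψ θ [] [] (λ ()) A) (sub-act ψ θ [] [] (λ ()) A′)
  Rep-sub {ψ = ψ} θ (repB refl refl) = repB (sub-act ψ θ [] [] (λ ()) B) (sub-act ψ θ [] [] (λ ()) B′)
  Rep-sub θ (repΠ x y)  = repΠ (Rep-sub θ x) (Rep-sub _ y)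
  Rep-sub θ (repΣ x y)  = repΣ (Rep-sub θ x) (Rep-sub _ y)
  Rep-sub θ (repPath x) = repPath (Rep-sub _ x)

  Rep-wkᵛ : ∀ {s Ψ m} {ψ : Ψ ⇒ Ψ₀} {X X′ : Term Ψ m} →
            Rep A A′ B B′ s ψ X X′ → Rep A A′ B B′ s ψ (wkᵛ X) (wkᵛ X′)
  Rep-wkᵛ {ψ = ψ} x = subst (λ ω → Rep A A′ B B′ _ ω _ _) (⨾-idʳ ψ) (Rep-act idₛ _ x)

  Rep-isContr : ∀ {s Ψ m} {ψ : Ψ ⇒ Ψ₀} {X X′ : Term Ψ m} →
                Rep A A′ B B′ s ψ X X′ → Rep A A′ B B′ (contrˢ s) ψ (isContr X) (isContr X′)
  Rep-isContr x =
    -- The endpoints are given explicitly because the goal contains them only under `wkᵛ`, which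
    -- does not determine them.
    repΣ x (Rep-wkᵛ (repΠ x (repΠ (Rep-wkᵛ x) (repPath {P = var (suc zero)} {var zero} (Rep-act wkₛ _ (Rep-wkᵛ (Rep-wkᵛ x)))))))

  Rep-Equiv : Rep A A′ B B′ equivˢ idₛ (Equiv A B) (Equiv A′ B′)
  Rep-Equiv =
    repΣ (repΠ a (Rep-wkᵛ b))
         (repΠ (Rep-wkᵛ b) (Rep-isContr
           (repΣ (Rep-wkᵛ (Rep-wkᵛ a)) (repPath (Rep-act wkₛ _ (Rep-wkᵛ (Rep-wkᵛ (Rep-wkᵛ b))))))))
    where
    a : Rep A A′ B B′ atA idₛ A A′
    a = repA (sym (act-id A)) (sym (act-id A′))
    b : Rep A A′ B B′ atB idₛ B B′
    b = repB (sym (act-id B)) (sym (act-id B′))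

-- Type systems over an interpretation of the universes

module _ (ℓ : Level) where

  open Relations ℓ
  open System ℓ
  open Elements ℓ

  -- All that the closure argument needs to know about the smaller universes. It is established for
  -- each finite stage by `universal`.
  record Universal (ν : Cand) : Set (lsuc (lsuc ℓ)) where
    field
      ν-fun  : ∀ {Ψ A B C φ χ} → ν Ψ A B φ → ν Ψ A C χ → φ ≃ χ
      ν-resp : ∀ {Ψ A B φ χ} → χ ≃ φ → ν Ψ A B φ → ν Ψ A B χ
      ν-cper : ∀ {Ψ A B φ} → ν Ψ A B φ → CPER φ
      ν-mono : ∀ {Ψ Ψ′ κ j φ} → ν Ψ (U κ j) (U κ j) φ → ∃ λ χ → ν Ψ′ (U κ j) (U κ j) χ

module Closure (ℓ : Level) (ν : System.Cand ℓ) where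

  open Relations ℓ
  open System ℓ

  τ : Kind → Cand
  τ κ = system κ ν

  rollFun : ∀ κ {Ψ A B φ} → Fun (τ κ) Ψ A B φ → τ κ Ψ A B φ
  rollFun pre d = roll (inFun d)
  rollFun Kan d = roll (inFun d)

  rollPair : ∀ κ {Ψ A B φ} → Pair (τ κ) Ψ A B φ → τ κ Ψ A B φ
  rollPair pre d = roll (inPair d)
  rollPair Kan d = roll (inPair d)

  rollPath : ∀ κ {Ψ A B φ} → Path (τ κ) Ψ A B φ → τ κ Ψ A B φ
  rollPath pre d = roll (inPath d)
  rollPath Kan d = roll (inPath d)

  rollV : ∀ κ {Ψ A B φ} → VTy (τ κ) Ψ A B φ → τ κ Ψ A B φ
  rollV pre d = roll (inV d)
  rollV Kan d = roll (inV d)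

  rollFcom : ∀ κ {Ψ A B φ} → Fcom (τ Kan) Ψ A B φ → τ κ Ψ A B φ
  rollFcom pre d = roll (inFcom d)
  rollFcom Kan d = roll (inFcom d)

  rollVoid : ∀ κ {Ψ A B φ} → Void Ψ A B φ → τ κ Ψ A B φ
  rollVoid pre d = roll (inVoid d)
  rollVoid Kan d = roll (inVoid d)

  rollNat : ∀ κ {Ψ A B φ} → Nat Ψ A B φ → τ κ Ψ A B φ
  rollNat pre d = roll (inNat d)
  rollNat Kan d = roll (inNat d)

  rollBool : ∀ κ {Ψ A B φ} → BoolTy Ψ A B φ → τ κ Ψ A B φ
  rollBool pre d = roll (inBool d)
  rollBool Kan d = roll (inBool d)

  rollWB : ∀ κ {Ψ A B φ} → WB Ψ A B φ → τ κ Ψ A B φ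
  rollWB pre d = roll (inWB d)
  rollWB Kan d = roll (inWB d)

  rollCirc : ∀ κ {Ψ A B φ} → Circ Ψ A B φ → τ κ Ψ A B φ
  rollCirc pre d = roll (inCirc d)
  rollCirc Kan d = roll (inCirc d)

  rollUKan : ∀ κ {Ψ A B φ} → UKan ν Ψ A B φ → τ κ Ψ A B φ
  rollUKan pre d = roll (inUKan d)
  rollUKan Kan d = roll (inUKan d)

  -- Inversion works because each head of a left-hand type is introduced by exactly one operator.
  outFun : ∀ κ {Ψ A B C φ} → τ κ Ψ (Πᵗ A B) C φ → Fun (τ κ) Ψ (Πᵗ A B) C φ
  outFun pre (roll (inFun d)) = d
  outFun Kan (roll (inFun d)) = d

  outPair : ∀ κ {Ψ A B C φ} → τ κ Ψ (Σᵗ A B) C φ → Pair (τ κ) Ψ (Σᵗ A B) C φ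
  outPair pre (roll (inPair d)) = d
  outPair Kan (roll (inPair d)) = d

  outPath : ∀ κ {Ψ A M N C φ} → τ κ Ψ (Pathᵗ A M N) C φ → Path (τ κ) Ψ (Pathᵗ A M N) C φ
  outPath pre (roll (inPath d)) = d
  outPath Kan (roll (inPath d)) = d

  outEq : ∀ {Ψ A M N C φ} → τ pre Ψ (Eqᵗ A M N) C φ → Eq (τ pre) Ψ (Eqᵗ A M N) C φ
  outEq (roll (inEq d)) = d

  outV : ∀ κ {Ψ r A B E C φ} → τ κ Ψ (V r A B E) C φ → VTy (τ κ) Ψ (V r A B E) C φ
  outV pre (roll (inV d)) = d
  outV Kan (roll (inV d)) = d

  outFcom : ∀ κ {Ψ k r r′ A} {ξ : Vec (Eqn Ψ) k} {B C φ} → τ κ Ψ (fcom r r′ A ξ B) C φ →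
            Fcom (τ Kan) Ψ (fcom r r′ A ξ B) C φ
  outFcom pre (roll (inFcom d)) = d
  outFcom Kan (roll (inFcom d)) = d

  outVoid : ∀ κ {Ψ C φ} → τ κ Ψ voidᵗ C φ → Void Ψ voidᵗ C φ
  outVoid pre (roll (inVoid d)) = d
  outVoid Kan (roll (inVoid d)) = d

  outNat : ∀ κ {Ψ C φ} → τ κ Ψ natᵗ C φ → Nat Ψ natᵗ C φ
  outNat pre (roll (inNat d)) = d
  outNat Kan (roll (inNat d)) = d

  outBool : ∀ κ {Ψ C φ} → τ κ Ψ boolᵗ C φ → BoolTy Ψ boolᵗ C φ
  outBool pre (roll (inBool d)) = d
  outBool Kan (roll (inBool d)) = d

  outWB : ∀ κ {Ψ C φ} → τ κ Ψ wboolᵗ C φ → WB Ψ wboolᵗ C φ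
  outWB pre (roll (inWB d)) = d
  outWB Kan (roll (inWB d)) = d

  outCirc : ∀ κ {Ψ C φ} → τ κ Ψ S¹ᵗ C φ → Circ Ψ S¹ᵗ C φ
  outCirc pre (roll (inCirc d)) = d
  outCirc Kan (roll (inCirc d)) = d

  outUKan : ∀ κ {Ψ j C φ} → τ κ Ψ (U Kan j) C φ → UKan ν Ψ (U Kan j) C φ
  outUKan pre (roll (inUKan d)) = d
  outUKan Kan (roll (inUKan d)) = d

  outUPre : ∀ {Ψ j C φ} → τ pre Ψ (U pre j) C φ → UPre ν Ψ (U pre j) C φ
  outUPre (roll (inUPre d)) = d

-- Functionality, transitivity and conditional symmetry of type equality

module Goodness (ℓ : Level) (ν : System.Cand ℓ) (univ : Universal ℓ ν) where

  open Relations ℓ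
  open System ℓ
  open Elements ℓ
  open Types ℓ
  open ElementRelations ℓ
  open Universal univ
  open Closure ℓ ν public

  respFun : ∀ {σ Ψ A B φ χ} → χ ≃ φ → Fun σ Ψ A B φ → Fun σ Ψ A B χ
  respFun e (funᵀ α β a ca b cb e′) = funᵀ α β a ca b cb (≃-trans e e′)

  respPair : ∀ {σ Ψ A B φ χ} → χ ≃ φ → Pair σ Ψ A B φ → Pair σ Ψ A B χ
  respPair e (pairᵀ α β a ca b cb e′) = pairᵀ α β a ca b cb (≃-trans e e′)

  respPath : ∀ {σ Ψ A B φ χ} → χ ≃ φ → Path σ Ψ A B φ → Path σ Ψ A B χ
  respPath e (pathᵀ α a ca p e′) = pathᵀ α a ca p (≃-trans e e′)

  respV : ∀ {σ Ψ A B φ χ} → χ ≃ φ → VTy σ Ψ A B φ → VTy σ Ψ A B χ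
  respV e (vᵀ β α η b cb a ca q t e′) = vᵀ β α η b cb a ca q t (≃-trans e e′)

  respFcom : ∀ {σ Ψ A B φ χ} → χ ≃ φ → Fcom σ Ψ A B φ → Fcom σ Ψ A B χ
  respFcom e (fcomᵀ α β v a ca b cb s e′) = fcomᵀ α β v a ca b cb s (≃-trans e e′)

  -- Each operator specifies its relation only up to `_≃_`, so the last component of a derivation
  -- absorbs the change and there is no recursion.
  τ-resp : ∀ κ {Ψ A B φ χ} → χ ≃ φ → τ κ Ψ A B φ → τ κ Ψ A B χ
  τ-resp pre e (roll (inFun d))                   = roll (inFun (respFun e d))
  τ-resp pre e (roll (inPair d))                  = roll (inPair (respPair e d))
  τ-resp pre e (roll (inPath d))                  = roll (inPath (respPath e d))
  τ-resp pre e (roll (inEq (eqᵀ α a ca m n e′)))  = roll (inEq (eqᵀ α a ca m n (≃-trans e e′)))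
  τ-resp pre e (roll (inV d))                     = roll (inV (respV e d))
  τ-resp pre e (roll (inFcom d))                  = roll (inFcom (respFcom e d))
  τ-resp pre e (roll (inVoid (voidᵀ e′)))         = roll (inVoid (voidᵀ (≃-trans e e′)))
  τ-resp pre e (roll (inNat (natᵀ e′)))           = roll (inNat (natᵀ (≃-trans e e′)))
  τ-resp pre e (roll (inBool (boolᵀ e′)))         = roll (inBool (boolᵀ (≃-trans e e′)))
  τ-resp pre e (roll (inWB (wboolᵀ e′)))          = roll (inWB (wboolᵀ (≃-trans e e′)))
  τ-resp pre e (roll (inCirc (S¹ᵀ e′)))           = roll (inCirc (S¹ᵀ (≃-trans e e′)))
  τ-resp pre e (roll (inUPre (upreᵀ u)))          = roll (inUPre (upreᵀ (ν-resp e u)))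
  τ-resp pre e (roll (inUKan (ukanᵀ u)))          = roll (inUKan (ukanᵀ (ν-resp e u)))
  τ-resp Kan e (roll (inFun d))                   = roll (inFun (respFun e d))
  τ-resp Kan e (roll (inPair d))                  = roll (inPair (respPair e d))
  τ-resp Kan e (roll (inPath d))                  = roll (inPath (respPath e d))
  τ-resp Kan e (roll (inV d))                     = roll (inV (respV e d))
  τ-resp Kan e (roll (inFcom d))                  = roll (inFcom (respFcom e d))
  τ-resp Kan e (roll (inVoid (voidᵀ e′)))         = roll (inVoid (voidᵀ (≃-trans e e′)))
  τ-resp Kan e (roll (inNat (natᵀ e′)))           = roll (inNat (natᵀ (≃-trans e e′)))
  τ-resp Kan e (roll (inBool (boolᵀ e′)))         = roll (inBool (boolᵀ (≃-trans e e′)))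
  τ-resp Kan e (roll (inWB (wboolᵀ e′)))          = roll (inWB (wboolᵀ (≃-trans e e′)))
  τ-resp Kan e (roll (inCirc (S¹ᵀ e′)))           = roll (inCirc (S¹ᵀ (≃-trans e e′)))
  τ-resp Kan e (roll (inUKan (ukanᵀ u)))          = roll (inUKan (ukanᵀ (ν-resp e u)))

  Goodτ : Kind → Cand
  Goodτ κ = Good (τ κ)

  module _ (κ : Kind) where

    open PTyGood (λ {Ψ} {A} {B} {φ} {χ} → τ-resp κ {Ψ} {A} {B} {φ} {χ})

    -- Common ground of Π and Σ types. Nothing in the definition links the relations `β ψ M M′` at
    -- different arguments; functionality in the left-hand and in the right-hand type shows that
    -- they depend only on the class of `M`.
    module Telescope {Ψ A A′} B B′ {α : ΨRel Ψ} {β : Fam Ψ} (a : PTy (Goodτ κ) Ψ A A′ α)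
      (b : ∀ {Ψ′} (ψ : Ψ′ ⇒ Ψ) M M′ → Tm (α · ψ) M M′ →
           PTy (Goodτ κ) Ψ′ (B ⟪ ψ ⟫ [ M ]) (B′ ⟪ ψ ⟫ [ M′ ]) (β ψ M M′))
      (cb : ∀ {Ψ′} (ψ : Ψ′ ⇒ Ψ) M M′ → Tm (α · ψ) M M′ → Coh (β ψ M M′)) where

      private
        module Q {Ψ′} (ψ : Ψ′ ⇒ Ψ) = TmPER (CPERs-· (cperᴾ a) ψ)

      βˡ : ∀ {Ψ′} (ψ : Ψ′ ⇒ Ψ) {M M′ M″} → Tm (α · ψ) M M′ → Tm (α · ψ) M M″ → β ψ M M′ ≃ₛ β ψ M M″
      βˡ ψ t u = funᴾ (b ψ _ _ t) (relᴾ (b ψ _ _ u))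

      βʳ : ∀ {Ψ′} (ψ : Ψ′ ⇒ Ψ) {M M′ M″} → Tm (α · ψ) M M′ → Tm (α · ψ) M″ M′ → β ψ M M′ ≃ₛ β ψ M″ M′
      βʳ ψ t u = funʳᴾ (b ψ _ _ t) (symᴾ (b ψ _ _ u))

      flip : ∀ {Ψ′} (ψ : Ψ′ ⇒ Ψ) M M′ → Tm (α · ψ) M M′ → β ψ M M′ ≃ₛ β ψ M′ M
      flip ψ M M′ t = ≃ₛ-trans (βʳ ψ t (Q.reflʳ ψ t)) (βˡ ψ (Q.reflʳ ψ t) (Q.symᵀ ψ t))

      b-cper : ∀ {Ψ′} (ψ : Ψ′ ⇒ Ψ) {M M′} → Tm (α · ψ) M M′ → CPERs (β ψ M M′)
      b-cper ψ t = cperᴾ (b ψ _ _ t)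

      b-rel : ∀ {Ψ′} (ψ : Ψ′ ⇒ Ψ) M M′ → Tm (α · ψ) M M′ →
              PTy (τ κ) Ψ′ (B ⟪ ψ ⟫ [ M ]) (B′ ⟪ ψ ⟫ [ M′ ]) (β ψ M M′)
      b-rel ψ M M′ t = relᴾ (b ψ M M′ t)

      b-sym : ∀ {Ψ′} (ψ : Ψ′ ⇒ Ψ) M M′ → Tm (α · ψ) M M′ →
              PTy (τ κ) Ψ′ (B′ ⟪ ψ ⟫ [ M ]) (B ⟪ ψ ⟫ [ M′ ]) (β ψ M′ M)
      b-sym ψ M M′ t = symᴾ (b ψ M′ M (Q.symᵀ ψ t))

      coh-sym : ∀ {Ψ′} (ψ : Ψ′ ⇒ Ψ) M M′ → Tm (α · ψ) M M′ → Coh (β ψ M′ M)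
      coh-sym ψ M M′ t = cb ψ M′ M (Q.symᵀ ψ t)

      coh-tr : ∀ {Ψ′} (ψ : Ψ′ ⇒ Ψ) M M′ → Tm (α · ψ) M M′ → Coh (β ψ M M)
      coh-tr ψ M M′ t = cb ψ M M (Q.reflˡ ψ t)

      module _ {A″} B″ {α′ : ΨRel Ψ} {β′ : Fam Ψ} (a′ : PTy (τ κ) Ψ A′ A″ α′)
        (b′ : ∀ {Ψ′} (ψ : Ψ′ ⇒ Ψ) M M′ → Tm (α′ · ψ) M M′ →
              PTy (τ κ) Ψ′ (B′ ⟪ ψ ⟫ [ M ]) (B″ ⟪ ψ ⟫ [ M′ ]) (β′ ψ M M′)) where

        -- The middle type is `B′ ⟪ ψ ⟫ [ M ]`, so the first family is used at `M`, `M`; this is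
        -- where the relation `β ψ M M` comes from.
        b-tr : ∀ {Ψ′} (ψ : Ψ′ ⇒ Ψ) M M′ → Tm (α · ψ) M M′ →
               PTy (τ κ) Ψ′ (B ⟪ ψ ⟫ [ M ]) (B″ ⟪ ψ ⟫ [ M′ ]) (β ψ M M)
        b-tr ψ M M′ t = trᴾ (b ψ M M (Q.reflˡ ψ t)) (b′ ψ M M′ (Tm-≃ (·-≃ₛ (funʳᴾ a a′) ψ) t))

      module _ {A″} B″ {α′ : ΨRel Ψ} {β′ : Fam Ψ} (a′ : PTy (τ κ) Ψ A A″ α′)
        (b′ : ∀ {Ψ′} (ψ : Ψ′ ⇒ Ψ) M M′ → Tm (α′ · ψ) M M′ →
              PTy (τ κ) Ψ′ (B ⟪ ψ ⟫ [ M ]) (B″ ⟪ ψ ⟫ [ M′ ]) (β′ ψ M M′)) where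

        b-fun : Agree α β β′
        b-fun ψ M M′ t = funᴾ (b ψ M M′ t) (b′ ψ M M′ (Tm-≃ (·-≃ₛ (funᴾ a a′) ψ) t))

      -- Transitivity passes through the middle function at the left argument `M`. Symmetry applies
      -- the hypothesis to the swapped arguments, and `flip` brings the result back to `β ψ M M′`.
      Funᴿ-cper : CPER (Funᴿ α β)
      Funᴿ-cper (lamᴿ n) = linked (lamᴿ n)
        (λ { (lamᴿ n′) → lamᴿ λ ψ M M′ t → TmPER.transᵀ (b-cper ψ t)
               (Tm-≃ (βˡ ψ (Q.reflˡ ψ t) t) (n ψ M M (Q.reflˡ ψ t))) (n′ ψ M M′ t) })
        (λ _ → lamᴿ λ ψ M M′ t → TmPER.symᵀ (b-cper ψ t)
               (Tm-≃ (≃ₛ-sym (flip ψ M M′ t)) (n ψ M′ M (Q.symᵀ ψ t))))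

      Pairᴿ-cper : CPER (Pairᴿ α β)
      Pairᴿ-cper (pairᴿ {M} {M′} m n) = linked (pairᴿ m n)
        (λ { (pairᴿ m′ n′) → let t′ = atId m′ in
               pairᴿ (A.transᵀ m m′) (TmPER.transᵀ (b-cper idₛ (Q.transᵀ idₛ t t′))
                 (Tm-≃ (βˡ idₛ t (Q.transᵀ idₛ t t′)) n)
                 (Tm-≃ (βʳ idₛ t′ (Q.transᵀ idₛ t t′)) n′)) })
        (λ _ → pairᴿ (A.symᵀ m) (Tm-≃ (flip idₛ M M′ t) (TmPER.symᵀ (b-cper idₛ t) n)))
        where
        module A = TmPER (cperᴾ a)
        atId : ∀ {M M′} → Tm α M M′ → Tm (α · idₛ) M M′
        atId = Tm-≃ (≃ₛ-sym (·-id α))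
        t = atId m

    -- Here, as for Σ, Path and Eq, all premises can be reversed outright, in contrast to V and
    -- fcom. Reflexivity on the right will be derived from this.
    sym-Fun : ∀ {Ψ A B φ} → Fun (Goodτ κ) Ψ A B φ → ∃ λ ω → τ κ Ψ B A ω
    sym-Fun (funᵀ {B = B} {B′} α β a ca b cb e) =
      _ , rollFun κ (funᵀ α (λ ψ M M′ → β ψ M′ M) (symᴾ a) ca T.b-sym T.coh-sym ≃-refl)
      where module T = Telescope B B′ a b cb

    good-Fun : ∀ {Ψ A B φ} → Fun (Goodτ κ) Ψ A B φ → Good (τ κ) Ψ A B φ
    good-Fun (funᵀ {B = B} {B′} α β a ca b cb e) = good
      (rollFun κ (funᵀ α β (relᴾ a) ca T.b-rel cb e))
      (λ r → case-fun (outFun κ r))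
      (λ r → case-tr (outFun κ r))
      (λ _ → sym-Fun (funᵀ α β a ca b cb e))
      (CPER-≃ e T.Funᴿ-cper)
      where
      module T = Telescope B B′ a b cb
      case-fun : ∀ {C χ} → Fun (τ κ) _ (Πᵗ _ _) C χ → _ ≃ χ
      case-fun (funᵀ {B′ = B″} α′ β′ a′ ca′ b′ cb′ e′) =
        ≃-trans e (≃-trans (Funᴿ-≃ (funᴾ a a′) (T.b-fun B″ a′ b′)) (≃-sym e′))
      case-tr : ∀ {C χ} → Fun (τ κ) _ (Πᵗ _ _) C χ → ∃ λ ω → τ κ _ (Πᵗ _ _) C ω
      case-tr (funᵀ {B′ = B″} α′ β′ a′ ca′ b′ cb′ e′) = _ , rollFun κ
        (funᵀ α (λ ψ M M′ → β ψ M M) (trᴾ a a′) ca (T.b-tr B″ a′ b′) T.coh-tr ≃-refl)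

    sym-Pair : ∀ {Ψ A B φ} → Pair (Goodτ κ) Ψ A B φ → ∃ λ ω → τ κ Ψ B A ω
    sym-Pair (pairᵀ {B = B} {B′} α β a ca b cb e) =
      _ , rollPair κ (pairᵀ α (λ ψ M M′ → β ψ M′ M) (symᴾ a) ca T.b-sym T.coh-sym ≃-refl)
      where module T = Telescope B B′ a b cb

    good-Pair : ∀ {Ψ A B φ} → Pair (Goodτ κ) Ψ A B φ → Good (τ κ) Ψ A B φ
    good-Pair (pairᵀ {B = B} {B′} α β a ca b cb e) = good
      (rollPair κ (pairᵀ α β (relᴾ a) ca T.b-rel cb e))
      (λ r → case-fun (outPair κ r))
      (λ r → case-tr (outPair κ r))
      (λ _ → sym-Pair (pairᵀ α β a ca b cb e))
      (CPER-≃ e T.Pairᴿ-cper)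
      where
      module T = Telescope B B′ a b cb
      case-fun : ∀ {C χ} → Pair (τ κ) _ (Σᵗ _ _) C χ → _ ≃ χ
      case-fun (pairᵀ {B′ = B″} α′ β′ a′ ca′ b′ cb′ e′) =
        ≃-trans e (≃-trans (Pairᴿ-≃ (funᴾ a a′) (T.b-fun B″ a′ b′)) (≃-sym e′))
      case-tr : ∀ {C χ} → Pair (τ κ) _ (Σᵗ _ _) C χ → ∃ λ ω → τ κ _ (Σᵗ _ _) C ω
      case-tr (pairᵀ {B′ = B″} α′ β′ a′ ca′ b′ cb′ e′) = _ , rollPair κ
        (pairᵀ α (λ ψ M M′ → β ψ M M) (trᴾ a a′) ca (T.b-tr B″ a′ b′) T.coh-tr ≃-refl)

    sym-Path : ∀ {Ψ A B φ} → Path (Goodτ κ) Ψ A B φ → ∃ λ ω → τ κ Ψ B A ω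
    sym-Path (pathᵀ α a ca p e) = _ , rollPath κ
      (pathᵀ α (symᴾ a) ca (λ ε → TmPER.symᵀ (CPERs-· (cperᴾ a) (const ε ∷ idₛ)) (p ε)) ≃-refl)

    good-Path : ∀ {Ψ A B φ} → Path (Goodτ κ) Ψ A B φ → Good (τ κ) Ψ A B φ
    good-Path {Ψ} (pathᵀ {P₀ = P₀} {P₁} α a ca p e) = good
      (rollPath κ (pathᵀ α (relᴾ a) ca p e))
      (λ r → case-fun (outPath κ r))
      (λ r → case-tr (outPath κ r))
      (λ _ → sym-Path (pathᵀ α a ca p e))
      (CPER-≃ e (Pathᴿ-cper (cperᴾ a)))
      where
      module Q ε = TmPER (CPERs-· (cperᴾ a) (const ε ∷ idₛ))
      case-fun : ∀ {C χ} → Path (τ κ) _ (Pathᵗ _ P₀ P₁) C χ → _ ≃ χ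
      case-fun (pathᵀ α′ a′ ca′ p′ e′) = ≃-trans e (≃-trans (Pathᴿ-≃ (funᴾ a a′)) (≃-sym e′))
      case-tr : ∀ {C χ} → Path (τ κ) _ (Pathᵗ _ _ _) C χ → ∃ λ ω → τ κ _ (Pathᵗ _ _ _) C ω
      case-tr (pathᵀ α′ a′ ca′ p′ e′) = _ , rollPath κ (pathᵀ α (trᴾ a a′) ca
        (λ ε → Q.transᵀ ε (p ε) (Tm-≃ (≃ₛ-sym (·-≃ₛ (funʳᴾ a a′) (const ε ∷ idₛ))) (p′ ε))) ≃-refl)

    -- Derivations are inverted one layer at a time, along the shape. Since the relation `γ` never
    -- changes, all premises about coherence and about elements carry over as they are.
    module Replacement {Ψ₀} {A A′ B B′ : Term Ψ₀ 0}
      (replaceA : ∀ {Ψ} (ψ : Ψ ⇒ Ψ₀) {γ : ΨRel Ψ} →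
                  PTy (τ κ) Ψ (A ⟪ ψ ⟫) (A ⟪ ψ ⟫) γ → PTy (τ κ) Ψ (A′ ⟪ ψ ⟫) (A′ ⟪ ψ ⟫) γ)
      (replaceB : ∀ {Ψ} (ψ : Ψ ⇒ Ψ₀) {γ : ΨRel Ψ} →
                  PTy (τ κ) Ψ (B ⟪ ψ ⟫) (B ⟪ ψ ⟫) γ → PTy (τ κ) Ψ (B′ ⟪ ψ ⟫) (B′ ⟪ ψ ⟫) γ) where

      Replaces : Shape → Set (lsuc ℓ)
      Replaces s = ∀ {Ψ} {ψ : Ψ ⇒ Ψ₀} {X X′ Y Y′} → Rep A A′ B B′ s ψ X X′ → Rep A A′ B B′ s ψ Y Y′ →
        ∀ {γ : ΨRel Ψ} → PTy (τ κ) Ψ X Y γ → PTy (τ κ) Ψ X′ Y′ γ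

      ReplacesValues : Shape → Set (lsuc ℓ)
      ReplacesValues s = ∀ {Ψ} {ψ : Ψ ⇒ Ψ₀} {X X′ Y Y′} → Rep A A′ B B′ s ψ X X′ → Rep A A′ B B′ s ψ Y Y′ →
        ∀ {φ : Rel Ψ} → τ κ Ψ X Y φ → τ κ Ψ X′ Y′ φ

      AreValues : Shape → Set
      AreValues s = ∀ {Ψ} {ψ : Ψ ⇒ Ψ₀} {X X′} → Rep A A′ B B′ s ψ X X′ → Val X × Val X′

      -- Compound shapes are values and remain so under substitution, which makes every evaluation
      -- inside `PTy` trivial.
      lift-values : ∀ {s} → AreValues s → ReplacesValues s → Replaces s
      lift-values {s} val f {X = X} {X′} {Y} {Y′} x y {γ} (mkPTy t c) = mkPTy
        (λ ψ → ev (Rep-act ψ _ x) (Rep-act ψ _ y) (t ψ)) coherent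
        where
        ev : ∀ {Ψ} {ψ : Ψ ⇒ Ψ₀} {X X′ Y Y′} → Rep A A′ B B′ s ψ X X′ → Rep A A′ B B′ s ψ Y Y′ →
             ∀ {φ} → EvalTy (τ κ) Ψ X Y φ → EvalTy (τ κ) Ψ X′ Y′ φ
        ev x y (eval m n r) with refl ← value-⇓ (proj₁ (val x)) m | refl ← value-⇓ (proj₁ (val y)) n =
          eval (stop , proj₂ (val x)) (stop , proj₂ (val y)) (f x y r)

        coherent : ∀ {Ψ₁ Ψ₂} (ψ₁ : Ψ₁ ⇒ _) (ψ₂ : Ψ₂ ⇒ Ψ₁) → PTyAt (τ κ) X′ Y′ ψ₁ ψ₂
        coherent ψ₁ ψ₂ with ptyAt m n φ a b c′ d e ← c ψ₁ ψ₂
          with refl ← value-⇓ (proj₁ (val (Rep-act ψ₁ _ x))) m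
             | refl ← value-⇓ (proj₁ (val (Rep-act ψ₁ _ y))) n =
          ptyAt (stop , proj₂ (val x₁)) (stop , proj₂ (val y₁)) φ
                (ev x₂ x₂ a) (ev x₂ x₂ b) (ev y₂ y₂ c′) (ev y₂ y₂ d) (ev x₂ y₂ e)
          where
          x₁ = Rep-act ψ₁ (allFin 0) x
          y₁ = Rep-act ψ₁ (allFin 0) y
          x₂ = Rep-act ψ₂ (allFin 0) x₁
          y₂ = Rep-act ψ₂ (allFin 0) y₁

      replace : ∀ s → Replaces s
      replace atA (repA refl refl) (repA refl refl) = replaceA _
      replace atB (repB refl refl) (repB refl refl) = replaceB _
      replace (Πˢ s t) = lift-values (λ { (repΠ _ _) → Π-val , Π-val }) val
        where
        case : ∀ {Ψ} {ψ : Ψ ⇒ Ψ₀} {X X′ Y Y′ C C′ D D′} → Rep A A′ B B′ s ψ X X′ → Rep A A′ B B′ s ψ Y Y′ →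
               Rep A A′ B B′ t ψ C C′ → Rep A A′ B B′ t ψ D D′ →
               ∀ {φ} → Fun (τ κ) Ψ (Πᵗ X C) (Πᵗ Y D) φ → Fun (τ κ) Ψ (Πᵗ X′ C′) (Πᵗ Y′ D′) φ
        case x y c d (funᵀ α β a ca b cb e) = funᵀ α β (replace s x y a) ca
          (λ ψ M M′ t′ → replace t (Rep-sub (M ∷ []) (Rep-act ψ _ c)) (Rep-sub (M′ ∷ []) (Rep-act ψ _ d)) (b ψ M M′ t′))
          cb e
        val : ReplacesValues (Πˢ s t)
        val (repΠ x c) (repΠ y d) r = rollFun κ (case x y c d (outFun κ r))
      replace (Σˢ s t) = lift-values (λ { (repΣ _ _) → Σ-val , Σ-val }) val
        where
        case : ∀ {Ψ} {ψ : Ψ ⇒ Ψ₀} {X X′ Y Y′ C C′ D D′} → Rep A A′ B B′ s ψ X X′ → Rep A A′ B B′ s ψ Y Y′ →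
               Rep A A′ B B′ t ψ C C′ → Rep A A′ B B′ t ψ D D′ →
               ∀ {φ} → Pair (τ κ) Ψ (Σᵗ X C) (Σᵗ Y D) φ → Pair (τ κ) Ψ (Σᵗ X′ C′) (Σᵗ Y′ D′) φ
        case x y c d (pairᵀ α β a ca b cb e) = pairᵀ α β (replace s x y a) ca
          (λ ψ M M′ t′ → replace t (Rep-sub (M ∷ []) (Rep-act ψ _ c)) (Rep-sub (M′ ∷ []) (Rep-act ψ _ d)) (b ψ M M′ t′))
          cb e
        val : ReplacesValues (Σˢ s t)
        val (repΣ x c) (repΣ y d) r = rollPair κ (case x y c d (outPair κ r))
      replace (Pathˢ s) = lift-values (λ { (repPath _) → Path-val , Path-val }) val
        where
        case : ∀ {Ψ} {ψ : Ψ ⇒ Ψ₀} {X X′ Y Y′ P Q P′ Q′} →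
               Rep A A′ B B′ s (ψ ⨾ wkₛ) X X′ → Rep A A′ B B′ s (ψ ⨾ wkₛ) Y Y′ →
               ∀ {φ} → Path (τ κ) Ψ (Pathᵗ X P Q) (Pathᵗ Y P′ Q′) φ → Path (τ κ) Ψ (Pathᵗ X′ P Q) (Pathᵗ Y′ P′ Q′) φ
        case x y (pathᵀ α a ca p e) = pathᵀ α (replace s x y a) ca p e
        val : ReplacesValues (Pathˢ s)
        val (repPath x) (repPath y) r = rollPath κ (case x y (outPath κ r))

      replace-Equiv : ∀ {γ : ΨRel Ψ₀} → PTy (τ κ) Ψ₀ (Equiv A B) (Equiv A B) γ → PTy (τ κ) Ψ₀ (Equiv A′ B′) (Equiv A′ B′) γ
      replace-Equiv = replace equivˢ Rep-Equiv Rep-Equiv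

    replaceˡ : ∀ {Ψ A A′} {α γ : ΨRel Ψ} → PTy (Goodτ κ) Ψ A A′ α → PTy (τ κ) Ψ A′ A′ γ → PTy (τ κ) Ψ A A γ
    replaceˡ p q = PTy-resp (≃ₛ-sym (funʳᴾ p q)) (reflˡᴾ p)

    replaceʳ : ∀ {Ψ A A′} {α γ : ΨRel Ψ} → PTy (Goodτ κ) Ψ A A′ α → PTy (τ κ) Ψ A A γ → PTy (τ κ) Ψ A′ A′ γ
    replaceʳ p q = PTy-resp (≃ₛ-sym (funᴾ p q)) (reflʳᴾ p)

    module _ {Ψ A A′ B B′} {α β γ : ΨRel Ψ} (a : PTy (Goodτ κ) Ψ A A′ α) (b : PTy (Goodτ κ) Ψ B B′ β) where

      replaceˡ-Equiv : PTy (τ κ) Ψ (Equiv A′ B′) (Equiv A′ B′) γ → PTy (τ κ) Ψ (Equiv A B) (Equiv A B) γ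
      replaceˡ-Equiv = Replacement.replace-Equiv
        (λ ψ → replaceˡ (PTy-subst a ψ)) (λ ψ → replaceˡ (PTy-subst b ψ))

      replaceʳ-Equiv : PTy (τ κ) Ψ (Equiv A B) (Equiv A B) γ → PTy (τ κ) Ψ (Equiv A′ B′) (Equiv A′ B′) γ
      replaceʳ-Equiv = Replacement.replace-Equiv
        (λ ψ → replaceʳ (PTy-subst a ψ)) (λ ψ → replaceʳ (PTy-subst b ψ))

    -- `E ≐ E′` is stated at the relation of `Equiv A B`, and `E′ ≐ E″` at that of `Equiv A′ B′`;
    -- transitivity has to identify the two relations first. Symmetry in turn takes from the
    -- self-relatedness of the right-hand side that `Equiv A′ B′` is a type.
    good-V : ∀ {Ψ A B φ} → VTy (Goodτ κ) Ψ A B φ → Good (τ κ) Ψ A B φ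
    good-V {Ψ} (vᵀ {x} {A} {A′} {B} {B′} {E} {E′} β α η b cb a ca q t e) = good
      (rollV κ (vᵀ β α η (relᴾ b) cb (λ ψ h → relᴾ (a ψ h)) ca (λ ψ h → relᴾ (q ψ h)) t e))
      (λ r → case-fun (outV κ r))
      (λ r → case-tr (outV κ r))
      (λ r → case-csym (outV κ r))
      (CPER-≃ e (Vᴿ-cper (λ ψ h → cperᴾ (a ψ h)) (cperᴾ b)))
      where
      -- By functionality the relation of Equiv A′ B′ is that of Equiv A B.
      η≃ : ∀ {Ψ′} (ψ : Ψ′ ⇒ Ψ) → lookup ψ x ≡ 𝟎 → ∀ {η′ : ΨRel Ψ′} →
           PTy (τ κ) Ψ′ (Equiv (A′ ⟪ ψ ⟫) (B′ ⟪ ψ ⟫)) (Equiv (A′ ⟪ ψ ⟫) (B′ ⟪ ψ ⟫)) η′ → η ψ ≃ₛ η′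
      η≃ ψ h q′ = funᴾ (q ψ h) (replaceˡ-Equiv (a ψ h) (PTy-subst b ψ) q′)

      module Q {Ψ′} (ψ : Ψ′ ⇒ Ψ) (h : lookup ψ x ≡ 𝟎) = TmPER (cperᴾ (q ψ h))

      case-fun : ∀ {C χ} → VTy (τ κ) _ (V (name x) A B E) C χ → _ ≃ χ
      case-fun (vᵀ β′ α′ η′ b′ cb′ a′ ca′ q′ t′ e′) =
        ≃-trans e (≃-trans (Vᴿ-≃ (λ ψ h → funᴾ (a ψ h) (a′ ψ h)) (funᴾ b b′)) (≃-sym e′))

      case-tr : ∀ {C χ} → VTy (τ κ) _ (V (name x) A′ B′ E′) C χ → ∃ λ ω → τ κ _ (V (name x) A B E) C ω
      case-tr (vᵀ β′ α′ η′ b′ cb′ a′ ca′ q′ t′ e′) = _ , rollV κ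
        (vᵀ β α η (trᴾ b b′) cb (λ ψ h → trᴾ (a ψ h) (a′ ψ h)) ca (λ ψ h → relᴾ (q ψ h))
            (λ ψ h → Q.transᵀ ψ h (t ψ h) (Tm-≃ (≃ₛ-sym (η≃ ψ h (q′ ψ h))) (t′ ψ h))) ≃-refl)

      case-csym : ∀ {χ} → VTy (τ κ) _ (V (name x) A′ B′ E′) (V (name x) A′ B′ E′) χ →
                  ∃ λ ω → τ κ _ (V (name x) A′ B′ E′) (V (name x) A B E) ω
      case-csym (vᵀ β′ α′ η′ b′ cb′ a′ ca′ q′ t′ e′) = _ , rollV κ
        (vᵀ β α η′ (symᴾ b) cb (λ ψ h → symᴾ (a ψ h)) ca q′
            (λ ψ h → Tm-≃ (η≃ ψ h (q′ ψ h)) (Q.symᵀ ψ h (t ψ h))) ≃-refl)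

    -- With the same term on both sides, transitivity and symmetry hand back the derivation they are
    -- given.
    self-good : ∀ {Ψ A φ} → τ κ Ψ A A φ → (∀ {C χ} → τ κ Ψ A C χ → φ ≃ χ) → CPER φ → Good (τ κ) Ψ A A φ
    self-good r f c = good r f (_ ,_) (_ ,_) c

    good-Void : ∀ {Ψ A B φ} → Void Ψ A B φ → Good (τ κ) Ψ A B φ
    good-Void (voidᵀ e) = self-good (rollVoid κ (voidᵀ e)) (λ r → f (outVoid κ r)) (CPER-≃ e (λ ()))
      where
      f : ∀ {C χ} → Void _ voidᵗ C χ → _ ≃ χ
      f (voidᵀ e′) = ≃-trans e (≃-sym e′)

    good-Nat : ∀ {Ψ A B φ} → Nat Ψ A B φ → Good (τ κ) Ψ A B φ
    good-Nat (natᵀ e) = self-good (rollNat κ (natᵀ e)) (λ r → f (outNat κ r)) (CPER-≃ e (Lift-cper ℕ-cper))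
      where
      f : ∀ {C χ} → Nat _ natᵗ C χ → _ ≃ χ
      f (natᵀ e′) = ≃-trans e (≃-sym e′)

    good-Bool : ∀ {Ψ A B φ} → BoolTy Ψ A B φ → Good (τ κ) Ψ A B φ
    good-Bool (boolᵀ e) = self-good (rollBool κ (boolᵀ e)) (λ r → f (outBool κ r)) (CPER-≃ e (Lift-cper Bool-cper))
      where
      f : ∀ {C χ} → BoolTy _ boolᵗ C χ → _ ≃ χ
      f (boolᵀ e′) = ≃-trans e (≃-sym e′)

    good-WB : ∀ {Ψ A B φ} → WB Ψ A B φ → Good (τ κ) Ψ A B φ
    good-WB (wboolᵀ e) = self-good (rollWB κ (wboolᵀ e)) (λ r → f (outWB κ r)) (CPER-≃ e (Lift-cper 𝔹-cper))
      where
      f : ∀ {C χ} → WB _ wboolᵗ C χ → _ ≃ χ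
      f (wboolᵀ e′) = ≃-trans e (≃-sym e′)

    good-Circ : ∀ {Ψ A B φ} → Circ Ψ A B φ → Good (τ κ) Ψ A B φ
    good-Circ (S¹ᵀ e) = self-good (rollCirc κ (S¹ᵀ e)) (λ r → f (outCirc κ r)) (CPER-≃ e (Lift-cper ℂ-cper))
      where
      f : ∀ {C χ} → Circ _ S¹ᵗ C χ → _ ≃ χ
      f (S¹ᵀ e′) = ≃-trans e (≃-sym e′)

    good-UKan : ∀ {Ψ A B φ} → UKan ν Ψ A B φ → Good (τ κ) Ψ A B φ
    good-UKan (ukanᵀ u) = self-good (rollUKan κ (ukanᵀ u)) (λ r → f (outUKan κ r)) (ν-cper u)
      where
      f : ∀ {C χ} → UKan ν _ (U Kan _) C χ → _ ≃ χ
      f (ukanᵀ u′) = ν-fun u u′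

  module _ where

    open PTyGood (λ {Ψ} {A} {B} {φ} {χ} → τ-resp pre {Ψ} {A} {B} {φ} {χ})

    good-UPre : ∀ {Ψ A B φ} → UPre ν Ψ A B φ → Good (τ pre) Ψ A B φ
    good-UPre (upreᵀ u) = self-good pre (roll (inUPre (upreᵀ u))) (λ r → f (outUPre r)) (ν-cper u)
      where
      f : ∀ {C χ} → UPre ν _ (U pre _) C χ → _ ≃ χ
      f (upreᵀ u′) = ν-fun u u′

    sym-Eq : ∀ {Ψ A B φ} → Eq (Goodτ pre) Ψ A B φ → ∃ λ ω → τ pre Ψ B A ω
    sym-Eq (eqᵀ α a ca m n e) = _ , roll (inEq (eqᵀ α (symᴾ a) ca (Q.symᵀ m) (Q.symᵀ n) ≃-refl))
      where module Q = TmPER (cperᴾ a)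

    good-Eq : ∀ {Ψ A B φ} → Eq (Goodτ pre) Ψ A B φ → Good (τ pre) Ψ A B φ
    good-Eq (eqᵀ {M = M} {N = N} α a ca m n e) = good
      (roll (inEq (eqᵀ α (relᴾ a) ca m n e)))
      (λ r → case-fun (outEq r))
      (λ r → case-tr (outEq r))
      (λ _ → sym-Eq (eqᵀ α a ca m n e))
      (CPER-≃ e Eqᴿ-cper)
      where
      module Q = TmPER (cperᴾ a)
      case-fun : ∀ {C χ} → Eq (τ pre) _ (Eqᵗ _ M N) C χ → _ ≃ χ
      case-fun (eqᵀ α′ a′ ca′ m′ n′ e′) = ≃-trans e (≃-trans (Eqᴿ-≃ (funᴾ a a′)) (≃-sym e′))
      case-tr : ∀ {C χ} → Eq (τ pre) _ (Eqᵗ _ _ _) C χ → ∃ λ ω → τ pre _ (Eqᵗ _ _ _) C ω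
      case-tr (eqᵀ α′ a′ ca′ m′ n′ e′) = _ , roll (inEq (eqᵀ α (trᴾ a a′) ca
        (Q.transᵀ m (Tm-≃ (≃ₛ-sym (funʳᴾ a a′)) m′)) (Q.transᵀ n (Tm-≃ (≃ₛ-sym (funʳᴾ a a′)) n′)) ≃-refl))

  module _ (κ : Kind) where

    open PTyGood (λ {Ψ} {A} {B} {φ} {χ} → τ-resp Kan {Ψ} {A} {B} {φ} {χ})

    -- The premise `B i ⟨ r ⟩ ≐ A` concerns the left-hand type: transitivity keeps the first one
    -- (`s-rel`), symmetry uses the one that comes with the self-related right-hand type (`s′`).
    good-Fcom : ∀ {Ψ A B φ} → Fcom (Goodτ Kan) Ψ A B φ → Good (τ κ) Ψ A B φ
    good-Fcom {Ψ} (fcomᵀ {k} {r} {r′} {A} {A′} {ξ} {B} {B′} α β v a ca b cb s e) = good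
      (rollFcom κ (fcomᵀ α β v (relᴾ a) ca (λ i j ψ h h′ → relᴾ (b i j ψ h h′)) cb s-rel e))
      (λ r → case-fun (outFcom κ r))
      (λ r → case-tr (outFcom κ r))
      (λ r → case-csym (outFcom κ r))
      (CPER-≃ e cper)
      where
      s-rel : ∀ {Ψ′} i (ψ : Ψ′ ⇒ Ψ) → Holds (lookup ξ i ⟪ ψ ⟫ᵉ) →
              SomePTy (τ Kan) Ψ′ (lookup B i ⟨ r ⟩ ⟪ ψ ⟫) (A ⟪ ψ ⟫)
      s-rel i ψ h with somePTy γ p ← s i ψ h = somePTy γ (relᴾ p)

      b-fun : ∀ {Ψ′} i j j′ (ψ : Ψ′ ⇒ suc Ψ) → Active ξ i ψ → Active ξ j ψ → Active ξ j′ ψ →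
              β ψ i j ≃ₛ β ψ i j′
      b-fun i j j′ ψ h h′ h″ = funᴾ (b i j ψ h h′) (relᴾ (b i j′ ψ h h″))

      -- Both relations equal `β ψ j j`: the first because it shares the right-hand type `B′ j`, the
      -- second because it shares the left-hand type `B j`.
      b-flip : ∀ {Ψ′} i j (ψ : Ψ′ ⇒ suc Ψ) → Active ξ i ψ → Active ξ j ψ → β ψ i j ≃ₛ β ψ j i
      b-flip i j ψ h h′ = ≃ₛ-trans (funʳᴾ (b i j ψ h h′) (symᴾ (b j j ψ h′ h′))) (b-fun j j i ψ h′ h′ h)

      cper : CPER (Fcomᴿ r r′ ξ B α β)
      cper (boxᴿ m n c) = linked (boxᴿ m n c)
        (λ { (boxᴿ m′ n′ c′) → boxᴿ (A.transᵀ m m′)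
               (λ i j ψ h h′ → N.transᵀ i j ψ h h′
                  (Tm-≃ (·-≃ₛ (b-fun i i j (lift ψ) (act-lift i ψ h) (act-lift i ψ h) (act-lift j ψ h′)) (r′ ⟪ ψ ⟫ᵈ ∷ idₛ))
                     (n i i ψ h h))
                  (n′ i j ψ h h′))
               c })
        (λ { (boxᴿ m′ n′ c′) → boxᴿ (A.symᵀ m)
               (λ i j ψ h h′ → N.symᵀ i j ψ h h′
                  (Tm-≃ (·-≃ₛ (b-flip j i (lift ψ) (act-lift j ψ h′) (act-lift i ψ h)) (r′ ⟪ ψ ⟫ᵈ ∷ idₛ))
                     (n j i ψ h′ h)))
               c′ })
        where
        act-lift : ∀ {Ψ′} i (ψ : Ψ′ ⇒ Ψ) → Holds (lookup ξ i ⟪ ψ ⟫ᵉ) → Active ξ i (lift ψ)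
        act-lift i = Holds-lift (lookup ξ i)
        module A = TmPER (cperᴾ a)
        module N {Ψ′} i j (ψ : Ψ′ ⇒ Ψ) h h′ =
          TmPER (CPERs-· (cperᴾ (b i j (lift ψ) (act-lift i ψ h) (act-lift j ψ h′))) (r′ ⟪ ψ ⟫ᵈ ∷ idₛ))

      case-fun : ∀ {C χ} → Fcom (τ Kan) _ (fcom r r′ A ξ B) C χ → _ ≃ χ
      case-fun (fcomᵀ α′ β′ v′ a′ ca′ b′ cb′ s′ e′) =
        ≃-trans e (≃-trans (Fcomᴿ-≃ (funᴾ a a′) (λ i j ψ h h′ → funᴾ (b i j ψ h h′) (b′ i j ψ h h′))) (≃-sym e′))

      case-tr : ∀ {C χ} → Fcom (τ Kan) _ (fcom r r′ A′ ξ B′) C χ → ∃ λ ω → τ κ _ (fcom r r′ A ξ B) C ω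
      case-tr (fcomᵀ α′ β′ v′ a′ ca′ b′ cb′ s′ e′) = _ , rollFcom κ
        (fcomᵀ α (λ ψ i j → β ψ i i) v (trᴾ a a′) ca
               (λ i j ψ h h′ → trᴾ (b i i ψ h h) (b′ i j ψ h h′)) (λ i j ψ h h′ → cb i i ψ h h) s-rel ≃-refl)

      case-csym : ∀ {χ} → Fcom (τ Kan) _ (fcom r r′ A′ ξ B′) (fcom r r′ A′ ξ B′) χ →
                  ∃ λ ω → τ κ _ (fcom r r′ A′ ξ B′) (fcom r r′ A ξ B) ω
      case-csym (fcomᵀ α′ β′ v′ a′ ca′ b′ cb′ s′ e′) = _ , rollFcom κ
        (fcomᵀ α (λ ψ i j → β ψ j i) v (symᴾ a) ca
               (λ i j ψ h h′ → symᴾ (b j i ψ h′ h)) (λ i j ψ h h′ → cb j i ψ h′ h) s′ ≃-refl)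

  -- The mutual functions walk through the premises of a derivation and attach the induction
  -- hypothesis to each. The fcom case of `pre` descends into the Kan system.
  τ-good : ∀ κ {Ψ A B φ} → τ κ Ψ A B φ → Good (τ κ) Ψ A B φ

  EvalTy-good : ∀ κ {Ψ A B φ} → EvalTy (τ κ) Ψ A B φ → EvalTy (Goodτ κ) Ψ A B φ
  EvalTy-good κ (eval a b r) = eval a b (τ-good κ r)

  PTyAt-good : ∀ κ {Ψ Ψ₁ Ψ₂ A B} {ψ₁ : Ψ₁ ⇒ Ψ} {ψ₂ : Ψ₂ ⇒ Ψ₁} → PTyAt (τ κ) A B ψ₁ ψ₂ → PTyAt (Goodτ κ) A B ψ₁ ψ₂
  PTyAt-good κ (ptyAt m n φ a b c d e) =
    ptyAt m n φ (EvalTy-good κ a) (EvalTy-good κ b) (EvalTy-good κ c) (EvalTy-good κ d) (EvalTy-good κ e)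

  PTy-good : ∀ κ {Ψ A B} {α : ΨRel Ψ} → PTy (τ κ) Ψ A B α → PTy (Goodτ κ) Ψ A B α
  PTy-good κ (mkPTy t c) = mkPTy (λ ψ → EvalTy-good κ (t ψ)) (λ ψ₁ ψ₂ → PTyAt-good κ (c ψ₁ ψ₂))

  SomePTy-good : ∀ κ {Ψ A B} → SomePTy (τ κ) Ψ A B → SomePTy (Goodτ κ) Ψ A B
  SomePTy-good κ (somePTy γ p) = somePTy γ (PTy-good κ p)

  Fun-good : ∀ κ {Ψ A B φ} → Fun (τ κ) Ψ A B φ → Fun (Goodτ κ) Ψ A B φ
  Fun-good κ (funᵀ α β a ca b cb e) =
    funᵀ α β (PTy-good κ a) ca (λ ψ M M′ t → PTy-good κ (b ψ M M′ t)) cb e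

  Pair-good : ∀ κ {Ψ A B φ} → Pair (τ κ) Ψ A B φ → Pair (Goodτ κ) Ψ A B φ
  Pair-good κ (pairᵀ α β a ca b cb e) =
    pairᵀ α β (PTy-good κ a) ca (λ ψ M M′ t → PTy-good κ (b ψ M M′ t)) cb e

  Path-good : ∀ κ {Ψ A B φ} → Path (τ κ) Ψ A B φ → Path (Goodτ κ) Ψ A B φ
  Path-good κ (pathᵀ α a ca p e) = pathᵀ α (PTy-good κ a) ca p e

  Eq-good : ∀ κ {Ψ A B φ} → Eq (τ κ) Ψ A B φ → Eq (Goodτ κ) Ψ A B φ
  Eq-good κ (eqᵀ α a ca m n e) = eqᵀ α (PTy-good κ a) ca m n e

  V-good : ∀ κ {Ψ A B φ} → VTy (τ κ) Ψ A B φ → VTy (Goodτ κ) Ψ A B φ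
  V-good κ (vᵀ β α η b cb a ca q t e) =
    vᵀ β α η (PTy-good κ b) cb (λ ψ h → PTy-good κ (a ψ h)) ca (λ ψ h → PTy-good κ (q ψ h)) t e

  Fcom-good : ∀ κ {Ψ A B φ} → Fcom (τ κ) Ψ A B φ → Fcom (Goodτ κ) Ψ A B φ
  Fcom-good κ (fcomᵀ α β v a ca b cb s e) =
    fcomᵀ α β v (PTy-good κ a) ca (λ i j ψ h h′ → PTy-good κ (b i j ψ h h′)) cb
          (λ i ψ h → SomePTy-good κ (s i ψ h)) e

  τ-good pre (roll (inFun d))  = good-Fun pre (Fun-good pre d)
  τ-good pre (roll (inPair d)) = good-Pair pre (Pair-good pre d)
  τ-good pre (roll (inPath d)) = good-Path pre (Path-good pre d)
  τ-good pre (roll (inEq d))   = good-Eq (Eq-good pre d)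
  τ-good pre (roll (inV d))    = good-V pre (V-good pre d)
  τ-good pre (roll (inFcom d)) = good-Fcom pre (Fcom-good Kan d)
  τ-good pre (roll (inVoid d)) = good-Void pre d
  τ-good pre (roll (inNat d))  = good-Nat pre d
  τ-good pre (roll (inBool d)) = good-Bool pre d
  τ-good pre (roll (inWB d))   = good-WB pre d
  τ-good pre (roll (inCirc d)) = good-Circ pre d
  τ-good pre (roll (inUPre d)) = good-UPre d
  τ-good pre (roll (inUKan d)) = good-UKan pre d
  τ-good Kan (roll (inFun d))  = good-Fun Kan (Fun-good Kan d)
  τ-good Kan (roll (inPair d)) = good-Pair Kan (Pair-good Kan d)
  τ-good Kan (roll (inPath d)) = good-Path Kan (Path-good Kan d)
  τ-good Kan (roll (inV d))    = good-V Kan (V-good Kan d)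
  τ-good Kan (roll (inFcom d)) = good-Fcom Kan (Fcom-good Kan d)
  τ-good Kan (roll (inVoid d)) = good-Void Kan d
  τ-good Kan (roll (inNat d))  = good-Nat Kan d
  τ-good Kan (roll (inBool d)) = good-Bool Kan d
  τ-good Kan (roll (inWB d))   = good-WB Kan d
  τ-good Kan (roll (inCirc d)) = good-Circ Kan d
  τ-good Kan (roll (inUKan d)) = good-UKan Kan d

-- Cumulativity

infix 4 _≼_
-- Apart from passing to a later stage, Kan types must embed into pretypes: the components of an
-- fcom type are Kan types even when the fcom is compared as a pretype.
data _≼_ : Kind → Kind → Set where
  pre≼pre : pre ≼ pre
  Kan≼    : ∀ κ → Kan ≼ κ

-- The relations of consecutive stages live at different levels, so a type is carried over together
-- with the lift of its relation.
module Raising (ℓ ℓ′ : Level) where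

  private
    module R  = Relations ℓ
    module R′ = Relations (ℓ ⊔ ℓ′)
    module S  = System ℓ
    module S′ = System (ℓ ⊔ ℓ′)
    module E′ = Elements (ℓ ⊔ ℓ′)

  infix 25 ↑_ ↑ₛ_
  ↑_ : ∀ {Ψ} → R.Rel Ψ → R′.Rel Ψ
  (↑ φ) M N = Lift ℓ′ (φ M N)

  ↑ₛ_ : ∀ {Ψ} → R.ΨRel Ψ → R′.ΨRel Ψ
  (↑ₛ α) ψ = ↑ (α ψ)

  Eval↑ : ∀ {Ψ} {φ : R.Rel Ψ} {M N} → R.Eval φ M N → R′.Eval (↑ φ) M N
  Eval↑ (R.eval m n r) = R′.eval m n (liftᴸ r)

  Eval↓ : ∀ {Ψ} {φ : R.Rel Ψ} {M N} → R′.Eval (↑ φ) M N → R.Eval φ M N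
  Eval↓ (R′.eval m n r) = R.eval m n (lower r)

  Tm↑ : ∀ {Ψ} {α : R.ΨRel Ψ} {M N} → R.Tm α M N → R′.Tm (↑ₛ α) M N
  Tm↑ t ψ₁ ψ₂ with R.tmAt m n a b c d e ← t ψ₁ ψ₂ =
    R′.tmAt m n (Eval↑ a) (Eval↑ b) (Eval↑ c) (Eval↑ d) (Eval↑ e)

  -- The way back serves the contravariant positions: arguments of functions, and the hypotheses
  -- under which a family of types is given.
  Tm↓ : ∀ {Ψ} {α : R.ΨRel Ψ} {M N} → R′.Tm (↑ₛ α) M N → R.Tm α M N
  Tm↓ t ψ₁ ψ₂ with R′.tmAt m n a b c d e ← t ψ₁ ψ₂ =
    R.tmAt m n (Eval↓ a) (Eval↓ b) (Eval↓ c) (Eval↓ d) (Eval↓ e)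

  Coh↑ : ∀ {Ψ} {α : R.ΨRel Ψ} → R.Coh α → R′.Coh (↑ₛ α)
  Coh↑ c ψ (liftᴸ r) = Tm↑ (c ψ r)

  ≃↑ : ∀ {Ψ} {φ χ : R.Rel Ψ} {ω : R′.Rel Ψ} → φ R.≃ χ → ↑ χ R′.≃ ω → ↑ φ R′.≃ ω
  ≃↑ e e′ = E′.≃-trans (R′.equal (λ r → liftᴸ (R._≃_.to e (lower r))) (λ r → liftᴸ (R._≃_.from e (lower r)))) e′

  Funᴿ↑ : ∀ {Ψ} {α : R.ΨRel Ψ} {β : S.Fam Ψ} → ↑ (S.Funᴿ α β) R′.≃ S′.Funᴿ (↑ₛ α) (λ ψ M M′ → ↑ₛ (β ψ M M′))
  Funᴿ↑ = R′.equal
    (λ { (liftᴸ (S.lamᴿ n)) → S′.lamᴿ λ ψ M M′ t → Tm↑ (n ψ M M′ (Tm↓ t)) })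
    (λ { (S′.lamᴿ n) → liftᴸ (S.lamᴿ λ ψ M M′ t → Tm↓ (n ψ M M′ (Tm↑ t))) })

  Pairᴿ↑ : ∀ {Ψ} {α : R.ΨRel Ψ} {β : S.Fam Ψ} → ↑ (S.Pairᴿ α β) R′.≃ S′.Pairᴿ (↑ₛ α) (λ ψ M M′ → ↑ₛ (β ψ M M′))
  Pairᴿ↑ = R′.equal
    (λ { (liftᴸ (S.pairᴿ m n)) → S′.pairᴿ (Tm↑ m) (Tm↑ n) })
    (λ { (S′.pairᴿ m n) → liftᴸ (S.pairᴿ (Tm↓ m) (Tm↓ n)) })

  Pathᴿ↑ : ∀ {Ψ} {α : R.ΨRel (suc Ψ)} {P₀ P₁} → ↑ (S.Pathᴿ α P₀ P₁) R′.≃ S′.Pathᴿ (↑ₛ α) P₀ P₁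
  Pathᴿ↑ = R′.equal
    (λ { (liftᴸ (S.plamᴿ m p)) → S′.plamᴿ (Tm↑ m) (λ ε → Tm↑ (p ε)) })
    (λ { (S′.plamᴿ m p) → liftᴸ (S.plamᴿ (Tm↓ m) (λ ε → Tm↓ (p ε))) })

  Eqᴿ↑ : ∀ {Ψ} {α : R.ΨRel Ψ} {M N} → ↑ (S.Eqᴿ α M N) R′.≃ S′.Eqᴿ (↑ₛ α) M N
  Eqᴿ↑ = R′.equal
    (λ { (liftᴸ (S.starᴿ m)) → S′.starᴿ (Tm↑ m) })
    (λ { (S′.starᴿ m) → liftᴸ (S.starᴿ (Tm↓ m)) })

  Vᴿ↑ : ∀ {Ψ x E} {α : S.VFam Ψ} {β : R.ΨRel Ψ} → ↑ (S.Vᴿ x α β E) R′.≃ S′.Vᴿ x (λ ψ → ↑ₛ (α ψ)) (↑ₛ β) E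
  Vᴿ↑ = R′.equal
    (λ { (liftᴸ (S.vinᴿ n m e)) → S′.vinᴿ (Tm↑ n) (λ ψ h → Tm↑ (m ψ h)) (λ ψ h → Tm↑ (e ψ h)) })
    (λ { (S′.vinᴿ n m e) → liftᴸ (S.vinᴿ (Tm↓ n) (λ ψ h → Tm↓ (m ψ h)) (λ ψ h → Tm↓ (e ψ h))) })

  Fcomᴿ↑ : ∀ {Ψ k r r′ ξ B} {α : R.ΨRel Ψ} {β : S.FcomFam Ψ k} →
           ↑ (S.Fcomᴿ r r′ ξ B α β) R′.≃ S′.Fcomᴿ r r′ ξ B (↑ₛ α) (λ ψ i j → ↑ₛ (β ψ i j))
  Fcomᴿ↑ = R′.equal
    (λ { (liftᴸ (S.boxᴿ m n c)) →
         S′.boxᴿ (Tm↑ m) (λ i j ψ h h′ → Tm↑ (n i j ψ h h′)) (λ i ψ h → Tm↑ (c i ψ h)) })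
    (λ { (S′.boxᴿ m n c) →
         liftᴸ (S.boxᴿ (Tm↓ m) (λ i j ψ h h′ → Tm↓ (n i j ψ h h′)) (λ i ψ h → Tm↓ (c i ψ h))) })

  Lift↑ : ∀ {Ψ} {φ : Relations.Rel lzero Ψ} → ↑ (λ M N → Lift ℓ (φ M N)) R′.≃ (λ M N → Lift (ℓ ⊔ ℓ′) (φ M N))
  Lift↑ = R′.equal (λ r → liftᴸ (lower (lower r))) (λ r → liftᴸ (liftᴸ (lower r)))

  module _ (ν : S.Cand) (ν′ : S′.Cand) (raise-ν : ∀ {Ψ A B φ} → ν Ψ A B φ → ν′ Ψ A B (↑ φ)) where

    open Closure ℓ ν using (τ)
    open Closure (ℓ ⊔ ℓ′) ν′ renaming (τ to τ′)

    raise : ∀ {κ κ′} → κ ≼ κ′ → ∀ {Ψ A B φ} → τ κ Ψ A B φ → τ′ κ′ Ψ A B (↑ φ)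

    raise-EvalTy : ∀ {κ κ′} → κ ≼ κ′ → ∀ {Ψ A B φ} → S.EvalTy (τ κ) Ψ A B φ → S′.EvalTy (τ′ κ′) Ψ A B (↑ φ)
    raise-EvalTy l (S.eval a b r) = S′.eval a b (raise l r)

    raise-PTyAt : ∀ {κ κ′} → κ ≼ κ′ → ∀ {Ψ Ψ₁ Ψ₂ A B} {ψ₁ : Ψ₁ ⇒ Ψ} {ψ₂ : Ψ₂ ⇒ Ψ₁} →
                  S.PTyAt (τ κ) A B ψ₁ ψ₂ → S′.PTyAt (τ′ κ′) A B ψ₁ ψ₂
    raise-PTyAt l (S.ptyAt m n φ a b c d e) =
      S′.ptyAt m n (↑ φ) (raise-EvalTy l a) (raise-EvalTy l b) (raise-EvalTy l c) (raise-EvalTy l d) (raise-EvalTy l e)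

    raise-PTy : ∀ {κ κ′} → κ ≼ κ′ → ∀ {Ψ A B} {α : R.ΨRel Ψ} → S.PTy (τ κ) Ψ A B α → S′.PTy (τ′ κ′) Ψ A B (↑ₛ α)
    raise-PTy l (S.mkPTy t c) = S′.mkPTy (λ ψ → raise-EvalTy l (t ψ)) (λ ψ₁ ψ₂ → raise-PTyAt l (c ψ₁ ψ₂))

    raise-SomePTy : ∀ {κ κ′} → κ ≼ κ′ → ∀ {Ψ A B} → S.SomePTy (τ κ) Ψ A B → S′.SomePTy (τ′ κ′) Ψ A B
    raise-SomePTy l (S.somePTy γ p) = S′.somePTy (↑ₛ γ) (raise-PTy l p)

    raise-Fun : ∀ {κ κ′} → κ ≼ κ′ → ∀ {Ψ A B φ} → S.Fun (τ κ) Ψ A B φ → S′.Fun (τ′ κ′) Ψ A B (↑ φ)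
    raise-Fun l (S.funᵀ α β a ca b cb e) = S′.funᵀ (↑ₛ α) (λ ψ M M′ → ↑ₛ (β ψ M M′)) (raise-PTy l a) (Coh↑ ca)
      (λ ψ M M′ t → raise-PTy l (b ψ M M′ (Tm↓ t))) (λ ψ M M′ t → Coh↑ (cb ψ M M′ (Tm↓ t))) (≃↑ e Funᴿ↑)

    raise-Pair : ∀ {κ κ′} → κ ≼ κ′ → ∀ {Ψ A B φ} → S.Pair (τ κ) Ψ A B φ → S′.Pair (τ′ κ′) Ψ A B (↑ φ)
    raise-Pair l (S.pairᵀ α β a ca b cb e) = S′.pairᵀ (↑ₛ α) (λ ψ M M′ → ↑ₛ (β ψ M M′)) (raise-PTy l a) (Coh↑ ca)
      (λ ψ M M′ t → raise-PTy l (b ψ M M′ (Tm↓ t))) (λ ψ M M′ t → Coh↑ (cb ψ M M′ (Tm↓ t))) (≃↑ e Pairᴿ↑)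

    raise-Path : ∀ {κ κ′} → κ ≼ κ′ → ∀ {Ψ A B φ} → S.Path (τ κ) Ψ A B φ → S′.Path (τ′ κ′) Ψ A B (↑ φ)
    raise-Path l (S.pathᵀ α a ca p e) = S′.pathᵀ (↑ₛ α) (raise-PTy l a) (Coh↑ ca) (λ ε → Tm↑ (p ε)) (≃↑ e Pathᴿ↑)

    raise-Eq : ∀ {κ κ′} → κ ≼ κ′ → ∀ {Ψ A B φ} → S.Eq (τ κ) Ψ A B φ → S′.Eq (τ′ κ′) Ψ A B (↑ φ)
    raise-Eq l (S.eqᵀ α a ca m n e) = S′.eqᵀ (↑ₛ α) (raise-PTy l a) (Coh↑ ca) (Tm↑ m) (Tm↑ n) (≃↑ e Eqᴿ↑)

    raise-V : ∀ {κ κ′} → κ ≼ κ′ → ∀ {Ψ A B φ} → S.VTy (τ κ) Ψ A B φ → S′.VTy (τ′ κ′) Ψ A B (↑ φ)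
    raise-V l (S.vᵀ β α η b cb a ca q t e) = S′.vᵀ (↑ₛ β) (λ ψ → ↑ₛ (α ψ)) (λ ψ → ↑ₛ (η ψ))
      (raise-PTy l b) (Coh↑ cb) (λ ψ h → raise-PTy l (a ψ h)) (λ ψ h → Coh↑ (ca ψ h))
      (λ ψ h → raise-PTy l (q ψ h)) (λ ψ h → Tm↑ (t ψ h)) (≃↑ e Vᴿ↑)

    raise-Fcom : ∀ {κ κ′} → κ ≼ κ′ → ∀ {Ψ A B φ} → S.Fcom (τ κ) Ψ A B φ → S′.Fcom (τ′ κ′) Ψ A B (↑ φ)
    raise-Fcom l (S.fcomᵀ α β v a ca b cb s e) = S′.fcomᵀ (↑ₛ α) (λ ψ i j → ↑ₛ (β ψ i j)) v
      (raise-PTy l a) (Coh↑ ca) (λ i j ψ h h′ → raise-PTy l (b i j ψ h h′)) (λ i j ψ h h′ → Coh↑ (cb i j ψ h h′))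
      (λ i ψ h → raise-SomePTy l (s i ψ h)) (≃↑ e Fcomᴿ↑)

    raise pre≼pre  (S.roll (S.inFun d))                = rollFun pre (raise-Fun pre≼pre d)
    raise pre≼pre  (S.roll (S.inPair d))               = rollPair pre (raise-Pair pre≼pre d)
    raise pre≼pre  (S.roll (S.inPath d))               = rollPath pre (raise-Path pre≼pre d)
    raise pre≼pre  (S.roll (S.inEq d))                 = S′.roll (S′.inEq (raise-Eq pre≼pre d))
    raise pre≼pre  (S.roll (S.inV d))                  = rollV pre (raise-V pre≼pre d)
    raise pre≼pre  (S.roll (S.inFcom d))               = rollFcom pre (raise-Fcom (Kan≼ Kan) d)
    raise pre≼pre  (S.roll (S.inVoid (S.voidᵀ e)))     = rollVoid pre (S′.voidᵀ (≃↑ e Lift↑))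
    raise pre≼pre  (S.roll (S.inNat (S.natᵀ e)))       = rollNat pre (S′.natᵀ (≃↑ e Lift↑))
    raise pre≼pre  (S.roll (S.inBool (S.boolᵀ e)))     = rollBool pre (S′.boolᵀ (≃↑ e Lift↑))
    raise pre≼pre  (S.roll (S.inWB (S.wboolᵀ e)))      = rollWB pre (S′.wboolᵀ (≃↑ e Lift↑))
    raise pre≼pre  (S.roll (S.inCirc (S.S¹ᵀ e)))       = rollCirc pre (S′.S¹ᵀ (≃↑ e Lift↑))
    raise pre≼pre  (S.roll (S.inUPre (S.upreᵀ u)))     = S′.roll (S′.inUPre (S′.upreᵀ (raise-ν u)))
    raise pre≼pre  (S.roll (S.inUKan (S.ukanᵀ u)))     = rollUKan pre (S′.ukanᵀ (raise-ν u))
    raise (Kan≼ κ) (S.roll (S.inFun d))                = rollFun κ (raise-Fun (Kan≼ κ) d)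
    raise (Kan≼ κ) (S.roll (S.inPair d))               = rollPair κ (raise-Pair (Kan≼ κ) d)
    raise (Kan≼ κ) (S.roll (S.inPath d))               = rollPath κ (raise-Path (Kan≼ κ) d)
    raise (Kan≼ κ) (S.roll (S.inV d))                  = rollV κ (raise-V (Kan≼ κ) d)
    raise (Kan≼ κ) (S.roll (S.inFcom d))               = rollFcom κ (raise-Fcom (Kan≼ Kan) d)
    raise (Kan≼ κ) (S.roll (S.inVoid (S.voidᵀ e)))     = rollVoid κ (S′.voidᵀ (≃↑ e Lift↑))
    raise (Kan≼ κ) (S.roll (S.inNat (S.natᵀ e)))       = rollNat κ (S′.natᵀ (≃↑ e Lift↑))
    raise (Kan≼ κ) (S.roll (S.inBool (S.boolᵀ e)))     = rollBool κ (S′.boolᵀ (≃↑ e Lift↑))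
    raise (Kan≼ κ) (S.roll (S.inWB (S.wboolᵀ e)))      = rollWB κ (S′.wboolᵀ (≃↑ e Lift↑))
    raise (Kan≼ κ) (S.roll (S.inCirc (S.S¹ᵀ e)))       = rollCirc κ (S′.S¹ᵀ (≃↑ e Lift↑))
    raise (Kan≼ κ) (S.roll (S.inUKan (S.ukanᵀ u)))     = rollUKan κ (S′.ukanᵀ (raise-ν u))

⟼-⇓⁻¹ : ∀ {Ψ} {M M′ W : Term Ψ 0} → M ⟼ M′ → M ⇓ W → M′ ⇓ W
⟼-⇓⁻¹ s (stop , v)      = ⊥-elim (value-stuck v s)
⟼-⇓⁻¹ s (t ◅ ts , v) = subst (_⇓ _) (sym (⟼-deterministic s t)) (ts , v)

⟪⟫-at : ∀ {Ψ Ψ′} (M : Term (suc Ψ) 0) (ψ : Ψ′ ⇒ Ψ) (s : Dim Ψ′) → M ⟪ lift ψ ⟫ ⟨ s ⟩ ≡ M ⟪ s ∷ ψ ⟫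
⟪⟫-at M ψ s = trans (⟪⟫-⨾ M (lift ψ) (s ∷ idₛ))
  (cong (M ⟪_⟫) (trans (lift-⨾-∷ ψ s idₛ) (cong (s ∷_) (⨾-idʳ ψ))))

⟨⟩-⟪⟫ : ∀ {Ψ Ψ′} (M : Term (suc Ψ) 0) (r : Dim Ψ) (ψ : Ψ′ ⇒ Ψ) → M ⟨ r ⟩ ⟪ ψ ⟫ ≡ M ⟪ r ⟪ ψ ⟫ᵈ ∷ ψ ⟫
⟨⟩-⟪⟫ M r ψ = trans (⟪⟫-⨾ M (r ∷ idₛ) ψ) (cong (λ χ → M ⟪ r ⟪ ψ ⟫ᵈ ∷ χ ⟫) (⨾-idˡ ψ))

Holds-∷ : ∀ {Ψ Ψ′} (e : Eqn Ψ) (s : Dim Ψ′) (ψ : Ψ′ ⇒ Ψ) → Holds (e ⟪ ψ ⟫ᵉ) → Holds (wkᵉ e ⟪ s ∷ ψ ⟫ᵉ)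
Holds-∷ (r , r′) s ψ h = trans (⟪⟫ᵈ-wk r s ψ) (trans h (sym (⟪⟫ᵈ-wk r′ s ψ)))

Holds-⨾ : ∀ {Ψ Ψ₁ Ψ₂} (e : Eqn Ψ) (ψ₁ : Ψ₁ ⇒ Ψ) (ψ₂ : Ψ₂ ⇒ Ψ₁) →
          Holds (e ⟪ ψ₁ ⟫ᵉ ⟪ ψ₂ ⟫ᵉ) → Holds (e ⟪ ψ₁ ⨾ ψ₂ ⟫ᵉ)
Holds-⨾ (r , r′) ψ₁ ψ₂ h = trans (sym (⟪⟫ᵈ-⨾ r ψ₁ ψ₂)) (trans h (⟪⟫ᵈ-⨾ r′ ψ₁ ψ₂))

wkᵈ-lift : ∀ {Ψ Ψ₁ Ψ₂} (r : Dim Ψ) (ψ₁ : Ψ₁ ⇒ Ψ) (ψ₂ : Ψ₂ ⇒ suc Ψ₁) →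
           wkᵈ (r ⟪ ψ₁ ⟫ᵈ) ⟪ ψ₂ ⟫ᵈ ≡ wkᵈ r ⟪ lift ψ₁ ⨾ ψ₂ ⟫ᵈ
wkᵈ-lift r ψ₁ (s ∷ ψ₂) = begin
  wkᵈ (r ⟪ ψ₁ ⟫ᵈ) ⟪ s ∷ ψ₂ ⟫ᵈ     ≡⟨ ⟪⟫ᵈ-wk (r ⟪ ψ₁ ⟫ᵈ) s ψ₂ ⟩
  r ⟪ ψ₁ ⟫ᵈ ⟪ ψ₂ ⟫ᵈ               ≡⟨ ⟪⟫ᵈ-⨾ r ψ₁ ψ₂ ⟩
  r ⟪ ψ₁ ⨾ ψ₂ ⟫ᵈ                  ≡⟨ ⟪⟫ᵈ-wk r s (ψ₁ ⨾ ψ₂) ⟨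
  wkᵈ r ⟪ s ∷ ψ₁ ⨾ ψ₂ ⟫ᵈ          ≡⟨ cong (wkᵈ r ⟪_⟫ᵈ) (lift-⨾-∷ ψ₁ s ψ₂) ⟨
  wkᵈ r ⟪ lift ψ₁ ⨾ (s ∷ ψ₂) ⟫ᵈ   ∎
  where open ≡-Reasoning

lookup-actVec-⟪⟫ : ∀ {Ψ Ψ₁ Ψ₂ k} (N : Vec (Term Ψ 0) k) (ψ₁ : Ψ₁ ⇒ Ψ) (ψ₂ : Ψ₂ ⇒ Ψ₁) i →
                   lookup (actVec ψ₁ [] N) i ⟪ ψ₂ ⟫ ≡ lookup N i ⟪ ψ₁ ⨾ ψ₂ ⟫
lookup-actVec-⟪⟫ N ψ₁ ψ₂ i = trans (cong (_⟪ ψ₂ ⟫) (lookup-actVec ψ₁ [] N i)) (⟪⟫-⨾ (lookup N i) ψ₁ ψ₂)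

-- Closure under dimension substitution

module Substitution (ℓ : Level) where

  open Relations ℓ
  open System ℓ
  open Elements ℓ
  open Types ℓ
  open ElementRelations ℓ

  PTy-≡ : ∀ {σ : Cand} {Ψ A A′ B B′} {α : ΨRel Ψ} → A ≡ A′ → B ≡ B′ → PTy σ Ψ A B α → PTy σ Ψ A′ B′ α
  PTy-≡ refl refl p = p

  module _ {σ : Cand} {Ψ Ψ′} (ψ : Ψ′ ⇒ Ψ) where

    -- There is no recursion, since the premises already quantify over all substitutions. Leaving
    -- `χ` existential is enough for the universe relation, which forgets it.
    subst-Fun : ∀ {A B φ} → Fun σ Ψ A B φ → ∃ λ χ → Fun σ Ψ′ (A ⟪ ψ ⟫) (B ⟪ ψ ⟫) χ
    subst-Fun (funᵀ {B = B} {B′} α β a ca b cb e) = _ , funᵀ (α · ψ) (λ ψ′ M M′ → β (ψ ⨾ ψ′) M M′)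
      (PTy-subst {σ} a ψ) (Coh-· ca ψ)
      (λ ψ′ M M′ t → PTy-≡ (cong (_[ M ]) (sym (⟪⟫-⨾₁ B ψ ψ′))) (cong (_[ M′ ]) (sym (⟪⟫-⨾₁ B′ ψ ψ′)))
                           (b (ψ ⨾ ψ′) M M′ (Tm-≃ (·-⨾ α ψ ψ′) t)))
      (λ ψ′ M M′ t → cb (ψ ⨾ ψ′) M M′ (Tm-≃ (·-⨾ α ψ ψ′) t)) ≃-refl

    subst-Pair : ∀ {A B φ} → Pair σ Ψ A B φ → ∃ λ χ → Pair σ Ψ′ (A ⟪ ψ ⟫) (B ⟪ ψ ⟫) χ
    subst-Pair (pairᵀ {B = B} {B′} α β a ca b cb e) = _ , pairᵀ (α · ψ) (λ ψ′ M M′ → β (ψ ⨾ ψ′) M M′)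
      (PTy-subst {σ} a ψ) (Coh-· ca ψ)
      (λ ψ′ M M′ t → PTy-≡ (cong (_[ M ]) (sym (⟪⟫-⨾₁ B ψ ψ′))) (cong (_[ M′ ]) (sym (⟪⟫-⨾₁ B′ ψ ψ′)))
                           (b (ψ ⨾ ψ′) M M′ (Tm-≃ (·-⨾ α ψ ψ′) t)))
      (λ ψ′ M M′ t → cb (ψ ⨾ ψ′) M M′ (Tm-≃ (·-⨾ α ψ ψ′) t)) ≃-refl

    subst-Path : ∀ {A B φ} → Path σ Ψ A B φ → ∃ λ χ → Path σ Ψ′ (A ⟪ ψ ⟫) (B ⟪ ψ ⟫) χ
    subst-Path (pathᵀ {P₀ = P₀} {P₁} {P₀′} {P₁′} α a ca p e) =
      _ , pathᵀ (α · lift ψ) (PTy-subst {σ} a (lift ψ)) (Coh-· ca (lift ψ))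
                (λ { false → endpoint false (p false) ; true → endpoint true (p true) }) ≃-refl
      where
      endpoint : ∀ ε {P Q} → Tm (α · (const ε ∷ idₛ)) P Q → Tm (α · lift ψ · (const ε ∷ idₛ)) (P ⟪ ψ ⟫) (Q ⟪ ψ ⟫)
      endpoint ε t = Tm-≃
        (≃ₛ-trans (·-⨾ α (const ε ∷ idₛ) ψ) (≃ₛ-trans (≡⇒≃ₛ α ends) (≃ₛ-sym (·-⨾ α (lift ψ) (const ε ∷ idₛ)))))
        (Tm-subst t ψ)
        where
        ends : (const ε ∷ idₛ) ⨾ ψ ≡ lift ψ ⨾ (const ε ∷ idₛ)
        ends = trans (cong (const ε ∷_) (trans (⨾-idˡ ψ) (sym (⨾-idʳ ψ)))) (sym (lift-⨾-∷ ψ (const ε) idₛ))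

    subst-Eq : ∀ {A B φ} → Eq σ Ψ A B φ → ∃ λ χ → Eq σ Ψ′ (A ⟪ ψ ⟫) (B ⟪ ψ ⟫) χ
    subst-Eq (eqᵀ α a ca m n e) =
      _ , eqᵀ (α · ψ) (PTy-subst {σ} a ψ) (Coh-· ca ψ) (Tm-subst m ψ) (Tm-subst n ψ) ≃-refl

    subst-V : ∀ {x y A B E A′ B′ E′ φ} → lookup ψ x ≡ name y →
              VTy σ Ψ (V (name x) A B E) (V (name x) A′ B′ E′) φ →
              ∃ λ χ → VTy σ Ψ′ (V (name y) (A ⟪ ψ ⟫) (B ⟪ ψ ⟫) (E ⟪ ψ ⟫)) (V (name y) (A′ ⟪ ψ ⟫) (B′ ⟪ ψ ⟫) (E′ ⟪ ψ ⟫)) χ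
    subst-V {x} {y} {A} {B} {E} {A′} {B′} {E′} x≡y (vᵀ β α η b cb a ca q t e) =
      _ , vᵀ (β · ψ) (λ ψ′ → α (ψ ⨾ ψ′)) (λ ψ′ → η (ψ ⨾ ψ′)) (PTy-subst {σ} b ψ) (Coh-· cb ψ)
        (λ ψ′ h → PTy-≡ (sym (⟪⟫-⨾ A ψ ψ′)) (sym (⟪⟫-⨾ A′ ψ ψ′)) (a (ψ ⨾ ψ′) (at-𝟎 ψ′ h)))
        (λ ψ′ h → ca (ψ ⨾ ψ′) (at-𝟎 ψ′ h))
        (λ ψ′ h → PTy-≡ (Equiv≡ ψ′) (Equiv≡ ψ′) (q (ψ ⨾ ψ′) (at-𝟎 ψ′ h)))
        (λ ψ′ h → subst₂ (Tm (η (ψ ⨾ ψ′))) (sym (⟪⟫-⨾ E ψ ψ′)) (sym (⟪⟫-⨾ E′ ψ ψ′)) (t (ψ ⨾ ψ′) (at-𝟎 ψ′ h))) ≃-refl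
      where
      at-𝟎 : ∀ {Ψ″} (ψ′ : Ψ″ ⇒ Ψ′) → lookup ψ′ y ≡ 𝟎 → lookup (ψ ⨾ ψ′) x ≡ 𝟎
      at-𝟎 ψ′ h = trans (lookup-map x (_⟪ ψ′ ⟫ᵈ) ψ) (trans (cong (_⟪ ψ′ ⟫ᵈ) x≡y) h)
      Equiv≡ : ∀ {Ψ″} (ψ′ : Ψ″ ⇒ Ψ′) → Equiv (A ⟪ ψ ⨾ ψ′ ⟫) (B ⟪ ψ ⨾ ψ′ ⟫) ≡ Equiv (A ⟪ ψ ⟫ ⟪ ψ′ ⟫) (B ⟪ ψ ⟫ ⟪ ψ′ ⟫)
      Equiv≡ ψ′ = cong₂ Equiv (sym (⟪⟫-⨾ A ψ ψ′)) (sym (⟪⟫-⨾ B ψ ψ′))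

    subst-Fcom : ∀ {k r r′ A A′} {ξ : Vec (Eqn Ψ) k} {B B′ φ} →
                 r ⟪ ψ ⟫ᵈ ≢ r′ ⟪ ψ ⟫ᵈ → AllApart (map (_⟪ ψ ⟫ᵉ) ξ) →
                 Fcom σ Ψ (fcom r r′ A ξ B) (fcom r r′ A′ ξ B′) φ →
                 ∃ λ χ → Fcom σ Ψ′ (fcom r r′ A ξ B ⟪ ψ ⟫) (fcom r r′ A′ ξ B′ ⟪ ψ ⟫) χ
    subst-Fcom {r = r} {r′} {A} {A′} {ξ} {B} {B′} r≢r′ ap (fcomᵀ α β (_ , _ , i₀ , j₀ , s₀ , e₀ , e₁) a ca b cb s e) =
      _ , fcomᵀ (α · ψ) (λ ψ′ i j → β (lift ψ ⨾ ψ′) i j)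
        (r≢r′ , ap , i₀ , j₀ , s₀ ⟪ ψ ⟫ᵈ , trans (lookup-map i₀ _ ξ) (cong (_⟪ ψ ⟫ᵉ) e₀) ,
                                          trans (lookup-map j₀ _ ξ) (cong (_⟪ ψ ⟫ᵉ) e₁))
        (PTy-subst {σ} a ψ) (Coh-· ca ψ)
        (λ i j ψ′ h h′ → PTy-≡ (sym (lookup-actVec-⟪⟫ B (lift ψ) ψ′ i)) (sym (lookup-actVec-⟪⟫ B′ (lift ψ) ψ′ j))
                               (b i j (lift ψ ⨾ ψ′) (active i ψ′ h) (active j ψ′ h′)))
        (λ i j ψ′ h h′ → cb i j (lift ψ ⨾ ψ′) (active i ψ′ h) (active j ψ′ h′))
        (λ i ψ′ h → SomePTy-≡ (tube i ψ′) (sym (⟪⟫-⨾ A ψ ψ′))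
                      (s i (ψ ⨾ ψ′) (Holds-⨾ (lookup ξ i) ψ ψ′ (subst (λ x → Holds (x ⟪ ψ′ ⟫ᵉ)) (lookup-map i _ ξ) h)))) ≃-refl
      where
      SomePTy-≡ : ∀ {Ψ X X′ Y Y′} → X ≡ X′ → Y ≡ Y′ → SomePTy σ Ψ X Y → SomePTy σ Ψ X′ Y′
      SomePTy-≡ refl refl p = p
      active : ∀ {Ψ″} i (ψ′ : Ψ″ ⇒ suc Ψ′) → Active (map (_⟪ ψ ⟫ᵉ) ξ) i ψ′ → Active ξ i (lift ψ ⨾ ψ′)
      active i ψ′ h = trans (sym (wkᵈ-lift (proj₁ (lookup ξ i)) ψ ψ′))
        (trans (subst (λ x → Holds (wkᵉ x ⟪ ψ′ ⟫ᵉ)) (lookup-map i _ ξ) h) (wkᵈ-lift (proj₂ (lookup ξ i)) ψ ψ′))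
      tube : ∀ {Ψ″} i (ψ′ : Ψ″ ⇒ Ψ′) →
             lookup B i ⟨ r ⟩ ⟪ ψ ⨾ ψ′ ⟫ ≡ lookup (actVec (lift ψ) [] B) i ⟨ r ⟪ ψ ⟫ᵈ ⟩ ⟪ ψ′ ⟫
      tube i ψ′ = trans (sym (⟪⟫-⨾ (lookup B i ⟨ r ⟩) ψ ψ′)) (cong (_⟪ ψ′ ⟫)
        (trans (⟨⟩-⟪⟫ (lookup B i) r ψ) (trans (sym (⟪⟫-at (lookup B i) ψ (r ⟪ ψ ⟫ᵈ)))
          (cong (_⟨ r ⟪ ψ ⟫ᵈ ⟩) (sym (lookup-actVec (lift ψ) [] B i))))))

-- Coherence of type equality

module Coherence (ℓ : Level) (ν : System.Cand ℓ) (univ : Universal ℓ ν) where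

  open Relations ℓ using (Rel; ΨRel)
  open System ℓ hiding (eval)
  open Elements ℓ
  open Types ℓ
  open ElementRelations ℓ
  open Universal univ
  open Goodness ℓ ν univ
  open Substitution ℓ
  private
    module R′ = Relations (lsuc ℓ)
    module E′ = Elements (lsuc ℓ)

  -- The relation of the universe that the next stage adds; its coherence is what makes that
  -- universe a type.
  T : Kind → ∀ Ψ → R′.Rel Ψ
  T κ Ψ A B = ∃ λ φ → τ κ Ψ A B φ

  Kan⊆ : ∀ κ {Ψ A B} → T Kan Ψ A B → T κ Ψ A B
  -- With both levels equal to `ℓ` nothing is raised, and `↑ φ` is just another presentation of `φ`.
  Kan⊆ κ (_ , r) = _ , Raising.raise ℓ ℓ ν ν (ν-resp (Relations.equal lower liftᴸ)) (Kan≼ κ) r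

  module PTyEq (κ : Kind) where

    private module G = PTyGood (λ {Ψ} {A} {B} {φ} {χ} → τ-resp κ {Ψ} {A} {B} {φ} {χ})

    module _ {Ψ A B} {α : ΨRel Ψ} (p : PTy (τ κ) Ψ A B α) where

      symᵖ : PTy (τ κ) Ψ B A α
      symᵖ = G.symᴾ (PTy-good κ p)

      transᵖ : ∀ {C} {β : ΨRel Ψ} → PTy (τ κ) Ψ B C β → PTy (τ κ) Ψ A C α
      transᵖ = G.trᴾ (PTy-good κ p)

      reflʳᵖ : PTy (τ κ) Ψ B B α
      reflʳᵖ = G.reflʳᴾ (PTy-good κ p)

      cperᵖ : CPERs α
      cperᵖ = G.cperᴾ (PTy-good κ p)

      PTy⇒T : R′.Eval (T κ Ψ) A B
      PTy⇒T with System.eval a b r ← PTy.types p idₛ =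
        R′.eval (subst (_⇓ _) (act-id A) a) (subst (_⇓ _) (act-id B) b) (_ , r)

      -- The premises of a type former bring their own coherence, used here with the identity as
      -- first substitution.
      PTy⇒coh : ∀ {Ψ′ A₁} → A ⇓ A₁ → (ψ : Ψ′ ⇒ Ψ) → R′.Eval (T κ Ψ′) (A₁ ⟪ ψ ⟫) (A ⟪ ψ ⟫)
      PTy⇒coh a ψ with ptyAt m n φ (System.eval x y r) _ _ _ _ ← PTy.coherent p idₛ ψ
        with refl ← ⇓-deterministic (subst (_⇓ _) (act-id A) m) a =
        R′.eval x (subst (λ X → X ⟪ ψ ⟫ ⇓ _) (act-id A) y) (_ , r)

  reflʳ-Fun : ∀ κ {Ψ A B φ} → Fun (τ κ) Ψ A B φ → T κ Ψ B B
  reflʳ-Fun κ d = Good.tr (τ-good κ (proj₂ (sym-Fun κ (Fun-good κ d)))) (rollFun κ d)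

  reflʳ-Pair : ∀ κ {Ψ A B φ} → Pair (τ κ) Ψ A B φ → T κ Ψ B B
  reflʳ-Pair κ d = Good.tr (τ-good κ (proj₂ (sym-Pair κ (Pair-good κ d)))) (rollPair κ d)

  reflʳ-Path : ∀ κ {Ψ A B φ} → Path (τ κ) Ψ A B φ → T κ Ψ B B
  reflʳ-Path κ d = Good.tr (τ-good κ (proj₂ (sym-Path κ (Path-good κ d)))) (rollPath κ d)

  reflʳ-Eq : ∀ {Ψ A B φ} → Eq (τ pre) Ψ A B φ → T pre Ψ B B
  reflʳ-Eq d = Good.tr (τ-good pre (proj₂ (sym-Eq (Eq-good pre d)))) (roll (inEq d))

  -- Conditional symmetry is no help in proving self-relatedness, so the premises are rebuilt one by
  -- one; `Equiv` of the right-hand types is a type by replacement.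
  reflʳ-V : ∀ κ {Ψ A B φ} → VTy (τ κ) Ψ A B φ → T κ Ψ B B
  reflʳ-V κ (vᵀ β α η b cb a ca q t e) = _ , rollV κ (vᵀ β α η (reflʳᵖ b) cb (λ ψ h → reflʳᵖ (a ψ h)) ca
    (λ ψ h → replaceʳ-Equiv κ (PTy-good κ (a ψ h)) (PTy-subst (PTy-good κ b) ψ) (q ψ h))
    (λ ψ h → TmPER.reflʳ (cperᵖ (q ψ h)) (t ψ h)) ≃-refl)
    where open PTyEq κ

  reflʳ-Fcom : ∀ κ {Ψ A B φ} → Fcom (τ Kan) Ψ A B φ → T κ Ψ B B
  reflʳ-Fcom κ {Ψ} (fcomᵀ {r = r} {A = A} {A′} {ξ} {B} {B′} α β v a ca b cb s e) = _ , rollFcom κ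
    (fcomᵀ α (λ ψ i j → β ψ i i) v (reflʳᵖ a) ca (λ i j ψ h h′ → transᵖ (symᵖ (b i i ψ h h)) (b i j ψ h h′))
           (λ i j ψ h h′ → cb i i ψ h h) base-eq ≃-refl)
    where
    open PTyEq Kan
    base-eq : ∀ {Ψ′} i (ψ : Ψ′ ⇒ Ψ) → Holds (lookup ξ i ⟪ ψ ⟫ᵉ) →
              SomePTy (τ Kan) Ψ′ (lookup B′ i ⟨ r ⟩ ⟪ ψ ⟫) (A′ ⟪ ψ ⟫)
    -- The chain is `B′ i ⟨ r ⟩ ≐ B i ⟨ r ⟩ ≐ A ≐ A′`, all under `ψ`.
    base-eq i ψ h with somePTy γ p ← s i ψ h = somePTy _
      (PTy-≡ (sym (⟨⟩-⟪⟫ (lookup B′ i) r ψ)) refl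
        (transᵖ (symᵖ (b i i (r ⟪ ψ ⟫ᵈ ∷ ψ) active active)) (transᵖ (PTy-≡ (⟨⟩-⟪⟫ (lookup B i) r ψ) refl p) (PTy-subst a ψ))))
      where
      active : Active ξ i (r ⟪ ψ ⟫ᵈ ∷ ψ)
      active = Holds-∷ (lookup ξ i) (r ⟪ ψ ⟫ᵈ) ψ h

  -- Supplies the hypothesis of `csym`, and so turns `_≈_` into a partial equivalence relation
  -- without side condition.
  τ-reflʳ : ∀ κ {Ψ A B φ} → τ κ Ψ A B φ → T κ Ψ B B
  τ-reflʳ pre (roll (inFun d))               = reflʳ-Fun pre d
  τ-reflʳ pre (roll (inPair d))              = reflʳ-Pair pre d
  τ-reflʳ pre (roll (inPath d))              = reflʳ-Path pre d
  τ-reflʳ pre (roll (inEq d))                = reflʳ-Eq d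
  τ-reflʳ pre (roll (inV d))                 = reflʳ-V pre d
  τ-reflʳ pre (roll (inFcom d))              = reflʳ-Fcom pre d
  τ-reflʳ pre d@(roll (inVoid (voidᵀ _)))    = _ , d
  τ-reflʳ pre d@(roll (inNat (natᵀ _)))      = _ , d
  τ-reflʳ pre d@(roll (inBool (boolᵀ _)))    = _ , d
  τ-reflʳ pre d@(roll (inWB (wboolᵀ _)))     = _ , d
  τ-reflʳ pre d@(roll (inCirc (S¹ᵀ _)))      = _ , d
  τ-reflʳ pre d@(roll (inUPre (upreᵀ _)))    = _ , d
  τ-reflʳ pre d@(roll (inUKan (ukanᵀ _)))    = _ , d
  τ-reflʳ Kan (roll (inFun d))               = reflʳ-Fun Kan d
  τ-reflʳ Kan (roll (inPair d))              = reflʳ-Pair Kan d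
  τ-reflʳ Kan (roll (inPath d))              = reflʳ-Path Kan d
  τ-reflʳ Kan (roll (inV d))                 = reflʳ-V Kan d
  τ-reflʳ Kan (roll (inFcom d))              = reflʳ-Fcom Kan d
  τ-reflʳ Kan d@(roll (inVoid (voidᵀ _)))    = _ , d
  τ-reflʳ Kan d@(roll (inNat (natᵀ _)))      = _ , d
  τ-reflʳ Kan d@(roll (inBool (boolᵀ _)))    = _ , d
  τ-reflʳ Kan d@(roll (inWB (wboolᵀ _)))     = _ , d
  τ-reflʳ Kan d@(roll (inCirc (S¹ᵀ _)))      = _ , d
  τ-reflʳ Kan d@(roll (inUKan (ukanᵀ _)))    = _ , d

  module _ (κ : Kind) {Ψ : ℕ} where

    T-cper : E′.CPER (T κ Ψ)
    T-cper (_ , r) = E′.linked (_ , r) (λ (_ , s) → Good.tr (τ-good κ r) s) (λ (_ , s) → Good.csym (τ-good κ r) s)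

    infix 4 _≈_
    _≈_ : Term Ψ 0 → Term Ψ 0 → Set (lsuc ℓ)
    _≈_ = R′.Eval (T κ Ψ)

    ≈-trans : ∀ {A B C} → A ≈ B → B ≈ C → A ≈ C
    ≈-trans p q = E′.Eval-tr (E′.Eval-map T-cper p) q

    ≈-reflʳ : ∀ {A B} → A ≈ B → B ≈ B
    ≈-reflʳ (R′.eval a b (_ , r)) = R′.eval b b (τ-reflʳ κ r)

    ≈-sym : ∀ {A B} → A ≈ B → B ≈ A
    ≈-sym p = E′.Eval-csym (E′.Eval-map T-cper p) (≈-reflʳ p)

    ≈-reflˡ : ∀ {A B} → A ≈ B → A ≈ A
    ≈-reflˡ p = ≈-trans p (≈-sym p)

    ≈-expandˡ : ∀ {A A′ B} → A ⟼ A′ → A′ ≈ B → A ≈ B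
    ≈-expandˡ s (R′.eval a b r) = R′.eval (⟼-⇓ s a) b r

    ≈-expandʳ : ∀ {A B B′} → B ⟼ B′ → A ≈ B′ → A ≈ B
    ≈-expandʳ s (R′.eval a b r) = R′.eval a (⟼-⇓ s b) r

  ≡⇒≈ : ∀ κ {Ψ} {A A′ B B′ : Term Ψ 0} → A ≡ A′ → B ≡ B′ → R′.Eval (T κ Ψ) A B → R′.Eval (T κ Ψ) A′ B′
  ≡⇒≈ κ refl refl p = p

  Stable : Kind → ∀ {Ψ} → Term Ψ 0 → Term Ψ 0 → Set (lsuc ℓ)
  Stable κ {Ψ} A B = ∀ {Ψ′} (ψ : Ψ′ ⇒ Ψ) → R′.Eval (T κ Ψ′) (A ⟪ ψ ⟫) (B ⟪ ψ ⟫)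

  Commutes : Kind → ∀ {Ψ} → Term Ψ 0 → Set (lsuc ℓ)
  Commutes κ {Ψ} A = ∀ {Ψ₁ Ψ₂ A₁} (ψ₁ : Ψ₁ ⇒ Ψ) (ψ₂ : Ψ₂ ⇒ Ψ₁) → A ⟪ ψ₁ ⟫ ⇓ A₁ →
                     R′.Eval (T κ Ψ₂) (A₁ ⟪ ψ₂ ⟫) (A ⟪ ψ₁ ⟫ ⟪ ψ₂ ⟫)

  module _ (κ : Kind) {Ψ} {A B : Term Ψ 0} (st : Stable κ A B) where

    -- The two values are compared by way of the unevaluated terms: `A₁ ⟪ ψ₂ ⟫` to `A`, from there
    -- to `B` by stability, and on to `B₁ ⟪ ψ₂ ⟫`.
    stable-Tm : Commutes κ A → Commutes κ B → R′.Tm (λ {Ψ′} _ → T κ Ψ′) A B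
    stable-Tm cA cB ψ₁ ψ₂ with R′.eval a b _ ← st ψ₁ =
      R′.tmAt a b (cA ψ₁ ψ₂ a) (≈-sym κ (cA ψ₁ ψ₂ a)) (cB ψ₁ ψ₂ b) (≈-sym κ (cB ψ₁ ψ₂ b))
        (≈-trans κ (cA ψ₁ ψ₂ a) (≈-trans κ
          (≡⇒≈ κ (sym (⟪⟫-⨾ A ψ₁ ψ₂)) (sym (⟪⟫-⨾ B ψ₁ ψ₂)) (st (ψ₁ ⨾ ψ₂))) (≈-sym κ (cB ψ₁ ψ₂ b))))

    value-commutes : ∀ {Ψ₁ Ψ₂ A₁} (ψ₁ : Ψ₁ ⇒ Ψ) (ψ₂ : Ψ₂ ⇒ Ψ₁) → Val (A ⟪ ψ₁ ⟫) → A ⟪ ψ₁ ⟫ ⇓ A₁ →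
                     R′.Eval (T κ Ψ₂) (A₁ ⟪ ψ₂ ⟫) (A ⟪ ψ₁ ⟫ ⟪ ψ₂ ⟫)
    value-commutes ψ₁ ψ₂ v a with refl ← value-⇓ v a =
      ≡⇒≈ κ (sym (⟪⟫-⨾ A ψ₁ ψ₂)) (sym (⟪⟫-⨾ A ψ₁ ψ₂)) (≈-reflˡ κ (st (ψ₁ ⨾ ψ₂)))

  value-≈ : ∀ κ {Ψ} {A B : Term Ψ 0} → Val A → Val B → T κ Ψ A B → R′.Eval (T κ Ψ) A B
  value-≈ κ v w r = R′.eval (stop , v) (stop , w) r

  -- Asking for `commutes` on the left alone halves the case analysis: the right-hand side is
  -- covered by applying the result to `B ≐ B`.
  record Coherent (κ : Kind) {Ψ : ℕ} (A B : Term Ψ 0) : Set (lsuc ℓ) where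
    constructor coherent
    field
      stable   : Stable κ A B
      commutes : Commutes κ A

  -- Settles every type former except V and fcom, whose values may start to reduce after a
  -- substitution.
  value-coherent : ∀ κ {Ψ} {A B : Term Ψ 0} →
                   (∀ {Ψ′} (ψ : Ψ′ ⇒ Ψ) → Val (A ⟪ ψ ⟫) × Val (B ⟪ ψ ⟫) × T κ Ψ′ (A ⟪ ψ ⟫) (B ⟪ ψ ⟫)) →
                   Coherent κ A B
  value-coherent κ {A = A} {B} f = coherent st (λ ψ₁ ψ₂ → value-commutes κ st ψ₁ ψ₂ (proj₁ (f ψ₁)))
    where
    st : Stable κ A B
    st ψ with v , w , r ← f ψ = value-≈ κ v w r

  coherent-Fun : ∀ κ {Ψ A B φ} → Fun (τ κ) Ψ A B φ → Coherent κ A B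
  coherent-Fun κ d@(funᵀ _ _ _ _ _ _ _) = value-coherent κ λ ψ →
    Π-val , Π-val , _ , rollFun κ (proj₂ (subst-Fun ψ d))

  coherent-Pair : ∀ κ {Ψ A B φ} → Pair (τ κ) Ψ A B φ → Coherent κ A B
  coherent-Pair κ d@(pairᵀ _ _ _ _ _ _ _) = value-coherent κ λ ψ →
    Σ-val , Σ-val , _ , rollPair κ (proj₂ (subst-Pair ψ d))

  coherent-Path : ∀ κ {Ψ A B φ} → Path (τ κ) Ψ A B φ → Coherent κ A B
  coherent-Path κ d@(pathᵀ _ _ _ _ _) = value-coherent κ λ ψ →
    Path-val , Path-val , _ , rollPath κ (proj₂ (subst-Path ψ d))

  coherent-Eq : ∀ {Ψ A B φ} → Eq (τ pre) Ψ A B φ → Coherent pre A B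
  coherent-Eq d@(eqᵀ _ _ _ _ _ _) = value-coherent pre λ ψ →
    Eq-val , Eq-val , _ , roll (inEq (proj₂ (subst-Eq ψ d)))

  -- Once `ψ` sends `x` to a constant, the type steps to `A` or `B`, and the premise at that same
  -- `ψ` provides both equality and coherence.
  coherent-V : ∀ κ {Ψ A B φ} → VTy (τ κ) Ψ A B φ → Coherent κ A B
  coherent-V κ {Ψ} d@(vᵀ {x} {A} {A′} {B} {B′} {E} {E′} β α η b cb a ca q t e) = coherent st commutes
    where
    open PTyEq κ
    st : Stable κ (V (name x) A B E) (V (name x) A′ B′ E′)
    st ψ with lookup ψ x in eq
    ... | 𝟎      = ≈-expandˡ κ V-0 (≈-expandʳ κ V-0 (PTy⇒T (a ψ eq)))
    ... | 𝟏      = ≈-expandˡ κ V-1 (≈-expandʳ κ V-1 (PTy⇒T (PTy-subst b ψ)))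
    ... | name y = value-≈ κ V-val V-val (_ , rollV κ (proj₂ (subst-V ψ eq d)))

    commutes : Commutes κ (V (name x) A B E)
    commutes ψ₁ ψ₂ m with lookup ψ₁ x in eq | value-commutes κ st ψ₁ ψ₂ | m
    ... | 𝟎      | _ | m′ = ≈-expandʳ κ V-0 (PTy⇒coh (a ψ₁ eq) (⟼-⇓⁻¹ V-0 m′) ψ₂)
    ... | 𝟏      | _ | m′ = ≈-expandʳ κ V-1 (PTy⇒coh (PTy-subst b ψ₁) (⟼-⇓⁻¹ V-1 m′) ψ₂)
    ... | name y | f | m′ = f V-val m′

  -- The difficulty is that the face that fires is not stable: a tube that is least under `ψ₁` may
  -- be overtaken by an earlier tube, or by the cap, under `ψ₁ ⨾ ψ₂`. So `tube-≈` compares any face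
  -- that holds with the fcom itself, whichever rule the fcom then reduces by.
  module FcomCoherence (κ : Kind) {Ψ k} {r r′ : Dim Ψ} {A A′ : Term Ψ 0} {ξ : Vec (Eqn Ψ) k}
    {B B′ : Vec (Term (suc Ψ) 0) k} {φ} (d : Fcom (τ Kan) Ψ (fcom r r′ A ξ B) (fcom r r′ A′ ξ B′) φ) where

    open PTyEq Kan

    private
      F F′ : Term Ψ 0
      F  = fcom r r′ A ξ B
      F′ = fcom r r′ A′ ξ B′

      _≈′_ : ∀ {Ψ} → Term Ψ 0 → Term Ψ 0 → Set (lsuc ℓ)
      _≈′_ {Ψ} = R′.Eval (T κ Ψ)

      embed : ∀ {Ψ} {A B : Term Ψ 0} → R′.Eval (T Kan Ψ) A B → A ≈′ B
      embed = E′.Eval-map (Kan⊆ κ)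

    viewAt : ∀ {Ψ′} (ψ : Ψ′ ⇒ Ψ) → View (r ⟪ ψ ⟫ᵈ) (r′ ⟪ ψ ⟫ᵈ) (map (_⟪ ψ ⟫ᵉ) ξ)
    viewAt ψ = view _ _ _

    holds : ∀ {Ψ′} j (ψ : Ψ′ ⇒ Ψ) → Holds (lookup (map (_⟪ ψ ⟫ᵉ) ξ) j) → Holds (lookup ξ j ⟪ ψ ⟫ᵉ)
    holds j ψ = subst Holds (lookup-map j _ ξ)

    -- B_j⟨r′/y⟩ψ
    end : ∀ {Ψ′} → Vec (Term (suc Ψ) 0) k → Fin k → Ψ′ ⇒ Ψ → Term Ψ′ 0
    end B j ψ = lookup B j ⟪ r′ ⟪ ψ ⟫ᵈ ∷ ψ ⟫

    tube-step : ∀ {Ψ′} {A : Term Ψ 0} B (ψ : Ψ′ ⇒ Ψ) j → r ⟪ ψ ⟫ᵈ ≢ r′ ⟪ ψ ⟫ᵈ → Least (map (_⟪ ψ ⟫ᵉ) ξ) j →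
                fcom r r′ A ξ B ⟪ ψ ⟫ ⟼ end B j ψ
    tube-step B ψ j ¬h l = subst (_ ⟼_)
      (trans (cong (_⟨ r′ ⟪ ψ ⟫ᵈ ⟩) (lookup-actVec (lift ψ) [] B j)) (⟪⟫-at (lookup B j) ψ (r′ ⟪ ψ ⟫ᵈ)))
      (fcom-tube j ¬h l)

    end-⟪⟫ : ∀ {Ψ₁ Ψ₂} j (ψ₁ : Ψ₁ ⇒ Ψ) (ψ₂ : Ψ₂ ⇒ Ψ₁) → end B j ψ₁ ⟪ ψ₂ ⟫ ≡ end B j (ψ₁ ⨾ ψ₂)
    end-⟪⟫ j ψ₁ ψ₂ = trans (⟪⟫-⨾ (lookup B j) _ ψ₂) (cong (λ s → lookup B j ⟪ s ∷ ψ₁ ⨾ ψ₂ ⟫) (⟪⟫ᵈ-⨾ r′ ψ₁ ψ₂))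

    base-≐ : SomePTy (τ Kan) Ψ A A′
    base-≐ = base-of d
      where
      base-of : Fcom (τ Kan) Ψ F F′ φ → SomePTy (τ Kan) Ψ A A′
      base-of (fcomᵀ α _ _ a _ _ _ _ _) = somePTy α a

    end-≐′ : ∀ {Ψ′} i j (ψ : Ψ′ ⇒ Ψ) → Holds (lookup ξ i ⟪ ψ ⟫ᵉ) → Holds (lookup ξ j ⟪ ψ ⟫ᵉ) →
             SomePTy (τ Kan) Ψ′ (end B i ψ) (end B′ j ψ)
    end-≐′ i j ψ h h′ = end-of d
      where
      end-of : Fcom (τ Kan) Ψ F F′ φ → SomePTy (τ Kan) _ (end B i ψ) (end B′ j ψ)
      end-of (fcomᵀ _ β _ _ _ b _ _ _) =
        somePTy _ (b i j _ (Holds-∷ (lookup ξ i) _ ψ h) (Holds-∷ (lookup ξ j) _ ψ h′))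

    end-≐ : ∀ {Ψ′} i j (ψ : Ψ′ ⇒ Ψ) → Holds (lookup ξ i ⟪ ψ ⟫ᵉ) → Holds (lookup ξ j ⟪ ψ ⟫ᵉ) →
            SomePTy (τ Kan) Ψ′ (end B i ψ) (end B j ψ)
    end-≐ i j ψ h h′ = somePTy _ (transᵖ (SomePTy.pty (end-≐′ i j ψ h h′)) (symᵖ (SomePTy.pty (end-≐′ j j ψ h′ h′))))

    end-≐-base : ∀ {Ψ′} i (ψ : Ψ′ ⇒ Ψ) → Holds (lookup ξ i ⟪ ψ ⟫ᵉ) → r ⟪ ψ ⟫ᵈ ≡ r′ ⟪ ψ ⟫ᵈ →
                 SomePTy (τ Kan) Ψ′ (end B i ψ) (A ⟪ ψ ⟫)
    end-≐-base i ψ h r≡r′ = start-of d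
      where
      start≡end : lookup B i ⟨ r ⟩ ⟪ ψ ⟫ ≡ end B i ψ
      start≡end = trans (⟨⟩-⟪⟫ (lookup B i) r ψ) (cong (λ s → lookup B i ⟪ s ∷ ψ ⟫) r≡r′)
      start-of : Fcom (τ Kan) Ψ F F′ φ → SomePTy (τ Kan) _ (end B i ψ) (A ⟪ ψ ⟫)
      start-of (fcomᵀ _ _ _ _ _ _ _ s _) with somePTy γ p ← s i ψ h = somePTy γ (PTy-≡ start≡end refl p)

    cap-≈ : ∀ {Ψ′} (ψ : Ψ′ ⇒ Ψ) → r ⟪ ψ ⟫ᵈ ≡ r′ ⟪ ψ ⟫ᵈ → (A ⟪ ψ ⟫) ≈′ (F ⟪ ψ ⟫)
    cap-≈ ψ h = ≈-expandʳ κ (fcom-cap h) (≈-reflˡ κ (embed (PTy⇒T (PTy-subst (SomePTy.pty base-≐) ψ))))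

    tube-≈ : ∀ {Ψ′} j (ψ : Ψ′ ⇒ Ψ) → Holds (lookup ξ j ⟪ ψ ⟫ᵉ) → end B j ψ ≈′ (F ⟪ ψ ⟫)
    tube-≈ j ψ h with viewAt ψ
    ... | cap-view r≡r′    = ≈-expandʳ κ (fcom-cap r≡r′) (embed (PTy⇒T (SomePTy.pty (end-≐-base j ψ h r≡r′))))
    ... | tube-view ¬h i l = ≈-expandʳ κ (tube-step B ψ i ¬h l)
                               (embed (PTy⇒T (SomePTy.pty (end-≐ j i ψ h (holds i ψ (proj₁ l))))))
    ... | value-view _ ap  = ⊥-elim (ap j (subst Holds (sym (lookup-map j _ ξ)) h))

    st : Stable κ F F′
    st ψ with viewAt ψ
    ... | cap-view h       = ≈-expandˡ κ (fcom-cap h) (≈-expandʳ κ (fcom-cap h)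
                               (embed (PTy⇒T (PTy-subst (SomePTy.pty base-≐) ψ))))
    ... | tube-view ¬h j l = ≈-expandˡ κ (tube-step B ψ j ¬h l) (≈-expandʳ κ (tube-step B′ ψ j ¬h l)
                               (embed (PTy⇒T (SomePTy.pty (end-≐′ j j ψ (holds j ψ (proj₁ l)) (holds j ψ (proj₁ l)))))))
    ... | value-view ¬h ap = value-≈ κ (fcom-val ¬h ap) (fcom-val ¬h ap)
                               (_ , rollFcom κ (proj₂ (subst-Fcom ψ ¬h ap d)))

    commutes : Commutes κ F
    commutes ψ₁ ψ₂ m with viewAt ψ₁
    ... | cap-view h       = ≈-trans κ (embed (PTy⇒coh (PTy-subst (SomePTy.pty base-≐) ψ₁) (⟼-⇓⁻¹ (fcom-cap h) m) ψ₂))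
      (≡⇒≈ κ (sym (⟪⟫-⨾ A ψ₁ ψ₂)) (sym (⟪⟫-⨾ F ψ₁ ψ₂)) (cap-≈ (ψ₁ ⨾ ψ₂) (Holds-⨾ (r , r′) ψ₁ ψ₂ (cong (_⟪ ψ₂ ⟫ᵈ) h))))
    ... | tube-view ¬h j l =
      ≈-trans κ (embed (PTy⇒coh (SomePTy.pty (end-≐ j j ψ₁ hⱼ hⱼ)) (⟼-⇓⁻¹ (tube-step B ψ₁ j ¬h l) m) ψ₂))
        (≡⇒≈ κ (sym (end-⟪⟫ j ψ₁ ψ₂)) (sym (⟪⟫-⨾ F ψ₁ ψ₂))
          (tube-≈ j (ψ₁ ⨾ ψ₂) (Holds-⨾ (lookup ξ j) ψ₁ ψ₂ (cong (_⟪ ψ₂ ⟫ᵈ) hⱼ))))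
      where
      hⱼ = holds j ψ₁ (proj₁ l)
    ... | value-view ¬h ap = value-commutes κ {A = F} {F′} st ψ₁ ψ₂ (fcom-val ¬h ap) m

  coherent-Fcom : ∀ κ {Ψ A B φ} → Fcom (τ Kan) Ψ A B φ → Coherent κ A B
  coherent-Fcom κ d@(fcomᵀ {r = r} {r′} _ _ _ _ _ _ _ _ _) = coherent st commutes
    where open FcomCoherence κ {r = r} {r′} d

  τ-coherent : ∀ κ {Ψ A B φ} → τ κ Ψ A B φ → Coherent κ A B
  τ-coherent pre (roll (inFun d))              = coherent-Fun pre d
  τ-coherent pre (roll (inPair d))             = coherent-Pair pre d
  τ-coherent pre (roll (inPath d))             = coherent-Path pre d
  τ-coherent pre (roll (inEq d))               = coherent-Eq d
  τ-coherent pre (roll (inV d))                = coherent-V pre d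
  τ-coherent pre (roll (inFcom d))             = coherent-Fcom pre d
  τ-coherent pre (roll (inVoid (voidᵀ _)))     =
    value-coherent pre λ _ → void-val , void-val , _ , rollVoid pre (voidᵀ ≃-refl)
  τ-coherent pre (roll (inNat (natᵀ _)))       =
    value-coherent pre λ _ → nat-val , nat-val , _ , rollNat pre (natᵀ ≃-refl)
  τ-coherent pre (roll (inBool (boolᵀ _)))     =
    value-coherent pre λ _ → bool-val , bool-val , _ , rollBool pre (boolᵀ ≃-refl)
  τ-coherent pre (roll (inWB (wboolᵀ _)))      =
    value-coherent pre λ _ → wbool-val , wbool-val , _ , rollWB pre (wboolᵀ ≃-refl)
  τ-coherent pre (roll (inCirc (S¹ᵀ _)))       =
    value-coherent pre λ _ → S¹-val , S¹-val , _ , rollCirc pre (S¹ᵀ ≃-refl)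
  τ-coherent pre (roll (inUPre (upreᵀ u)))     =
    value-coherent pre λ _ → U-val , U-val , _ , roll (inUPre (upreᵀ (proj₂ (ν-mono u))))
  τ-coherent pre (roll (inUKan (ukanᵀ u)))     =
    value-coherent pre λ _ → U-val , U-val , _ , rollUKan pre (ukanᵀ (proj₂ (ν-mono u)))
  τ-coherent Kan (roll (inFun d))              = coherent-Fun Kan d
  τ-coherent Kan (roll (inPair d))             = coherent-Pair Kan d
  τ-coherent Kan (roll (inPath d))             = coherent-Path Kan d
  τ-coherent Kan (roll (inV d))                = coherent-V Kan d
  τ-coherent Kan (roll (inFcom d))             = coherent-Fcom Kan d
  τ-coherent Kan (roll (inVoid (voidᵀ _)))     =
    value-coherent Kan λ _ → void-val , void-val , _ , rollVoid Kan (voidᵀ ≃-refl)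
  τ-coherent Kan (roll (inNat (natᵀ _)))       =
    value-coherent Kan λ _ → nat-val , nat-val , _ , rollNat Kan (natᵀ ≃-refl)
  τ-coherent Kan (roll (inBool (boolᵀ _)))     =
    value-coherent Kan λ _ → bool-val , bool-val , _ , rollBool Kan (boolᵀ ≃-refl)
  τ-coherent Kan (roll (inWB (wboolᵀ _)))      =
    value-coherent Kan λ _ → wbool-val , wbool-val , _ , rollWB Kan (wboolᵀ ≃-refl)
  τ-coherent Kan (roll (inCirc (S¹ᵀ _)))       =
    value-coherent Kan λ _ → S¹-val , S¹-val , _ , rollCirc Kan (S¹ᵀ ≃-refl)
  τ-coherent Kan (roll (inUKan (ukanᵀ u)))     =
    value-coherent Kan λ _ → U-val , U-val , _ , rollUKan Kan (ukanᵀ (proj₂ (ν-mono u)))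

  T-Tm : ∀ κ {Ψ A B} → T κ Ψ A B → R′.Tm {Ψ} (λ {Ψ′} _ → T κ Ψ′) A B
  T-Tm κ (_ , r) = stable-Tm κ (Coherent.stable (τ-coherent κ r))
    (Coherent.commutes (τ-coherent κ r)) (Coherent.commutes (τ-coherent κ (proj₂ (τ-reflʳ κ r))))

-- The hierarchy of universes

-- `universeRel` recurses on the proof of `j <′ n`, so functionality of `νᶠ n` requires these proofs
-- to be unique.
<′-irrelevant : ∀ {m n} (p q : m <′ n) → p ≡ q
<′-irrelevant (≤′-reflexive refl) (≤′-reflexive refl) = refl
<′-irrelevant (≤′-reflexive refl) (≤′-step q)         = ⊥-elim (1+n≰n (≤′⇒≤ q))
<′-irrelevant (≤′-step p)         (≤′-reflexive refl) = ⊥-elim (1+n≰n (≤′⇒≤ p))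
<′-irrelevant (≤′-step p)         (≤′-step q)         = cong ≤′-step (<′-irrelevant p q)

𝒰 : Kind → ∀ n Ψ → Relations.Rel (level (suc n)) Ψ
𝒰 κ n Ψ A B = ∃ λ φ → τᶠ κ n Ψ A B φ

-- By induction on the stage: the largest universe below `suc n` consists of the types of stage `n`,
-- whose closure argument needs `universal n`; the smaller universes are lifted unchanged.
universal : ∀ n → Universal (level n) (νᶠ n)

universeRel-cper : ∀ n {j} (j<n : j <′ n) κ {Ψ} → Elements.CPER (level n) (universeRel n j<n κ Ψ)
universeRel-cper (suc n) (≤′-reflexive refl) κ = Coherence.T-cper (level n) (νᶠ n) (universal n) κ
universeRel-cper (suc n) (≤′-step j<n) κ (liftᴸ r) = Elements.linked (liftᴸ r)
  (λ s → liftᴸ (L.tr (lower s))) (λ s → liftᴸ (L.csym (lower s)))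
  where module L = Elements.Linked (universeRel-cper n j<n κ r)

universal n = record
  { ν-fun  = fun
  ; ν-resp = λ { e (universe j<n κ e′) → universe j<n κ (≃-trans e e′) }
  ; ν-cper = λ { (universe j<n κ e) → CPER-≃ e (universeRel-cper n j<n κ) }
  ; ν-mono = λ { (universe j<n κ e) → _ , universe j<n κ ≃-refl }
  }
  where
  open Elements (level n)
  open Relations (level n)
  fun : ∀ {Ψ A B C φ χ} → νᶠ n Ψ A B φ → νᶠ n Ψ A C χ → φ ≃ χ
  fun (universe p κ e) (universe q .κ e′) with refl ← <′-irrelevant p q = ≃-trans e (≃-sym e′)

raise-νᶠ : ∀ n {Ψ A B φ} → νᶠ n Ψ A B φ → νᶠ (suc n) Ψ A B (Raising.↑_ (level n) (lsuc (level n)) φ)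
-- By definition `universeRel` at `≤′-step j<n` is the lift of the relation at `j<n`.
raise-νᶠ n (universe j<n κ e) = universe (≤′-step j<n) κ (≃↑ e ≃-refl)
  where
  open Elements (lsuc (level n))
  open Raising (level n) (lsuc (level n))

𝒰-suc : ∀ κ n {Ψ A B} → 𝒰 κ n Ψ A B → 𝒰 κ (suc n) Ψ A B
𝒰-suc κ n (_ , r) = _ , raise (νᶠ n) (νᶠ (suc n)) (raise-νᶠ n) (≼-refl κ) r
  where
  open Raising (level n) (lsuc (level n))
  ≼-refl : ∀ κ → κ ≼ κ
  ≼-refl pre = pre≼pre
  ≼-refl Kan = Kan≼ Kan

𝒰-mono : ∀ κ {i j} → i ≤′ j → ∀ {Ψ A B} → 𝒰 κ i Ψ A B → 𝒰 κ j Ψ A B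
𝒰-mono κ (≤′-reflexive refl) r = r
𝒰-mono κ (≤′-step i≤j)       r = 𝒰-suc κ _ (𝒰-mono κ i≤j r)

𝒰-Tm : ∀ κ n {Ψ A B} → 𝒰 κ n Ψ A B → Relations.Tm (level (suc n)) {Ψ} (λ {Ψ′} _ → 𝒰 κ n Ψ′) A B
𝒰-Tm κ n = Coherence.T-Tm (level n) (νᶠ n) (universal n) κ

-- The limit system

module Limit where

  open Relationsω
  open Systemω

  ⟦U⟧ : Kind → ℕ → ∀ {Ψ} → ΨRel Ψ
  ⟦U⟧ κ j {Ψ′ = Ψ′} ψ A B = Liftω (𝒰 κ j Ψ′ A B)

  Eval-map : ∀ {Ψ} {R S : Rel Ψ} → (∀ {M N} → R M N → S M N) → ∀ {M N} → Eval R M N → Eval S M N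
  Eval-map f (eval m n r) = eval m n (f r)

  Tm-map : ∀ {Ψ} {α β : ΨRel Ψ} → (∀ {Ψ′} (ψ : Ψ′ ⇒ Ψ) {M N} → α ψ M N → β ψ M N) →
           ∀ {M N} → Tm α M N → Tm β M N
  Tm-map {α = α} {β} f t ψ₁ ψ₂ = go (t ψ₁ ψ₂)
    where
    go : TmAt α _ _ ψ₁ ψ₂ → TmAt β _ _ ψ₁ ψ₂
    go (tmAt m n a b c d e) =
      tmAt m n (Eval-map (f _) a) (Eval-map (f _) b) (Eval-map (f _) c) (Eval-map (f _) d) (Eval-map (f _) e)

  Tm-liftω : ∀ {ℓ Ψ} {R : ∀ Ψ → Relations.Rel ℓ Ψ} {M N} → Relations.Tm ℓ {Ψ} (λ {Ψ′} _ → R Ψ′) M N →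
             Tm {Ψ} (λ {Ψ′} _ A B → Liftω (R Ψ′ A B)) M N
  Tm-liftω {ℓ} {R = R} t ψ₁ ψ₂ with Relations.tmAt m n a b c d e ← t ψ₁ ψ₂ =
    tmAt m n (up a) (up b) (up c) (up d) (up e)
    where
    up : ∀ {Ψ M N} → Relations.Eval ℓ (R Ψ) M N → Eval (λ A B → Liftω (R Ψ A B)) M N
    up (Relations.eval m n r) = eval m n (liftω r)

  -- The relation is that of a finite stage moved to `Setω`, so its coherence is the one proved for
  -- that stage.
  U-type : ∀ κ j Ψ → Type (τω pre) Ψ (U κ j) (U κ j)
  U-type κ j Ψ = mkType (⟦U⟧ κ j)
    (mkPTy (λ ψ → ev) (λ ψ₁ ψ₂ → ptyAt (stop , U-val) (stop , U-val) _ ev ev ev ev ev))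
    (λ ψ r → Tm-liftω (𝒰-Tm κ j (Liftω.lowerω r)))
    where
    rolled : ∀ κ {Ψ} → τω pre Ψ (U κ j) (U κ j) (⟦U⟧ κ j (idₛ {Ψ}))
    rolled pre = roll (inUPre (upreᵀ (universe j pre (equal (λ r → r) (λ r → r)))))
    rolled Kan = roll (inUKan (ukanᵀ (universe j Kan (equal (λ r → r) (λ r → r)))))
    ev : ∀ {Ψ} → EvalTy (τω pre) Ψ (U κ j) (U κ j) (⟦U⟧ κ j (idₛ {Ψ}))
    ev = eval (stop , U-val) (stop , U-val) (rolled κ)

  -- A hypothesis about elements of `U κ j` comes with a relation of its own choosing; inverting the
  -- derivation exposes it as type equality at stage `j`.
  ⟦U⟧-unique : ∀ κ j {Ψ φ} → EvalTy (τω pre) Ψ (U κ j) (U κ j) φ →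
               ∀ {A B} → φ A B → Liftω (𝒰 κ j Ψ A B)
  ⟦U⟧-unique κ j {Ψ} {φ} (eval a b r) with refl ← value-⇓ U-val a | refl ← value-⇓ U-val b = unroll κ r
    where
    unroll : ∀ κ → τω pre Ψ (U κ j) (U κ j) φ → ∀ {A B} → φ A B → Liftω (𝒰 κ j Ψ A B)
    unroll pre (roll (inUPre (upreᵀ (universe .j .pre e)))) = _≃_.to e
    unroll Kan (roll (inUKan (ukanᵀ (universe .j .Kan e)))) = _≃_.to e

mainTheorem4 : (κ : Kind) (i j : ℕ) → i ≤ j → (Ψ : ℕ) (A B : Term Ψ 0) →
    Systemω.Elem (Systemω.τω pre) Ψ A B (U κ i) →
    Systemω.Elem (Systemω.τω pre) Ψ A B (U κ j)
mainTheorem4 κ i j i≤j Ψ A B (Systemω.mkElem (Systemω.mkType α pty coh) t) = Systemω.mkElem (U-type κ j Ψ)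
  (Tm-map (λ ψ r → liftω (𝒰-mono κ (≤⇒≤′ i≤j) (Liftω.lowerω (⟦U⟧-unique κ i (Systemω.PTy.types pty ψ) r)))) t)
  where open Limit
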